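{- Let $n$ be even and $m,\ell$ positive integers. For $i=1,\ldots,\ell$, let $\mu_i$ be a positive integer, $k_i=\lfloor\mu_im(n-1)/2\rfloor$, and assume $\mu_imK_n$ admits a 2-factorization of type $\mathcal{T}_i=[T_{i,1},\ldots,T_{i,k_i}]$. Let $\mathcal{O}=\{i:\mu_im(n-1)\text{ is odd}\}$ and let $\lambda$ be a positive integer. Then $\lambda K_{n\times m}$ admits a 2-factorization of type $$\bigsqcup_{i=1}^\ell[(mT_{i,1})^{\langle x_i\rangle},\ldots,(mT_{i,k_i})^{\langle x_i\rangle}]\ \sqcup\ [T_1,\ldots,T_{\lfloor\beta/2\rfloor}]$$ for all $(x_1,\ldots,x_\ell)\in\mathbb{N}^\ell$ with $\sum_{i=1}^\ell x_i\mu_i=\lambda$, where $\beta=\sum_{i\in\mathcal{O}}x_i$, and all admissible bipartite 2-factor types $T_1,\ldots,T_{\lfloor\beta/2\rfloor}$ for $2K_{n\times m}$ that are refinements of $[(2m)^{\langle n/2\rangle}]$.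
   Context: $\mu K_n$: complete multigraph on $n$ vertices with $\mu$ parallel edges per pair; $\lambda K_{n\times m}$: complete $\lambda$-fold $n$-partite multigraph with parts of size $m$. A 2-factor is a spanning 2-regular subgraph (2-cycles allowed); type $[c_1,\ldots,c_t]$ means a disjoint union of cycles of those lengths; $mT=[mx:x\in T]$. A 2-factorization of an $r$-regular graph is a decomposition into $\lfloor r/2\rfloor$ 2-factors plus a single 1-factor if $r$ is odd; its type is the multiset of types of its 2-factors. $[x^{\langle a\rangle}]$ denotes $a$ copies of $x$; $\sqcup$ is multiset union. A 2-factor type is bipartite if all entries are even, and admissible for a graph $\mathcal{G}$ if $\mathcal{G}$ contains a 2-factor of that type. A multiset $[y_1,\ldots,y_t]$ of positive integers is a refinement of $[x_1,\ldots,x_s]$ if $\{1,\ldots,t\}$ can be partitioned into sets $P_1,\ldots,P_s$ with $\sum_{j\in P_i}y_j=x_i$ for all $i$. -}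

module Defs where

open import Data.Nat using (ℕ; zero; suc; _+_; _*_; _∸_; _≤_; _%_; _/_; _≡ᵇ_)
open import Data.Bool using (Bool; true; false; if_then_else_; _∧_; _∨_)
open import Data.Fin using (Fin)
open import Data.Fin.Properties using () renaming (_≟_ to _≟F_)
open import Data.Product using (Σ; ∃; _×_; _,_; proj₁; proj₂)
open import Data.Product.Properties using (≡-dec)
open import Data.List using (List; []; _∷_; _++_; length; map; concat; concatMap; replicate; allFin; cartesianProduct)
open import Data.Nat.ListAction using (sum)
open import Data.List.Relation.Unary.All using (All)
open import Data.List.Relation.Binary.Pointwise using (Pointwise)
open import Data.List.Relation.Binary.Permutation.Propositional using (_↭_)
open import Relation.Binary.PropositionalEquality using (_≡_)
open import Relation.Binary.Definitions using (DecidableEquality)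
open import Relation.Nullary.Decidable using (⌊_⌋)

-- Multigraphs (loopless) on a vertex type V: edge multiplicity function.

Multigraph : Set → Set
Multigraph V = V → V → ℕ

mult : {V : Set} → DecidableEquality V → List (V × V) → V → V → ℕ
mult _≟_ [] u v = 0
mult _≟_ ((a , b) ∷ es) u v =
  (if (⌊ a ≟ u ⌋ ∧ ⌊ b ≟ v ⌋) ∨ (⌊ a ≟ v ⌋ ∧ ⌊ b ≟ u ⌋) then 1 else 0)
  + mult _≟_ es u v

closeUp : {V : Set} → V → V → List V → List (V × V)
closeUp first prev []       = (prev , first) ∷ []
closeUp first prev (y ∷ ys) = (prev , y) ∷ closeUp first y ys

-- Edges of a cycle given by its cyclic vertex sequence [v1,…,vc]:
-- v1v2, v2v3, …, vcv1.  For c = 2 this is the 2-cycle (two parallel edges).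
cycleEdges : {V : Set} → List V → List (V × V)
cycleEdges []       = []
cycleEdges (x ∷ xs) = closeUp x x xs

-- A 2-factor is represented as a list of cycles (vertex lists).
TwoFactorData : Set → Set
TwoFactorData V = List (List V)

factorEdges : {V : Set} → TwoFactorData V → List (V × V)
factorEdges F = concatMap cycleEdges F

-- Spanning 2-regular: cycles of length ≥ 2 (2-cycles allowed), vertex
-- disjoint and covering every vertex exactly once (verts lists each
-- vertex exactly once).
IsTwoFactor : {V : Set} → List V → TwoFactorData V → Set
IsTwoFactor verts F = All (λ c → 2 ≤ length c) F × (concat F ↭ verts)

factorType : {V : Set} → TwoFactorData V → List ℕ
factorType F = map length F

IsOneFactor : {V : Set} → List V → List (V × V) → Set
IsOneFactor verts M = concatMap (λ e → proj₁ e ∷ proj₂ e ∷ []) M ↭ verts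

TypeMultisetEq : List (List ℕ) → List (List ℕ) → Set
TypeMultisetEq xs ys = ∃ λ zs → Pointwise _↭_ xs zs × (zs ↭ ys)

record TwoFactorization {V : Set} (_≟_ : DecidableEquality V)
    (verts : List V) (G : Multigraph V) (r : ℕ) : Set where
  field
    factors   : List (TwoFactorData V)
    oneFactor : List (V × V)
    allTwoFactors : All (IsTwoFactor verts) factors
    numFactors    : length factors ≡ r / 2
    oddCase       : r % 2 ≡ 1 → IsOneFactor verts oneFactor
    evenCase      : r % 2 ≡ 0 → oneFactor ≡ []
    decomposes    : ∀ u v →
      G u v ≡ sum (map (λ F → mult _≟_ (factorEdges F) u v) factors)
              + mult _≟_ oneFactor u v

  fType : List (List ℕ)
  fType = map factorType factors

HasTwoFactorizationOfType : {V : Set} → DecidableEquality V → List V →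
  Multigraph V → ℕ → List (List ℕ) → Set
HasTwoFactorizationOfType _≟_ verts G r 𝒯 =
  Σ (TwoFactorization _≟_ verts G r) λ D →
    TypeMultisetEq (TwoFactorization.fType D) 𝒯

Admissible : {V : Set} → DecidableEquality V → List V → Multigraph V →
  List ℕ → Set
Admissible _≟_ verts G T = ∃ λ F →
  IsTwoFactor verts F ×
  (∀ u v → mult _≟_ (factorEdges F) u v ≤ G u v) ×
  (factorType F ↭ T)

Bipartite : List ℕ → Set
Bipartite T = All (λ c → c % 2 ≡ 0) T

Refinement : List ℕ → List ℕ → Set
Refinement ys xs = ∃ λ blocks → (concat blocks ↭ ys) × (map sum blocks ≡ xs)

verticesK : (n : ℕ) → List (Fin n)
verticesK n = allFin n

decK : (n : ℕ) → DecidableEquality (Fin n)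
decK n = _≟F_

completeMulti : (n μ : ℕ) → Multigraph (Fin n)
completeMulti n μ u v = if ⌊ u ≟F v ⌋ then 0 else μ

-- λK_{n×m} on vertex set Fin n × Fin m (part = first coordinate).
decNM : (n m : ℕ) → DecidableEquality (Fin n × Fin m)
decNM n m = ≡-dec _≟F_ _≟F_

verticesNM : (n m : ℕ) → List (Fin n × Fin m)
verticesNM n m = cartesianProduct (allFin n) (allFin m)

completeMultipartite : (n m λ' : ℕ) → Multigraph (Fin n × Fin m)
completeMultipartite n m λ' u v =
  if ⌊ proj₁ u ≟F proj₁ v ⌋ then 0 else λ'

sumFin : (ℓ : ℕ) → (Fin ℓ → ℕ) → ℕ
sumFin ℓ f = sum (map f (allFin ℓ))

isOdd : ℕ → Bool
isOdd k = k % 2 ≡ᵇ 1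

{-# OPTIONS --safe #-}
-- Amalgamate the m vertices of each part: running m times round every cycle of a 2-factorization of
-- μ m Kₙ gives closed trails that use every pair of amalgamated vertices μ m² times.  The amalgamated
-- vertices are then split into their m constituents one vertex α at a time.  Let w still stand for
-- p ≥ 2 vertices.  It cuts each trail through it into p segments, and α takes over one end of each of
-- two different segments S₁, S₂ of that trail; since the trail w S₁ w S₂ R can be rerouted as
-- w S₁⁻¹ α S₂ w R, every trail stays a single closed trail and finally becomes a cycle m times as
-- long as the original one.
-- The ends are chosen so that α receives exactly its share 1/p of the edges from w to every other
-- vertex, which is an equitable choice from rows of equal length obtained by augmenting paths.
-- A 1-factor of μ m Kₙ turns into perfect matchings between the parts it joins.  The 1-factors of two
-- such copies are paired by relabelling one copy: a suitable second matching between the same parts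
-- closes the first one up into cycles with any prescribed even lengths adding up to 2m.
module Submission where

open import Defs
open import Data.Nat using (ℕ; zero; suc; _+_; _*_; _∸_; _≤_; _<_; _<?_; z≤n; s≤s; >-nonZero; _%_; _/_)
open import Data.Nat.Properties hiding (_≟_)
open import Data.Nat.DivMod using (m≡m%n+[m/n]*n; m%n<n; [m+kn]%n≡m%n; m*n/n≡m; +-distrib-/-∣ʳ)
open import Data.Nat.Divisibility using (divides; m%n≡0⇒n∣m)
open import Data.Nat.ListAction using (sum)
open import Data.Nat.ListAction.Properties using (sum-++; sum-↭)
open import Data.Nat.Tactic.RingSolver using (solve-∀)
open import Data.Bool using (true; false; if_then_else_; _∧_; _∨_)
open import Data.Bool.Properties using (∧-comm; ∨-comm)
open import Data.Empty using (⊥-elim)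
open import Data.Unit using (⊤; tt)
open import Data.Fin using (Fin; zero; suc)
open import Data.Fin.Properties as Fin using () renaming (_≟_ to _≟ᶠ_)
open import Data.List using (List; []; _∷_; _++_; _∷ʳ_; length; map; concat; concatMap; replicate; reverse; allFin; cartesianProduct; tabulate; lookup; take; drop)
open import Data.List.Properties using (unfold-reverse; ++-identityʳ; length-++; length-map; length-replicate; length-tabulate; length-take; take++drop≡id; map-++; map-∘; map-id; map-cong; map-tabulate; map-replicate; concat-++; concat-map; concatMap-++; concatMap-map; ∷-injectiveˡ; ∷-injectiveʳ)
open import Data.List.Membership.Propositional using (_∈_; _∉_; lose; find)
open import Data.List.Membership.Propositional.Properties using (∈-∃++; ∈-lookup; ∈-map⁺; ∈-map⁻)
open import Data.List.Relation.Unary.Any as Any using (here; there)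
open import Data.List.Relation.Unary.All as All using (All; []; _∷_)
open import Data.List.Relation.Unary.All.Properties as All using ()
open import Data.List.Relation.Binary.Pointwise as Pointwise using (Pointwise; []; _∷_)
open import Data.List.Relation.Binary.Permutation.Propositional using (_↭_; refl; prep; swap; ↭-sym; ↭-refl; ↭-trans; ↭-reflexive)
open import Data.List.Relation.Binary.Permutation.Propositional.Properties using (shift; shifts; map⁺; ++⁺; ++⁺ˡ; ++-comm; ↭-length; ↭-reverse; All-resp-↭)
open import Data.Product using (Σ; ∃; ∃₂; _×_; _,_; proj₁; proj₂; uncurry) renaming (map to ×-map; swap to ×-swap)
open import Data.Product.Properties using (,-injectiveˡ; ,-injectiveʳ)
open import Data.Sum using (_⊎_; inj₁; inj₂)
open import Data.Sum.Properties as Sum using (inj₁-injective; inj₂-injective)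
open import Function using (_∘_)
open import Relation.Binary.Definitions using (DecidableEquality)
open import Relation.Binary.PropositionalEquality hiding ([_])
open import Relation.Nullary using (¬_; Dec; yes; no; ¬?)
open import Relation.Nullary.Decidable using (⌊_⌋; _×-dec_)

-- An exact share is possible because of the invariant `amalgam`: vertices of different parts that
-- stand for `g u` and `g v` final vertices are joined by `κ * (g u * g v)` edges. For `g w = p` the
-- number of edges from `w` to any `z` outside its part is thus `p` times the integer `κ * g z`, and
-- `w` carries no loops. The obstacle is that the ends given to `α` must meet this global count and
-- at the same time be two per trail, from different segments: both ends of one segment would break
-- off as a separate cycle. So every segment becomes a row of the choice problem, from which at most
-- one end is taken. It has only two ends while the rows need length `p`, hence it is padded with
-- `p - 2` dummies. A trail has `p` segments, so its dummy occurs `p * (p - 2)` times and its share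
-- is `p - 2`: exactly two segments choose a real end. A matching between two parts contributes a
-- single row, the `p` partners of `w`.

-- Occurrence counts in lists.

module Counting {A : Set} (_≟_ : DecidableEquality A) where

  δ : A → A → ℕ
  δ x y = if ⌊ x ≟ y ⌋ then 1 else 0

  δ-refl : ∀ x → δ x x ≡ 1
  δ-refl x with x ≟ x
  ... | yes _ = refl
  ... | no ¬p = ⊥-elim (¬p refl)

  δ-≢ : ∀ {x y} → x ≢ y → δ x y ≡ 0
  δ-≢ {x} {y} ne with x ≟ y
  ... | yes p = ⊥-elim (ne p)
  ... | no _ = refl

  δ-sym : ∀ x y → δ x y ≡ δ y x
  δ-sym x y with x ≟ y
  ... | yes refl = sym (δ-refl x)
  ... | no ne = sym (δ-≢ (λ e → ne (sym e)))

  δ≤1 : ∀ x y → δ x y ≤ 1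
  δ≤1 x y with x ≟ y
  ... | yes _ = ≤-refl
  ... | no _ = z≤n

  count : A → List A → ℕ
  count x [] = 0
  count x (y ∷ ys) = δ y x + count x ys

  count-++ : ∀ x xs ys → count x (xs ++ ys) ≡ count x xs + count x ys
  count-++ x [] ys = refl
  count-++ x (y ∷ xs) ys = trans (cong (δ y x +_) (count-++ x xs ys)) (sym (+-assoc (δ y x) _ _))

  count-concatMap : ∀ {B : Set} x (h : B → List A) bs → count x (concatMap h bs) ≡ sum (map (λ b → count x (h b)) bs)
  count-concatMap x h [] = refl
  count-concatMap x h (b ∷ bs) = trans (count-++ x (h b) _) (cong (count x (h b) +_) (count-concatMap x h bs))

  count-concatMap-↭ : ∀ {B : Set} x (h : B → List A) {bs cs} → bs ↭ cs →
    count x (concatMap h bs) ≡ count x (concatMap h cs)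
  count-concatMap-↭ x h {bs} {cs} p = trans (count-concatMap x h bs)
    (trans (sum-↭ (map⁺ (λ b → count x (h b)) p)) (sym (count-concatMap x h cs)))

  count-↭ : ∀ x {xs ys} → xs ↭ ys → count x xs ≡ count x ys
  count-↭ x refl = refl
  count-↭ x (prep y p) = cong (δ y x +_) (count-↭ x p)
  count-↭ x (swap {xs} {ys} y z p) rewrite count-↭ x p = lemma (δ y x) (δ z x) (count x ys)
    where lemma : ∀ a b c → a + (b + c) ≡ b + (a + c)
          lemma = solve-∀
  count-↭ x (_↭_.trans p q) rewrite count-↭ x p = count-↭ x q

  ∈⇒1≤count : ∀ {x xs} → x ∈ xs → 1 ≤ count x xs
  ∈⇒1≤count {x} (here {xs = xs} refl) rewrite δ-refl x = s≤s z≤n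
  ∈⇒1≤count {x} (there {y} p) = ≤-trans (∈⇒1≤count p) (m≤n+m _ (δ y x))

  1≤count⇒∈ : ∀ {x} xs → 1 ≤ count x xs → x ∈ xs
  1≤count⇒∈ {x} (y ∷ xs) le with y ≟ x
  ... | yes refl = here refl
  ... | no _ = there (1≤count⇒∈ xs le)

  count≡0⇒∉ : ∀ {x} {xs} → count x xs ≡ 0 → x ∉ xs
  count≡0⇒∉ e p with ∈⇒1≤count p
  ... | le rewrite e with le
  ... | ()

  ∉⇒count≡0 : ∀ {x} xs → x ∉ xs → count x xs ≡ 0
  ∉⇒count≡0 {x} xs ne with count x xs in eq
  ... | zero = refl
  ... | suc k = ⊥-elim (ne (1≤count⇒∈ xs (subst (1 ≤_) (sym eq) (s≤s z≤n))))

  count≡⇒↭ : ∀ xs ys → (∀ x → count x xs ≡ count x ys) → xs ↭ ys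
  count≡⇒↭ [] [] h = refl
  count≡⇒↭ [] (y ∷ ys) h with h y
  ... | e rewrite δ-refl y with e
  ... | ()
  count≡⇒↭ (x ∷ xs) ys h
    with ∈-∃++ (1≤count⇒∈ {x} ys (subst (1 ≤_) (h x) (∈⇒1≤count {xs = x ∷ xs} (here refl))))
  ... | as , bs , refl = ↭-trans (prep x (count≡⇒↭ xs (as ++ bs) tail≡)) (↭-sym (shift x as bs))
    where
    tail≡ : ∀ z → count z xs ≡ count z (as ++ bs)
    tail≡ z = +-cancelˡ-≡ (δ x z) _ _
      (trans (h z) (count-↭ z (shift x as bs)))

  count-replicate-≡ : ∀ k x → count x (replicate k x) ≡ k
  count-replicate-≡ zero x = refl
  count-replicate-≡ (suc k) x rewrite δ-refl x | count-replicate-≡ k x = refl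

  count-concat-replicate : ∀ k x xs → count x (concat (replicate k xs)) ≡ k * count x xs
  count-concat-replicate zero x xs = refl
  count-concat-replicate (suc k) x xs
    rewrite count-++ x xs (concat (replicate k xs)) | count-concat-replicate k x xs = refl

-- Edge multiplicities of edge lists and closed walks.

module Multiplicity {V : Set} (_≟_ : DecidableEquality V) where
  open Counting _≟_ public

  Edges : Set
  Edges = List (V × V)

  infix 4 _≈ₑ_
  _≈ₑ_ : Edges → Edges → Set
  es ≈ₑ fs = ∀ u v → mult _≟_ es u v ≡ mult _≟_ fs u v

  ε : V → V → V → V → ℕ
  ε a b u v = if (⌊ a ≟ u ⌋ ∧ ⌊ b ≟ v ⌋) ∨ (⌊ a ≟ v ⌋ ∧ ⌊ b ≟ u ⌋) then 1 else 0

  ε-swap : ∀ a b u v → ε a b u v ≡ ε b a u v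
  ε-swap a b u v = cong (λ t → if t then 1 else 0)
    (trans (∨-comm (⌊ a ≟ u ⌋ ∧ ⌊ b ≟ v ⌋) _)
      (cong₂ _∨_ (∧-comm ⌊ a ≟ v ⌋ _) (∧-comm ⌊ a ≟ u ⌋ _)))

  ε-sym : ∀ a b u v → ε a b u v ≡ ε a b v u
  ε-sym a b u v = cong (λ t → if t then 1 else 0) (∨-comm (⌊ a ≟ u ⌋ ∧ ⌊ b ≟ v ⌋) _)

  ε-refl : ∀ a b → ε a b a b ≡ 1
  ε-refl a b with a ≟ a | b ≟ b
  ... | yes _ | yes _ = refl
  ... | no ne | _ = ⊥-elim (ne refl)
  ... | yes _ | no ne = ⊥-elim (ne refl)

  ε-star : ∀ w x u v → x ≢ w → ε w x u v ≡ δ w u * δ x v + δ w v * δ x u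
  ε-star w x u v ne with w ≟ u | x ≟ v | w ≟ v | x ≟ u
  ... | yes refl | yes refl | yes p | _ = ⊥-elim (ne (sym p))
  ... | yes refl | yes refl | no _ | yes p = ⊥-elim (ne p)
  ... | yes refl | yes refl | no _ | no _ = refl
  ... | yes refl | no _ | yes p | yes q = ⊥-elim (ne q)
  ... | yes refl | no _ | yes p | no q = refl
  ... | yes refl | no _ | no p | yes q = refl
  ... | yes refl | no _ | no p | no q = refl
  ... | no _ | yes _ | yes p | yes q = refl
  ... | no _ | yes _ | yes p | no q = refl
  ... | no _ | yes _ | no p | yes q = refl
  ... | no _ | yes _ | no p | no q = refl
  ... | no _ | no _ | yes p | yes q = refl
  ... | no _ | no _ | yes p | no q = refl
  ... | no _ | no _ | no p | yes q = refl
  ... | no _ | no _ | no p | no q = refl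

  mult-++ : ∀ xs ys u v → mult _≟_ (xs ++ ys) u v ≡ mult _≟_ xs u v + mult _≟_ ys u v
  mult-++ [] ys u v = refl
  mult-++ ((a , b) ∷ xs) ys u v rewrite mult-++ xs ys u v = sym (+-assoc (ε a b u v) _ _)

  mult-concatMap : ∀ {B : Set} (h : B → Edges) bs u v →
    mult _≟_ (concatMap h bs) u v ≡ sum (map (λ b → mult _≟_ (h b) u v) bs)
  mult-concatMap h [] u v = refl
  mult-concatMap h (b ∷ bs) u v = trans (mult-++ (h b) _ u v) (cong (mult _≟_ (h b) u v +_) (mult-concatMap h bs u v))

  mult-concatMap-↭ : ∀ {B : Set} (h : B → Edges) {bs cs} → bs ↭ cs → concatMap h bs ≈ₑ concatMap h cs
  mult-concatMap-↭ h {bs} {cs} p u v = trans (mult-concatMap h bs u v)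
    (trans (sum-↭ (map⁺ (λ b → mult _≟_ (h b) u v) p)) (sym (mult-concatMap h cs u v)))

  mult-sym : ∀ es u v → mult _≟_ es u v ≡ mult _≟_ es v u
  mult-sym [] u v = refl
  mult-sym ((a , b) ∷ es) u v = cong₂ _+_ (ε-sym a b u v) (mult-sym es u v)

  mult-concat-replicate : ∀ k es u v → mult _≟_ (concat (replicate k es)) u v ≡ k * mult _≟_ es u v
  mult-concat-replicate zero es u v = refl
  mult-concat-replicate (suc k) es u v
    rewrite mult-++ es (concat (replicate k es)) u v | mult-concat-replicate k es u v = refl

  star : V → List V → Edges
  star w = map (w ,_)

  mult-star : ∀ w Y u v → count w Y ≡ 0 →
    mult _≟_ (star w Y) u v ≡ δ w u * count v Y + δ w v * count u Y
  mult-star w [] u v h rewrite *-zeroʳ (δ w u) | *-zeroʳ (δ w v) = refl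
  mult-star w (y ∷ Y) u v h
    rewrite mult-star w Y u v (m+n≡0⇒n≡0 (δ y w) h)
          | ε-star w y u v (λ { refl → 1+n≢0 (trans (cong (_+ count y Y) (sym (δ-refl y))) h) })
    = lemma (δ w u) (δ w v) (δ y v) (δ y u) (count v Y) (count u Y)
    where lemma : ∀ a b c d e f → a * c + b * d + (a * e + b * f) ≡ a * (c + e) + b * (d + f)
          lemma = solve-∀

  closeUp-++ : ∀ (f x : V) xs y ys → closeUp f x (xs ++ y ∷ ys) ≡ closeUp y x xs ++ closeUp f y ys
  closeUp-++ f x [] y ys = refl
  closeUp-++ f x (z ∷ xs) y ys = cong ((x , z) ∷_) (closeUp-++ f z xs y ys)

  -- A path walked backwards has the same edges, with its two attachment vertices exchanged. This is
  -- what allows a segment hanging between two vertices to be turned round.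
  closeUp-reverse : ∀ (f x : V) s → closeUp f x (reverse s) ≈ₑ closeUp x f s
  closeUp-reverse f x [] u v = cong (_+ 0) (ε-swap x f u v)
  closeUp-reverse f x (y ∷ s) u v = begin
    mult _≟_ (closeUp f x (reverse (y ∷ s))) u v
      ≡⟨ cong (λ t → mult _≟_ (closeUp f x t) u v) (unfold-reverse y s) ⟩
    mult _≟_ (closeUp f x (reverse s ∷ʳ y)) u v
      ≡⟨ cong (λ t → mult _≟_ t u v) (closeUp-++ f x (reverse s) y []) ⟩
    mult _≟_ (closeUp y x (reverse s) ++ (y , f) ∷ []) u v
      ≡⟨ mult-++ (closeUp y x (reverse s)) ((y , f) ∷ []) u v ⟩
    mult _≟_ (closeUp y x (reverse s)) u v + (ε y f u v + 0)
      ≡⟨ cong₂ (λ p q → p + (q + 0)) (closeUp-reverse y x s u v) (ε-swap y f u v) ⟩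
    mult _≟_ (closeUp x y s) u v + (ε f y u v + 0)
      ≡⟨ lemma (mult _≟_ (closeUp x y s) u v) (ε f y u v) ⟩
    ε f y u v + mult _≟_ (closeUp x y s) u v ∎
    where
    open ≡-Reasoning
    lemma : ∀ a b → a + (b + 0) ≡ b + a
    lemma = solve-∀

  cycleEdges-rotate : ∀ (pre : List V) w post → cycleEdges (pre ++ w ∷ post) ≈ₑ closeUp w w (post ++ pre)
  cycleEdges-rotate [] w post u v rewrite ++-identityʳ post = refl
  cycleEdges-rotate (x ∷ pre) w post u v
    rewrite closeUp-++ x x pre w post | closeUp-++ w w post x pre
          | mult-++ (closeUp w x pre) (closeUp x w post) u v
          | mult-++ (closeUp x w post) (closeUp w x pre) u v
    = +-comm (mult _≟_ (closeUp w x pre) u v) _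

-- Finite sums over rows and over columns.

ΣF : (R : ℕ) → (Fin R → ℕ) → ℕ
ΣF zero f = 0
ΣF (suc R) f = f zero + ΣF R (f ∘ suc)

ΣF-cong : ∀ R {f g : Fin R → ℕ} → (∀ r → f r ≡ g r) → ΣF R f ≡ ΣF R g
ΣF-cong zero h = refl
ΣF-cong (suc R) h = cong₂ _+_ (h zero) (ΣF-cong R (h ∘ suc))

ΣF-mono : ∀ R {f g : Fin R → ℕ} → (∀ r → f r ≤ g r) → ΣF R f ≤ ΣF R g
ΣF-mono zero h = z≤n
ΣF-mono (suc R) h = +-mono-≤ (h zero) (ΣF-mono R (h ∘ suc))

ΣF-zero : ∀ R → ΣF R (λ _ → 0) ≡ 0
ΣF-zero zero = refl
ΣF-zero (suc R) = ΣF-zero R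

ΣF-ones : ∀ R → ΣF R (λ _ → 1) ≡ R
ΣF-ones zero = refl
ΣF-ones (suc R) = cong suc (ΣF-ones R)

ΣF-+ : ∀ R (f g : Fin R → ℕ) → ΣF R (λ r → f r + g r) ≡ ΣF R f + ΣF R g
ΣF-+ zero f g = refl
ΣF-+ (suc R) f g rewrite ΣF-+ R (f ∘ suc) (g ∘ suc) = lemma (f zero) (g zero) (ΣF R (f ∘ suc)) (ΣF R (g ∘ suc))
  where lemma : ∀ a b c d → a + b + (c + d) ≡ a + c + (b + d)
        lemma = solve-∀

ΣF-* : ∀ R p (f : Fin R → ℕ) → ΣF R (λ r → p * f r) ≡ p * ΣF R f
ΣF-* zero p f = sym (*-zeroʳ p)
ΣF-* (suc R) p f rewrite ΣF-* R p (f ∘ suc) = sym (*-distribˡ-+ p (f zero) _)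

ΣF-sum : ∀ {B : Set} R (h : Fin R → B → ℕ) (K : List B) →
  ΣF R (λ r → sum (map (h r) K)) ≡ sum (map (λ c → ΣF R (λ r → h r c)) K)
ΣF-sum R h [] = ΣF-zero R
ΣF-sum R h (c ∷ K) = trans (ΣF-+ R (λ r → h r c) _) (cong (ΣF R (λ r → h r c) +_) (ΣF-sum R h K))

module _ {B : Set} where

  sum-map-mono : ∀ {f g : B → ℕ} (K : List B) → (∀ c → c ∈ K → f c ≤ g c) → sum (map f K) ≤ sum (map g K)
  sum-map-mono [] h = z≤n
  sum-map-mono (c ∷ K) h = +-mono-≤ (h c (here refl)) (sum-map-mono K (λ c' p → h c' (there p)))

  sum-map-cong : ∀ {f g : B → ℕ} (K : List B) → (∀ c → f c ≡ g c) → sum (map f K) ≡ sum (map g K)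
  sum-map-cong [] h = refl
  sum-map-cong (c ∷ K) h = cong₂ _+_ (h c) (sum-map-cong K h)

  sum-map-+ : ∀ (f g : B → ℕ) (K : List B) → sum (map (λ c → f c + g c) K) ≡ sum (map f K) + sum (map g K)
  sum-map-+ f g [] = refl
  sum-map-+ f g (c ∷ K) rewrite sum-map-+ f g K = lemma (f c) (g c) (sum (map f K)) (sum (map g K))
    where lemma : ∀ a b c d → a + b + (c + d) ≡ a + c + (b + d)
          lemma = solve-∀

  sum-map-* : ∀ p (f : B → ℕ) (K : List B) → sum (map (λ c → p * f c) K) ≡ p * sum (map f K)
  sum-map-* p f [] = sym (*-zeroʳ p)
  sum-map-* p f (c ∷ K) rewrite sum-map-* p f K = sym (*-distribˡ-+ p (f c) _)

  sum-map-const : ∀ p (K : List B) → sum (map (λ _ → p) K) ≡ length K * p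
  sum-map-const p [] = refl
  sum-map-const p (c ∷ K) = cong (p +_) (sum-map-const p K)

  sum-map-zero : ∀ (K : List B) → sum (map (λ _ → 0) K) ≡ 0
  sum-map-zero [] = refl
  sum-map-zero (c ∷ K) = sum-map-zero K

-- Equitable choice from rows by augmenting paths.

module Rounding {C : Set} (_≟_ : DecidableEquality C) where
  open Counting _≟_
  open import Data.List.Membership.DecPropositional _≟_ using (_∈?_)

  count-as-sum : ∀ x K → count x K ≡ sum (map (λ c → δ c x) K)
  count-as-sum x [] = refl
  count-as-sum x (c ∷ K) = cong (δ c x +_) (count-as-sum x K)

  sum-count-comm : ∀ xs K → sum (map (λ x → count x K) xs) ≡ sum (map (λ c → count c xs) K)
  sum-count-comm [] K = sym (sum-map-zero K)
  sum-count-comm (x ∷ xs) K = begin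
    count x K + sum (map (λ y → count y K) xs)
      ≡⟨ cong₂ _+_ (trans (count-as-sum x K) (sum-map-cong K (λ c → δ-sym c x))) (sum-count-comm xs K) ⟩
    sum (map (δ x) K) + sum (map (λ c → count c xs) K)
      ≡⟨ sum-map-+ (δ x) (λ c → count c xs) K ⟨
    sum (map (λ c → count c (x ∷ xs)) K) ∎
    where open ≡-Reasoning

  countF : {R : ℕ} → C → (Fin R → C) → ℕ
  countF {R} c f = ΣF R (λ r → δ (f r) c)

  sum-countF : ∀ {R} (f : Fin R → C) K → ΣF R (λ r → count (f r) K) ≡ sum (map (λ c → countF c f) K)
  sum-countF {R} f K = trans
    (ΣF-cong R (λ r → trans (count-as-sum (f r) K) (sum-map-cong K (λ c → δ-sym c (f r)))))
    (ΣF-sum R (λ r c → δ (f r) c) K)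

  update : {R : ℕ} → (Fin R → C) → Fin R → C → Fin R → C
  update f zero d zero = d
  update f zero d (suc i) = f (suc i)
  update f (suc r) d zero = f zero
  update f (suc r) d (suc i) = update (f ∘ suc) r d i

  update-elim : ∀ {R} (P : Fin R → C → Set) f r d → P r d → (∀ i → P i (f i)) → ∀ i → P i (update f r d i)
  update-elim P f zero d pd pf zero = pd
  update-elim P f zero d pd pf (suc i) = pf (suc i)
  update-elim P f (suc r) d pd pf zero = pf zero
  update-elim P f (suc r) d pd pf (suc i) = update-elim (P ∘ suc) (f ∘ suc) r d pd (pf ∘ suc) i

  update-other : ∀ {R} (f : Fin R → C) r d i → i ≢ r → update f r d i ≡ f i
  update-other f zero d zero ne = ⊥-elim (ne refl)
  update-other f zero d (suc i) ne = refl
  update-other f (suc r) d zero ne = refl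
  update-other f (suc r) d (suc i) ne = update-other (f ∘ suc) r d i (ne ∘ cong suc)

  countF-update : ∀ {R} (f : Fin R → C) r d a →
    countF a (update f r d) + δ (f r) a ≡ countF a f + δ d a
  countF-update f zero d a = lemma (δ d a) _ (δ (f zero) a)
    where lemma : ∀ x y z → x + y + z ≡ z + y + x
          lemma = solve-∀
  countF-update f (suc r) d a =
    trans (+-assoc (δ (f zero) a) _ _)
      (trans (cong (δ (f zero) a +_) (countF-update (f ∘ suc) r d a)) (sym (+-assoc (δ (f zero) a) _ _)))

  Valid : ∀ {R} → (Fin R → List C) → (Fin R → C) → Set
  Valid opts f = ∀ r → f r ∈ opts r

  -- The assignment `f` may exceed the capacities only by one and only in the column `c₀`. The
  -- excess is pushed along an alternating path to a column that still has room.
  module Augment (p : ℕ) (1≤p : 1 ≤ p) (cap : C → ℕ) {R : ℕ} (opts : Fin R → List C)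
    (size : ∀ r → length (opts r) ≡ p)
    (bound : ∀ c → ΣF R (λ r → count c (opts r)) ≤ p * cap c)
    (f : Fin R → C) (valid : Valid opts f)
    (c₀ : C) (1≤cap₀ : 1 ≤ cap c₀) (nearly : ∀ a → countF a f ≤ cap a + δ c₀ a) where

    -- An alternating path from c₀ to c has been applied to f; only rows
    -- sitting in columns of K other than c may have moved.
    Shifted : List C → C → Set
    Shifted K c = Σ (Fin R → C) λ g → Valid opts g
      × (∀ a → countF a g + δ c₀ a ≡ countF a f + δ c a)
      × (∀ r → (f r ∈ K → f r ≡ c) → g r ≡ f r)

    Feasible : Set
    Feasible = Σ (Fin R → C) λ g → Valid opts g × (∀ a → countF a g ≤ cap a)

    -- The summand `δ c₀ c` in the test adapts it to `c₀` itself: there, room only means that the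
    -- suspected excess does not occur.
    free⇒feasible : ∀ {K c} → Shifted K c → countF c f < cap c + δ c₀ c → Feasible
    free⇒feasible {K} {c} (g , vg , cg , _) lt = g , vg , λ a →
      +-cancelʳ-≤ (δ c₀ a) _ _ (≤-trans (≤-reflexive (cg a)) (bnd a))
      where
      bnd : ∀ a → countF a f + δ c a ≤ cap a + δ c₀ a
      bnd a with c ≟ a
      ... | yes refl = ≤-trans (≤-reflexive (+-comm _ 1)) lt
      ... | no _ = ≤-trans (≤-reflexive (+-identityʳ _)) (nearly a)

    -- A column of capacity zero has total at most `p * 0`, so it occurs in no row. Positive
    -- capacities make tight columns occupied, which is what bounds the search.
    option⇒1≤cap : ∀ {r d} → d ∈ opts r → 1 ≤ cap d
    option⇒1≤cap {r} {d} d∈ with cap d in eq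
    ... | suc _ = s≤s z≤n
    ... | zero = ⊥-elim (1+n≰n (≤-trans (≤-trans (∈⇒1≤count d∈) (term≤ R r (λ r → count d (opts r))))
            (≤-trans (bound d) (≤-reflexive (trans (cong (p *_) eq) (*-zeroʳ p))))))
      where
      term≤ : ∀ R (r : Fin R) (h : Fin R → ℕ) → h r ≤ ΣF R h
      term≤ (suc R) zero h = m≤m+n _ _
      term≤ (suc R) (suc r) h = ≤-trans (term≤ R r (h ∘ suc)) (m≤n+m _ _)

    module _ (K : List C) (uniq : ∀ x → count x K ≤ 1) (c₀∈K : c₀ ∈ K)
      (tight : ∀ c → c ∈ K → cap c + δ c₀ c ≤ countF c f) where

      -- Every column of `K` is tight with positive capacity and therefore holds some row, and a row
      -- sits in only one column.
      tight-size : (∀ c → c ∈ K → 1 ≤ cap c) → length K ≤ R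
      tight-size capped = begin
        length K ≡⟨ trans (sum-map-const 1 K) (*-identityʳ _) ⟨
        sum (map (λ _ → 1) K) ≤⟨ sum-map-mono K (λ c c∈ → ≤-trans (capped c c∈) (≤-trans (m≤m+n _ _) (tight c c∈))) ⟩
        sum (map (λ c → countF c f) K) ≡⟨ sum-countF f K ⟨
        ΣF R (λ r → count (f r) K) ≤⟨ ΣF-mono R (λ r → uniq (f r)) ⟩
        ΣF R (λ _ → 1) ≡⟨ ΣF-ones R ⟩
        R ∎
        where open ≤-Reasoning

      -- Otherwise the rows sitting in K would carry more than p · cap(K) options, all in K.
      not-closed : ¬ (∀ r → f r ∈ K → ∀ d → d ∈ opts r → d ∈ K)
      not-closed closed = 1+n≰n (≤-trans strict weak)
        where
        row : ∀ r → p * count (f r) K ≤ sum (map (λ o → count o K) (opts r))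
        row r with f r ∈? K
        ... | no ∉K rewrite ∉⇒count≡0 K ∉K | *-zeroʳ p = z≤n
        ... | yes ∈K = begin
          p * count (f r) K ≤⟨ *-monoʳ-≤ p (uniq (f r)) ⟩
          p * 1 ≡⟨ cong (_* 1) (size r) ⟨
          length (opts r) * 1 ≡⟨ sum-map-const 1 (opts r) ⟨
          sum (map (λ _ → 1) (opts r)) ≤⟨ sum-map-mono (opts r) (λ o o∈ → ∈⇒1≤count (closed r ∈K o o∈)) ⟩
          sum (map (λ o → count o K) (opts r)) ∎
          where open ≤-Reasoning
        weak : sum (map (λ c → countF c f) K) ≤ sum (map cap K)
        weak = *-cancelˡ-≤ p {{>-nonZero 1≤p}} (begin
          p * sum (map (λ c → countF c f) K) ≡⟨ cong (p *_) (sum-countF f K) ⟨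
          p * ΣF R (λ r → count (f r) K) ≡⟨ ΣF-* R p _ ⟨
          ΣF R (λ r → p * count (f r) K) ≤⟨ ΣF-mono R row ⟩
          ΣF R (λ r → sum (map (λ o → count o K) (opts r))) ≡⟨ ΣF-cong R (λ r → sum-count-comm (opts r) K) ⟩
          ΣF R (λ r → sum (map (λ c → count c (opts r)) K)) ≡⟨ ΣF-sum R (λ r c → count c (opts r)) K ⟩
          sum (map (λ c → ΣF R (λ r → count c (opts r))) K) ≤⟨ sum-map-mono K (λ c _ → bound c) ⟩
          sum (map (λ c → p * cap c) K) ≡⟨ sum-map-* p cap K ⟩
          p * sum (map cap K) ∎)
          where open ≤-Reasoning
        -- The extra one is the excess in `c₀`, which is part of its tightness.
        strict : suc (sum (map cap K)) ≤ sum (map (λ c → countF c f) K)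
        strict = begin
          suc (sum (map cap K)) ≡⟨ +-comm 1 _ ⟩
          sum (map cap K) + 1 ≤⟨ +-monoʳ-≤ _ (∈⇒1≤count c₀∈K) ⟩
          sum (map cap K) + count c₀ K ≡⟨ cong (sum (map cap K) +_) (trans (count-as-sum c₀ K) (sum-map-cong K (λ c → δ-sym c c₀))) ⟩
          sum (map cap K) + sum (map (δ c₀) K) ≡⟨ sum-map-+ cap (δ c₀) K ⟨
          sum (map (λ c → cap c + δ c₀ c) K) ≤⟨ sum-map-mono K tight ⟩
          sum (map (λ c → countF c f) K) ∎
          where open ≤-Reasoning

    -- `K` collects the columns reached by alternating paths. Each round finds room in `K` or adds a
    -- column that some row sitting in `K` could move to, while `length K + fuel` stays `suc R`.
    -- Without fuel there would be `suc R` distinct occupied columns, more than there are rows.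
    search : ∀ fuel K → length K + fuel ≡ suc R → (∀ x → count x K ≤ 1) → c₀ ∈ K →
      (∀ c → c ∈ K → 1 ≤ cap c) → (∀ c → c ∈ K → Shifted K c) → Feasible
    search fuel K eq uniq c₀∈K capped shifted
      with Any.any? (λ c → countF c f <? cap c + δ c₀ c) K
    ... | yes any = let c , c∈ , lt = find any in free⇒feasible (shifted c c∈) lt
    ... | no none
      with Fin.any? (λ r → (f r ∈? K) ×-dec Any.any? (λ d → ¬? (d ∈? K)) (opts r))
    ... | no closed = ⊥-elim (not-closed K uniq c₀∈K (λ c c∈ → ≮⇒≥ (λ lt → none (lose c∈ lt)))
            (λ r ∈K d d∈ → case-∈ (d ∈? K) (λ d∉ → closed (r , ∈K , lose d∈ d∉))))
      where
      case-∈ : ∀ {P : Set} → Dec P → ¬ (¬ P) → P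
      case-∈ (yes x) _ = x
      case-∈ (no x) h = ⊥-elim (h x)
    search zero K eq uniq c₀∈K capped shifted | no none | yes _ =
      ⊥-elim (1+n≰n (≤-trans (≤-reflexive (sym (trans (sym (+-identityʳ _)) eq)))
        (tight-size K uniq c₀∈K (λ c c∈ → ≮⇒≥ (λ lt → none (lose c∈ lt))) capped)))
    search (suc fuel) K eq uniq c₀∈K capped shifted | no none | yes (r , ∈K , anyd) =
      let d , d∈ , d∉ = find anyd in
      search fuel (d ∷ K) (trans (sym (+-suc (length K) fuel)) eq)
        (uniq' d d∉) (there c₀∈K)
        (λ { c (here refl) → option⇒1≤cap d∈ ; c (there q) → capped c q })
        (λ { c (here refl) → moved d d∈ d∉ (shifted (f r) ∈K)
           ; c (there q) → let g , vg , cg , ag = shifted c q in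
               g , vg , cg , λ i h → ag i (λ i∈ → h (there i∈)) })
      where
      uniq' : ∀ d → d ∉ K → ∀ x → count x (d ∷ K) ≤ 1
      uniq' d d∉ x with d ≟ x
      ... | yes refl rewrite ∉⇒count≡0 K d∉ = ≤-refl
      ... | no _ = uniq x
      moved : ∀ d → d ∈ opts r → d ∉ K → Shifted K (f r) → Shifted (d ∷ K) d
      moved d d∈ d∉ (g , vg , cg , ag) = update g r d
        , update-elim (λ i c → c ∈ opts i) g r d d∈ vg
        , counts
        , agree
        where
        -- The path to `f r` has moved only rows sitting in other columns of `K`, so row `r` is
        -- still in place and can make the last move of the longer path.
        gr≡fr : g r ≡ f r
        gr≡fr = ag r (λ _ → refl)
        counts : ∀ a → countF a (update g r d) + δ c₀ a ≡ countF a f + δ d a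
        counts a = +-cancelʳ-≡ (δ (f r) a) _ _ (begin
          countF a (update g r d) + δ c₀ a + δ (f r) a ≡⟨ lemma (countF a (update g r d)) (δ c₀ a) (δ (f r) a) ⟩
          countF a (update g r d) + δ (f r) a + δ c₀ a
            ≡⟨ cong (λ t → countF a (update g r d) + δ t a + δ c₀ a) gr≡fr ⟨
          countF a (update g r d) + δ (g r) a + δ c₀ a ≡⟨ cong (_+ δ c₀ a) (countF-update g r d a) ⟩
          countF a g + δ d a + δ c₀ a ≡⟨ lemma (countF a g) (δ d a) (δ c₀ a) ⟩
          countF a g + δ c₀ a + δ d a ≡⟨ cong (_+ δ d a) (cg a) ⟩
          countF a f + δ (f r) a + δ d a ≡⟨ lemma (countF a f) (δ (f r) a) (δ d a) ⟩
          countF a f + δ d a + δ (f r) a ∎)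
          where
          open ≡-Reasoning
          lemma : ∀ x y z → x + y + z ≡ x + z + y
          lemma = solve-∀
        agree : ∀ i → (f i ∈ d ∷ K → f i ≡ d) → update g r d i ≡ f i
        agree i h = trans (update-other g r d i (λ { refl → fi∉K ∈K })) (ag i (⊥-elim ∘ fi∉K))
          where
          fi∉K : f i ∉ K
          fi∉K i∈K = d∉ (subst (_∈ K) (h (there i∈K)) i∈K)

    augment : Feasible
    augment = search R (c₀ ∷ []) refl (λ x → ≤-trans (≤-reflexive (+-identityʳ _)) (δ≤1 c₀ x)) (here refl)
      (λ { c (here refl) → 1≤cap₀ })
      (λ { c (here refl) → f , valid , (λ a → refl) , (λ r _ → refl) })

  -- Induction on the rows: the new row takes any of its options, which overfills at most that one
  -- column by one, and an augmenting path repairs it. The bound for the remaining rows is inherited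
  -- because dropping a row only lowers the column totals.
  round : ∀ R p → 1 ≤ p → (cap : C → ℕ) (opts : Fin R → List C) → (∀ r → length (opts r) ≡ p) →
    (∀ c → ΣF R (λ r → count c (opts r)) ≤ p * cap c) →
    Σ (Fin R → C) λ f → Valid opts f × (∀ a → countF a f ≤ cap a)
  round zero p 1≤p cap opts size bound = (λ ()) , (λ ()) , (λ _ → z≤n)
  round (suc R) p 1≤p cap opts size bound
    with round R p 1≤p cap (opts ∘ suc) (size ∘ suc) (λ c → ≤-trans (m≤n+m _ _) (bound c))
       | head (opts zero) (subst (1 ≤_) (sym (size zero)) 1≤p)
    where
    head : ∀ xs → 1 ≤ length xs → ∃ (_∈ xs)
    head (x ∷ xs) _ = x , here refl
  ... | f , vf , cf | c₀ , c₀∈ = Augment.augment p 1≤p cap opts size bound f⁺ vf⁺ c₀ 1≤cap nearly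
    where
    f⁺ : Fin (suc R) → C
    f⁺ zero = c₀
    f⁺ (suc r) = f r
    vf⁺ : Valid opts f⁺
    vf⁺ zero = c₀∈
    vf⁺ (suc r) = vf r
    nearly : ∀ a → countF a f⁺ ≤ cap a + δ c₀ a
    nearly a = ≤-trans (+-monoʳ-≤ (δ c₀ a) (cf a)) (≤-reflexive (+-comm (δ c₀ a) _))
    1≤cap : 1 ≤ cap c₀
    1≤cap with cap c₀ in eq
    ... | suc _ = s≤s z≤n
    ... | zero = ⊥-elim (1+n≰n (≤-trans (≤-trans (∈⇒1≤count c₀∈) (m≤m+n _ _))
            (≤-trans (bound c₀) (≤-reflexive (trans (cong (p *_) eq) (*-zeroʳ p))))))

  -- Equal lengths leave no slack in the inequalities. This upgrades the upper bounds delivered by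
  -- `round` to exact counts.
  count≤⇒↭ : ∀ xs ys → (∀ x → count x xs ≤ count x ys) → length xs ≡ length ys → xs ↭ ys
  count≤⇒↭ [] [] h e = ↭-refl
  count≤⇒↭ (x ∷ xs) ys h e
    with ∈-∃++ (1≤count⇒∈ {x} ys (≤-trans (∈⇒1≤count {xs = x ∷ xs} (here refl)) (h x)))
  ... | as , bs , refl = ↭-trans (prep x (count≤⇒↭ xs (as ++ bs) tail≤ length≡)) (↭-sym (shift x as bs))
    where
    tail≤ : ∀ z → count z xs ≤ count z (as ++ bs)
    tail≤ z = +-cancelˡ-≤ (δ x z) _ _ (≤-trans (h z) (≤-reflexive (count-↭ z (shift x as bs))))
    length≡ : length xs ≡ length (as ++ bs)
    length≡ = suc-injective (trans e (↭-length (shift x as bs)))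

  -- Rows and columns form a bipartite multigraph with degree `p` at each row and `p` times its
  -- capacity at each column; the choice is a subgraph with all these degrees divided by `p`. The
  -- capacities add up to the number of rows, so each of them is attained.
  round-list : ∀ p → 1 ≤ p → (rows : List (List C)) (caps : List C) → All (λ row → length row ≡ p) rows →
    (∀ c → count c (concat rows) ≡ p * count c caps) →
    ∃ λ ys → Pointwise _∈_ ys rows × (∀ c → count c ys ≡ count c caps)
  round-list p 1≤p rows caps sizes total
    with round (length rows) p 1≤p (λ c → count c caps) (lookup rows) (λ r → All.lookup sizes (∈-lookup r))
           (λ c → ≤-reflexive (trans (rowsum c rows) (total c)))
    where
    rowsum : ∀ c rows → ΣF (length rows) (λ r → count c (lookup rows r)) ≡ count c (concat rows)
    rowsum c [] = refl
    rowsum c (row ∷ rows) = trans (cong (count c row +_) (rowsum c rows)) (sym (count-++ c row (concat rows)))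
  ... | f , vf , cf = tabulate f , pointwise rows f vf
      , λ c → count-↭ c (count≤⇒↭ (tabulate f) caps (λ a → ≤-trans (≤-reflexive (count-tab a f)) (cf a)) length≡)
    where
    pointwise : ∀ rows (f : Fin (length rows) → C) → (∀ r → f r ∈ lookup rows r) → Pointwise _∈_ (tabulate f) rows
    pointwise [] f v = []
    pointwise (row ∷ rows) f v = v zero ∷ pointwise rows (f ∘ suc) (v ∘ suc)
    count-tab : ∀ {R} a (f : Fin R → C) → count a (tabulate f) ≡ countF a f
    count-tab {zero} a f = refl
    count-tab {suc R} a f = cong (δ (f zero) a +_) (count-tab a (f ∘ suc))
    length-concat : ∀ {rows : List (List C)} → All (λ row → length row ≡ p) rows → length (concat rows) ≡ p * length rows
    length-concat [] = sym (*-zeroʳ p)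
    length-concat {row ∷ rows} (e ∷ es) = trans (length-++ row)
      (trans (cong₂ _+_ e (length-concat es)) (sym (*-suc p (length rows))))
    length-copies : ∀ k → length (concat (replicate k caps)) ≡ k * length caps
    length-copies zero = refl
    length-copies (suc k) = trans (length-++ caps) (cong (length caps +_) (length-copies k))
    length≡ : length (tabulate f) ≡ length caps
    length≡ = trans (length-tabulate f) (*-cancelˡ-≡ _ _ p {{>-nonZero 1≤p}}
      (trans (sym (length-concat sizes)) (trans (↭-length (count≡⇒↭ (concat rows) (concat (replicate p caps))
        (λ c → trans (total c) (sym (count-concat-replicate p c caps))))) (length-copies p))))

Pointwise-++⁻ : ∀ {A B : Set} {R : A → B → Set} {xs} ys₁ {ys₂} → Pointwise R xs (ys₁ ++ ys₂) →
  ∃₂ λ xs₁ xs₂ → xs ≡ xs₁ ++ xs₂ × Pointwise R xs₁ ys₁ × Pointwise R xs₂ ys₂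
Pointwise-++⁻ [] p = [] , _ , refl , [] , p
Pointwise-++⁻ (y ∷ ys₁) (r ∷ p) with Pointwise-++⁻ ys₁ p
... | xs₁ , xs₂ , refl , p₁ , p₂ = _ ∷ xs₁ , xs₂ , refl , r ∷ p₁ , p₂

-- Choosing the edge ends that the new vertex takes over.

module Selection {V : Set} (_≟_ : DecidableEquality V) {S : Set} (e₁ e₂ : S → V) where
  open Counting _≟_

  -- How a piece of the decomposition meets the vertex being split: not at all, as a closed trail
  -- cut into segments with ends `e₁` and `e₂`, or as a matching in which the vertex has the listed
  -- partners.
  data Shape : Set where
    none   : Shape
    pairs  : List S → Shape
    single : List V → Shape

  -- The permutation in `pairs` places `s₁` and `s₂` at different positions of `ss`, so the two ends
  -- never belong to the same segment.
  data Select : Shape → List V → Set where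
    none   : Select none []
    pairs  : ∀ {ss s₁ s₂ rest x₁ x₂} → ss ↭ s₁ ∷ s₂ ∷ rest →
      x₁ ∈ e₁ s₁ ∷ e₂ s₁ ∷ [] → x₂ ∈ e₁ s₂ ∷ e₂ s₂ ∷ [] → Select (pairs ss) (x₁ ∷ x₂ ∷ [])
    single : ∀ {xs x} → x ∈ xs → Select (single xs) (x ∷ [])

  OfSize : ℕ → Shape → Set
  OfSize p none = ⊤
  OfSize p (pairs ss) = length ss ≡ p
  OfSize p (single xs) = length xs ≡ p

  endpoints : Shape → List V
  endpoints none = []
  endpoints (pairs ss) = concatMap (λ s → e₁ s ∷ e₂ s ∷ []) ss
  endpoints (single xs) = xs

  -- The k-th shape gets its own dummy column inj₂ k of capacity q; a segment that
  -- picks a dummy is left alone, so exactly 2 of its 2 + q segments are used.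
  Column : Set
  Column = V ⊎ ℕ

  _≟ᶜ_ : DecidableEquality Column
  _≟ᶜ_ = Sum.≡-dec _≟_ Data.Nat.Properties._≟_

  module C = Counting _≟ᶜ_

  δ-inj₁ : ∀ y z → C.δ (inj₁ y) (inj₁ z) ≡ δ y z
  δ-inj₁ y z = go (y ≟ z)
    where
    go : Dec (y ≡ z) → C.δ (inj₁ y) (inj₁ z) ≡ δ y z
    go (yes refl) = trans (C.δ-refl (inj₁ y)) (sym (δ-refl y))
    go (no ne) = trans (C.δ-≢ (λ e → ne (inj₁-injective e))) (sym (δ-≢ ne))

  count-inj₁ : ∀ z xs → C.count (inj₁ z) (map inj₁ xs) ≡ count z xs
  count-inj₁ z [] = refl
  count-inj₁ z (x ∷ xs) = cong₂ _+_ (δ-inj₁ x z) (count-inj₁ z xs)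

  count-avoid : ∀ {c} {xs} → All (_≢ c) xs → C.count c xs ≡ 0
  count-avoid [] = refl
  count-avoid (ne ∷ nes) = cong₂ _+_ (C.δ-≢ ne) (count-avoid nes)

  module _ (q : ℕ) where

    row : ℕ → S → List Column
    row k s = inj₁ (e₁ s) ∷ inj₁ (e₂ s) ∷ replicate q (inj₂ k)

    rows : ℕ → Shape → List (List Column)
    rows k none = []
    rows k (pairs ss) = map (row k) ss
    rows k (single xs) = map inj₁ xs ∷ []

    dummies : ℕ → Shape → List Column
    dummies k none = []
    dummies k (pairs ss) = replicate q (inj₂ k)
    dummies k (single xs) = []

    allRows : ℕ → List Shape → List (List Column)
    allRows k [] = []
    allRows k (s ∷ ss) = rows k s ++ allRows (suc k) ss

    allDummies : ℕ → List Shape → List Column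
    allDummies k [] = []
    allDummies k (s ∷ ss) = dummies k s ++ allDummies (suc k) ss

    replicate-all : ∀ {P : Column → Set} r {c} → P c → All P (replicate r c)
    replicate-all zero p = []
    replicate-all (suc r) p = p ∷ replicate-all r p

    inj₁-avoid : ∀ {j} (xs : List V) → All (_≢ inj₂ j) (map (inj₁ {B = ℕ}) xs)
    inj₁-avoid xs = All.map⁺ (All.universal (λ _ ()) xs)

    rows-avoid : ∀ {j k} s → k ≢ j → All (All (_≢ inj₂ j)) (rows k s)
    rows-avoid none ne = []
    rows-avoid (pairs ss) ne = All.map⁺ (All.universal
      (λ s → (λ ()) ∷ (λ ()) ∷ replicate-all q (λ e → ne (inj₂-injective e))) ss)
    rows-avoid (single xs) ne = inj₁-avoid xs ∷ []

    allRows-avoid : ∀ {j k} ss → j < k → All (All (_≢ inj₂ j)) (allRows k ss)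
    allRows-avoid [] lt = []
    allRows-avoid (s ∷ ss) lt = All.++⁺ (rows-avoid s (λ e → <-irrefl (sym e) lt)) (allRows-avoid ss (m≤n⇒m≤1+n lt))

    dummies-avoid : ∀ {j k} s → k ≢ j → All (_≢ inj₂ j) (dummies k s)
    dummies-avoid none ne = []
    dummies-avoid (pairs ss) ne = replicate-all q (λ e → ne (inj₂-injective e))
    dummies-avoid (single xs) ne = []

    allDummies-avoid : ∀ {j k} ss → j < k → All (_≢ inj₂ j) (allDummies k ss)
    allDummies-avoid [] lt = []
    allDummies-avoid (s ∷ ss) lt = All.++⁺ (dummies-avoid s (λ e → <-irrefl (sym e) lt)) (allDummies-avoid ss (m≤n⇒m≤1+n lt))

    allDummies-avoid₁ : ∀ z k ss → All (_≢ inj₁ z) (allDummies k ss)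
    allDummies-avoid₁ z k [] = []
    allDummies-avoid₁ z k (none ∷ ss) = allDummies-avoid₁ z (suc k) ss
    allDummies-avoid₁ z k (pairs _ ∷ ss) = All.++⁺ (replicate-all q (λ ())) (allDummies-avoid₁ z (suc k) ss)
    allDummies-avoid₁ z k (single _ ∷ ss) = allDummies-avoid₁ z (suc k) ss

    choice-avoid : ∀ {c : Column} {ys rs} → All (All (_≢ c)) rs → Pointwise _∈_ ys rs → All (_≢ c) ys
    choice-avoid [] [] = []
    choice-avoid (av ∷ avs) (y∈ ∷ ys∈) = All.lookup av y∈ ∷ choice-avoid avs ys∈

    rows-size : ∀ k s → OfSize (2 + q) s → All (λ r → length r ≡ 2 + q) (rows k s)
    rows-size k none _ = []
    rows-size k (pairs ss) _ = All.map⁺ (All.universal (λ s → cong (2 +_) (length-replicate q)) ss)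
    rows-size k (single xs) e = trans (length-map inj₁ xs) e ∷ []

    allRows-size : ∀ k {ss} → All (OfSize (2 + q)) ss → All (λ r → length r ≡ 2 + q) (allRows k ss)
    allRows-size k [] = []
    allRows-size k (e ∷ es) = All.++⁺ (rows-size k _ e) (allRows-size (suc k) es)

    rows-count₁ : ∀ z k s → C.count (inj₁ z) (concat (rows k s)) ≡ count z (endpoints s)
    rows-count₁ z k none = refl
    rows-count₁ z k (pairs []) = refl
    rows-count₁ z k (pairs (s ∷ ss)) = cong₂ _+_ (δ-inj₁ (e₁ s) z) (cong₂ _+_ (δ-inj₁ (e₂ s) z)
      (trans (C.count-++ (inj₁ z) (replicate q (inj₂ k)) _)
        (cong₂ _+_ (count-avoid (replicate-all q (λ ()))) (rows-count₁ z k (pairs ss)))))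
    rows-count₁ z k (single xs) = trans (C.count-++ (inj₁ z) (map inj₁ xs) [])
      (trans (+-identityʳ _) (count-inj₁ z xs))

    count-concat-++ : ∀ c xss yss → C.count c (concat (xss ++ yss)) ≡ C.count c (concat xss) + C.count c (concat yss)
    count-concat-++ c xss yss = trans (cong (C.count c) (sym (concat-++ xss yss))) (C.count-++ c (concat xss) (concat yss))

    allRows-count₁ : ∀ z k ss → C.count (inj₁ z) (concat (allRows k ss)) ≡ count z (concatMap endpoints ss)
    allRows-count₁ z k [] = refl
    allRows-count₁ z k (s ∷ ss) = trans (count-concat-++ (inj₁ z) (rows k s) _)
      (trans (cong₂ _+_ (rows-count₁ z k s) (allRows-count₁ z (suc k) ss))
        (sym (count-++ z (endpoints s) _)))

    avoid-concat : ∀ {c rs} → All (All (_≢ c)) rs → C.count c (concat rs) ≡ 0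
    avoid-concat avs = count-avoid (All.concat⁺ avs)

    -- A trail has exactly `2 + q` rows and each contains the dummy `q` times, so the dummy total is
    -- `2 + q` times the capacity `q`, just as `round-list` demands.
    rows-count₂ : ∀ j k s → OfSize (2 + q) s →
      C.count (inj₂ j) (concat (rows k s)) ≡ (2 + q) * C.count (inj₂ j) (dummies k s)
    rows-count₂ j k none _ = sym (*-zeroʳ (2 + q))
    rows-count₂ j k (pairs ss) e = trans (lemma ss) (cong (_* C.count (inj₂ j) (replicate q (inj₂ k))) e)
      where
      lemma : ∀ ss → C.count (inj₂ j) (concat (map (row k) ss)) ≡ length ss * C.count (inj₂ j) (replicate q (inj₂ k))
      lemma [] = refl
      lemma (s ∷ ss) = trans (C.count-++ (inj₂ j) (replicate q (inj₂ k)) _)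
        (cong (C.count (inj₂ j) (replicate q (inj₂ k)) +_) (lemma ss))
    rows-count₂ j k (single xs) _ =
      trans (avoid-concat {inj₂ j} {map inj₁ xs ∷ []} (inj₁-avoid xs ∷ [])) (sym (*-zeroʳ (2 + q)))

    allRows-count₂ : ∀ j k {ss} → All (OfSize (2 + q)) ss →
      C.count (inj₂ j) (concat (allRows k ss)) ≡ (2 + q) * C.count (inj₂ j) (allDummies k ss)
    allRows-count₂ j k [] = sym (*-zeroʳ (2 + q))
    allRows-count₂ j k {s ∷ ss} (e ∷ es) = trans (count-concat-++ (inj₂ j) (rows k s) _)
      (trans (cong₂ _+_ (rows-count₂ j k s e) (allRows-count₂ j (suc k) es))
        (trans (sym (*-distribˡ-+ (2 + q) (C.count (inj₂ j) (dummies k s)) _))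
          (cong ((2 + q) *_) (sym (C.count-++ (inj₂ j) (dummies k s) _)))))

    Chosen : S × V → Set
    Chosen (s , x) = x ∈ e₁ s ∷ e₂ s ∷ []

    extract : ∀ k ss {ys} → Pointwise _∈_ ys (map (row k) ss) →
      ∃₂ λ (chosen : List (S × V)) rest → ss ↭ map proj₁ chosen ++ rest × All Chosen chosen
        × length chosen + C.count (inj₂ k) ys ≡ length ss
        × (∀ z → C.count (inj₁ z) ys ≡ count z (map proj₂ chosen))
    extract k [] [] = [] , [] , ↭-refl , [] , refl , λ z → refl
    extract k (s ∷ ss) {y ∷ ys} (y∈ ∷ ys∈) with extract k ss ys∈ | decode y∈
      where
      replicate⁻ : ∀ r → y ∈ replicate r (inj₂ k) → y ≡ inj₂ k
      replicate⁻ (suc r) (here e) = e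
      replicate⁻ (suc r) (there p) = replicate⁻ r p
      decode : y ∈ row k s → y ≡ inj₂ k ⊎ ∃ λ x → y ≡ inj₁ x × Chosen (s , x)
      decode (here e) = inj₂ (_ , e , here refl)
      decode (there (here e)) = inj₂ (_ , e , there (here refl))
      decode (there (there p)) = inj₁ (replicate⁻ q p)
    ... | chosen , rest , perm , ok , len , cnt | inj₁ refl =
      chosen , s ∷ rest , ↭-trans (prep s perm) (↭-sym (shift s (map proj₁ chosen) rest)) , ok
      , trans (cong (λ t → length chosen + (t + C.count (inj₂ k) ys)) (C.δ-refl (inj₂ k)))
          (trans (+-suc (length chosen) _) (cong suc len))
      , λ z → trans (cong (_+ C.count (inj₁ z) ys) (C.δ-≢ {inj₂ k} {inj₁ z} (λ ()))) (cnt z)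
    ... | chosen , rest , perm , ok , len , cnt | inj₂ (x , refl , x∈) =
      (s , x) ∷ chosen , rest , prep s perm , x∈ ∷ ok
      , cong suc (trans (cong (λ t → length chosen + (t + C.count (inj₂ k) ys)) (C.δ-≢ {inj₁ x} {inj₂ k} (λ ()))) len)
      , λ z → cong₂ _+_ (δ-inj₁ x z) (cnt z)

    decodeShape : ∀ k s {ys} → OfSize (2 + q) s → Pointwise _∈_ ys (rows k s) →
      C.count (inj₂ k) ys ≡ C.count (inj₂ k) (dummies k s) →
      ∃ λ Y → Select s Y × (∀ z → count z Y ≡ C.count (inj₁ z) ys)
    decodeShape k none size [] d = [] , none , λ z → refl
    decodeShape k (single xs) size (y∈ ∷ []) d with ∈-map⁻ inj₁ y∈
    ... | x , x∈ , refl = x ∷ [] , single x∈ , λ z → cong (_+ 0) (sym (δ-inj₁ x z))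
    decodeShape k (pairs ss) {ys} size ys∈ d with extract k ss ys∈
    -- The dummy column is filled to its capacity `q`, so of the `2 + q` segments exactly two have
    -- chosen a real end.
    ... | chosen , rest , perm , ok , len , cnt = two chosen ok perm cnt
        (+-cancelʳ-≡ q _ _ (trans (cong (length chosen +_) (sym (trans d (C.count-replicate-≡ q (inj₂ k))))) (trans len size)))
      where
      two : ∀ chosen → All Chosen chosen → ss ↭ map proj₁ chosen ++ rest →
        (∀ z → C.count (inj₁ z) ys ≡ count z (map proj₂ chosen)) → length chosen ≡ 2 →
        ∃ λ Y → Select (pairs ss) Y × (∀ z → count z Y ≡ C.count (inj₁ z) ys)
      two ((s₁ , x₁) ∷ (s₂ , x₂) ∷ []) (ok₁ ∷ ok₂ ∷ []) perm cnt _ =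
        x₁ ∷ x₂ ∷ [] , pairs perm ok₁ ok₂ , λ z → sym (cnt z)

    -- Only the shape numbered `k` offers the column `inj₂ k`; hence the global dummy counts split
    -- into those of this shape and those of the later ones.
    decodeAll : ∀ k {ss} {ys} → All (OfSize (2 + q)) ss → Pointwise _∈_ ys (allRows k ss) →
      (∀ j → C.count (inj₂ j) ys ≡ C.count (inj₂ j) (allDummies k ss)) →
      ∃ λ Ys → Pointwise Select ss Ys × (∀ z → count z (concat Ys) ≡ C.count (inj₁ z) ys)
    decodeAll k [] [] d = [] , [] , λ z → refl
    decodeAll k {s ∷ ss} (size ∷ sizes) ys∈ d with Pointwise-++⁻ (rows k s) ys∈
    ... | ys₁ , ys₂ , refl , ys₁∈ , ys₂∈ =
      let Y , sel , cY = decodeShape k s size ys₁∈ d₁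
          Ys , sels , cYs = decodeAll (suc k) sizes ys₂∈ d₂
      in Y ∷ Ys , sel ∷ sels , λ z → trans (count-++ z Y (concat Ys))
           (trans (cong₂ _+_ (cY z) (cYs z)) (sym (C.count-++ (inj₁ z) ys₁ ys₂)))
      where
      split : ∀ j → C.count (inj₂ j) ys₁ + C.count (inj₂ j) ys₂
                  ≡ C.count (inj₂ j) (dummies k s) + C.count (inj₂ j) (allDummies (suc k) ss)
      split j = trans (sym (C.count-++ (inj₂ j) ys₁ ys₂)) (trans (d j) (C.count-++ (inj₂ j) (dummies k s) _))
      fresh-choice : C.count (inj₂ k) ys₂ ≡ 0
      fresh-choice = count-avoid {inj₂ k} (choice-avoid (allRows-avoid {k} ss ≤-refl) ys₂∈)
      fresh-dummies : C.count (inj₂ k) (allDummies (suc k) ss) ≡ 0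
      fresh-dummies = count-avoid {inj₂ k} (allDummies-avoid ss ≤-refl)
      d₁ : C.count (inj₂ k) ys₁ ≡ C.count (inj₂ k) (dummies k s)
      d₁ = trans (sym (+-identityʳ _)) (trans (cong (C.count (inj₂ k) ys₁ +_) (sym fresh-choice))
        (trans (split k) (trans (cong (C.count (inj₂ k) (dummies k s) +_) fresh-dummies) (+-identityʳ _))))
      d₂ : ∀ j → C.count (inj₂ j) ys₂ ≡ C.count (inj₂ j) (allDummies (suc k) ss)
      d₂ j with k Data.Nat.Properties.≟ j
      ... | yes refl = trans fresh-choice (sym fresh-dummies)
      ... | no ne = trans (cong (_+ C.count (inj₂ j) ys₂) (sym (count-avoid {inj₂ j} (choice-avoid (rows-avoid s ne) ys₁∈))))
              (trans (split j) (cong (_+ C.count (inj₂ j) (allDummies (suc k) ss)) (count-avoid (dummies-avoid s ne))))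

    -- All pieces are treated in one choice problem, because the share of a vertex is prescribed for
    -- their union. Exactness in the vertex columns gives the share, exactness in the dummy columns
    -- the two ends per trail.
    select : ∀ {ss} (caps : List V) → All (OfSize (2 + q)) ss →
      (∀ z → count z (concatMap endpoints ss) ≡ (2 + q) * count z caps) →
      ∃ λ Ys → Pointwise Select ss Ys × (∀ z → count z (concat Ys) ≡ count z caps)
    select {ss} caps sizes total =
      let ys , ys∈ , cys = Rounding.round-list _≟ᶜ_ (2 + q) (s≤s z≤n) (allRows 0 ss)
                             (map inj₁ caps ++ allDummies 0 ss) (allRows-size 0 sizes) hyp
          Ys , sels , cYs = decodeAll 0 sizes ys∈ (λ j → trans (cys (inj₂ j)) (caps₂ j))
      in Ys , sels , λ z → trans (cYs z) (trans (cys (inj₁ z)) (caps₁ z))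
      where
      caps₁ : ∀ z → C.count (inj₁ z) (map inj₁ caps ++ allDummies 0 ss) ≡ count z caps
      caps₁ z = trans (C.count-++ (inj₁ z) (map inj₁ caps) _)
        (trans (cong₂ _+_ (count-inj₁ z caps) (count-avoid (allDummies-avoid₁ z 0 ss))) (+-identityʳ _))
      caps₂ : ∀ j → C.count (inj₂ j) (map inj₁ caps ++ allDummies 0 ss) ≡ C.count (inj₂ j) (allDummies 0 ss)
      caps₂ j = trans (C.count-++ (inj₂ j) (map inj₁ caps) _)
        (cong (_+ C.count (inj₂ j) (allDummies 0 ss)) (count-avoid {inj₂ j} (inj₁-avoid caps)))
      hyp : ∀ c → C.count c (concat (allRows 0 ss)) ≡ (2 + q) * C.count c (map inj₁ caps ++ allDummies 0 ss)
      hyp (inj₁ z) = trans (allRows-count₁ z 0 ss) (trans (total z) (cong ((2 + q) *_) (sym (caps₁ z))))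
      hyp (inj₂ j) = trans (allRows-count₂ j 0 sizes) (cong ((2 + q) *_) (sym (caps₂ j)))

-- Closed trails: cutting at a vertex and rerouting.

module Trails {V : Set} (_≟_ : DecidableEquality V) where
  open Multiplicity _≟_

  private
    μ : Edges → V → V → ℕ
    μ = mult _≟_

  -- The stretch of a trail between two visits to `w`. The head is kept apart to make it nonempty,
  -- so that both ends exist; for a single vertex they coincide.
  Segment : Set
  Segment = V × List V

  toList : Segment → List V
  toList (x , s) = x ∷ s

  last : V → List V → V
  last x [] = x
  last x (y ∷ s) = last y s

  final : Segment → V
  final (x , s) = last x s

  δ≡0⇒≢ : ∀ {x y} → δ x y ≡ 0 → x ≢ y
  δ≡0⇒≢ {x} e refl = 1+n≢0 (trans (sym (δ-refl x)) e)

  ε-avoid : ∀ {a b w} z → a ≢ w → b ≢ w → ε a b w z ≡ 0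
  ε-avoid {a} {b} {w} z a≢ b≢ with a ≟ w | b ≟ w | b ≟ z | a ≟ z
  ... | yes e | _ | _ | _ = ⊥-elim (a≢ e)
  ... | no _ | yes e | _ | _ = ⊥-elim (b≢ e)
  ... | no _ | no _ | _ | yes _ = refl
  ... | no _ | no _ | _ | no _ = refl

  ε-at : ∀ {w x} z → x ≢ w → ε w x w z ≡ δ x z
  ε-at {w} {x} z ne rewrite ε-star w x w z ne | δ-refl w | δ-≢ ne | *-zeroʳ (δ w z) =
    trans (+-identityʳ _) (+-identityʳ _)

  mult-closeUp-avoid : ∀ {w f x} s z → f ≢ w → count w (x ∷ s) ≡ 0 → μ (closeUp f x s) w z ≡ 0
  mult-closeUp-avoid [] z f≢ e = cong (_+ 0) (ε-avoid z (δ≡0⇒≢ (m+n≡0⇒m≡0 _ e)) f≢)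
  mult-closeUp-avoid {w} {f} {x} (y ∷ s) z f≢ e =
    cong₂ _+_ (ε-avoid z (δ≡0⇒≢ (m+n≡0⇒m≡0 _ e)) (δ≡0⇒≢ (m+n≡0⇒m≡0 _ (m+n≡0⇒n≡0 (δ x w) e))))
      (mult-closeUp-avoid s z f≢ (m+n≡0⇒n≡0 (δ x w) e))

  mult-cycle-avoid : ∀ {w} t z → count w t ≡ 0 → μ (cycleEdges t) w z ≡ 0
  mult-cycle-avoid [] z e = refl
  mult-cycle-avoid (x ∷ s) z e = mult-closeUp-avoid s z (δ≡0⇒≢ (m+n≡0⇒m≡0 _ e)) e

  mult-closing : ∀ {w x} s z → count w (x ∷ s) ≡ 0 → μ (closeUp w x s) w z ≡ δ (last x s) z
  mult-closing {w} {x} [] z e =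
    trans (+-identityʳ _) (trans (ε-swap x w w z) (ε-at z (δ≡0⇒≢ (m+n≡0⇒m≡0 _ e))))
  mult-closing {w} {x} (y ∷ s) z e =
    cong₂ _+_ (ε-avoid z (δ≡0⇒≢ (m+n≡0⇒m≡0 _ e)) (δ≡0⇒≢ (m+n≡0⇒m≡0 _ (m+n≡0⇒n≡0 (δ x w) e))))
      (mult-closing s z (m+n≡0⇒n≡0 (δ x w) e))

  loops : V → List Segment → Edges
  loops w = concatMap (λ s → closeUp w w (toList s))

  -- The segments avoid `w`, so the edges at `w` are the first and last edge of each loop, and their
  -- other endpoints are the two ends of the segment.
  mult-loops : ∀ {w ss} z → All (λ s → count w (toList s) ≡ 0) ss →
    μ (loops w ss) w z ≡ count z (concatMap (λ s → proj₁ s ∷ final s ∷ []) ss)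
  mult-loops z [] = refl
  mult-loops {w} {(x , s) ∷ ss} z (e ∷ es) = begin
    μ (closeUp w w (x ∷ s) ++ loops w ss) w z ≡⟨ mult-++ (closeUp w w (x ∷ s)) _ w z ⟩
    ε w x w z + μ (closeUp w x s) w z + μ (loops w ss) w z
      ≡⟨ cong₂ _+_ (cong₂ _+_ (ε-at z (δ≡0⇒≢ (m+n≡0⇒m≡0 _ e))) (mult-closing s z e)) (mult-loops z es) ⟩
    δ x z + δ (last x s) z + _ ≡⟨ +-assoc (δ x z) _ _ ⟩
    δ x z + (δ (last x s) z + _) ∎
    where open ≡-Reasoning

  closeUp-concat : ∀ w p xs segs →
    closeUp w p (xs ++ concatMap (w ∷_) segs) ≡ closeUp w p xs ++ concatMap (closeUp w w) segs
  closeUp-concat w p xs [] = trans (cong (closeUp w p) (++-identityʳ xs)) (sym (++-identityʳ _))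
  closeUp-concat w p xs (s ∷ segs) = trans (closeUp-++ w p xs w (s ++ concatMap (w ∷_) segs))
    (cong (closeUp w p xs ++_) (closeUp-concat w w s segs))

  cutAt : ∀ w xs → ∃₂ λ s segs → xs ≡ s ++ concatMap (w ∷_) segs
    × All (λ s → count w s ≡ 0) (s ∷ segs) × length segs ≡ count w xs
  cutAt w [] = [] , [] , refl , refl ∷ [] , refl
  cutAt w (x ∷ xs) with cutAt w xs | x ≟ w
  ... | s , segs , refl , z , len | yes refl = [] , s ∷ segs , refl , refl ∷ z , cong suc len
  ... | s , segs , refl , e ∷ es , len | no ne =
    x ∷ s , segs , refl , trans (cong (_+ count w s) (δ-≢ ne)) e ∷ es , len

  -- An empty segment would be two consecutive visits to `w`, that is, a loop contributing to the
  -- multiplicity of `w` with itself.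
  nonempty : ∀ w segs → μ (concatMap (closeUp w w) segs) w w ≡ 0 → ∃ λ ss → segs ≡ map toList ss
  nonempty w [] e = [] , refl
  nonempty w ([] ∷ segs) e = ⊥-elim (1+n≢0 (trans (cong (_+ μ (concatMap (closeUp w w) segs) w w) (sym (ε-refl w w))) e))
  nonempty w ((x ∷ s) ∷ segs) e with nonempty w segs (m+n≡0⇒n≡0 (μ (closeUp w w (x ∷ s)) w w)
                                       (trans (sym (mult-++ (closeUp w w (x ∷ s)) _ w w)) e))
  ... | ss , refl = (x , s) ∷ ss , refl

  -- The cyclic order of the segments is forgotten on purpose. Edges and vertex counts of the trail
  -- depend only on the multiset of segments, so any two of them may be brought to the front.
  record Cut (w : V) (t : List V) (k : ℕ) : Set where
    field
      segments : List Segment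
      number   : length segments ≡ k
      avoid    : All (λ s → count w (toList s) ≡ 0) segments
      edges≈   : cycleEdges t ≈ₑ loops w segments
      count≡   : ∀ a → count a t ≡ count a (concatMap (λ s → w ∷ toList s) segments)

  -- Rotating the trail to start at a visit to `w` makes every stretch a complete segment, one for
  -- each visit.
  cut : ∀ {w t} k → count w t ≡ suc k → μ (cycleEdges t) w w ≡ 0 → Cut w t (suc k)
  cut {w} {t} k e noloop with ∈-∃++ (1≤count⇒∈ {w} t (subst (1 ≤_) (sym e) (s≤s z≤n)))
  ... | pre , post , refl with cutAt w (post ++ pre)
  ... | s , segs , eq , zeros , len = result (nonempty w (s ∷ segs)
          (trans (sym (edges-segs w w)) noloop)) zeros
    where
    edges-segs : ∀ u v → μ (cycleEdges (pre ++ w ∷ post)) u v ≡ μ (concatMap (closeUp w w) (s ∷ segs)) u v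
    edges-segs u v = trans (cycleEdges-rotate pre w post u v)
      (cong (λ l → μ l u v) (trans (cong (closeUp w w) eq) (closeUp-concat w w s segs)))
    rotated : pre ++ w ∷ post ↭ concatMap (w ∷_) (s ∷ segs)
    rotated = ↭-trans (++-comm pre (w ∷ post)) (subst (λ l → w ∷ post ++ pre ↭ w ∷ l) eq ↭-refl)
    suc-count : suc (count w (post ++ pre)) ≡ suc k
    suc-count = trans (sym (trans (count-↭ w (++-comm pre (w ∷ post))) (cong (_+ count w (post ++ pre)) (δ-refl w)))) e
    zeros⁻ : ∀ {ss} → All (λ s → count w s ≡ 0) (map toList ss) → All (λ s → count w (toList s) ≡ 0) ss
    zeros⁻ {[]} [] = []
    zeros⁻ {s ∷ ss} (z ∷ zs) = z ∷ zeros⁻ zs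
    result : (∃ λ ss → s ∷ segs ≡ map toList ss) → All (λ s → count w s ≡ 0) (s ∷ segs) → Cut w (pre ++ w ∷ post) (suc k)
    result (ss , eq') zs = record
      { segments = ss
      ; number = trans (sym (length-map toList ss)) (trans (cong length (sym eq')) (trans (cong suc len) suc-count))
      ; avoid = zeros⁻ (subst (All (λ s → count w s ≡ 0)) eq' zs)
      ; edges≈ = λ u v → trans (edges-segs u v) (cong (λ l → μ l u v) (trans (cong (concatMap (closeUp w w)) eq') (concatMap-map (closeUp w w) toList ss)))
      ; count≡ = λ a → trans (count-↭ a rotated) (cong (count a) (trans (cong (concatMap (w ∷_)) eq') (concatMap-map (w ∷_) toList ss)))
      }

  reverse-last : ∀ x s → ∃ λ s' → reverse (x ∷ s) ≡ last x s ∷ s'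
  reverse-last x [] = [] , refl
  reverse-last x (y ∷ s) with reverse-last y s
  ... | s' , e = s' ∷ʳ x , trans (unfold-reverse x (y ∷ s)) (cong (_∷ʳ x) e)

  -- Turns the segment round if necessary, so that the chosen end comes first.
  orient : ∀ w s {z} → z ∈ proj₁ s ∷ final s ∷ [] →
    ∃ λ s' → closeUp w w (z ∷ s') ≈ₑ closeUp w w (toList s) × (∀ a → count a (z ∷ s') ≡ count a (toList s))
  orient w (x , s) (here refl) = s , (λ u v → refl) , λ a → refl
  orient w (x , s) (there (here refl)) with reverse-last x s
  ... | s' , e = s'
    , (λ u v → trans (cong (λ l → μ (closeUp w w l) u v) (sym e)) (closeUp-reverse w w (x ∷ s) u v))
    , λ a → trans (cong (count a) (sym e)) (count-↭ a (↭-reverse (x ∷ s)))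

  open Selection _≟_ proj₁ final public

  -- Splitting α off w: the trail w S₁ w S₂ w R becomes w S₁⁻¹ α S₂ w R, so connectivity is never lost.
  splitTrail : ∀ {w α t k} (C : Cut w t k) {Y} → Select (pairs (Cut.segments C)) Y →
    ∃ λ t' → (∀ a → count a t' + δ w a ≡ count a t + δ α a)
      × (∀ u v → μ (cycleEdges t') u v + μ (star w Y) u v ≡ μ (cycleEdges t) u v + μ (star α Y) u v)
  splitTrail {w} {α} {t} C (pairs {s₁ = s₁} {s₂} {rest} {x₁} {x₂} perm x₁∈ x₂∈)
    with orient w s₁ x₁∈ | orient w s₂ x₂∈
  ... | s₁' , e₁ , c₁ | s₂' , e₂ , c₂ = t' , counts , edges
    where
    open ≡-Reasoning
    tail : List V
    tail = (x₂ ∷ s₂') ++ concatMap (λ s → w ∷ toList s) rest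
    t' : List V
    -- The first segment is reversed to end in `x₁` and the second one starts with `x₂`, so both
    -- chosen ends become neighbours of `α` while the far ends stay attached to `w`.
    t' = w ∷ reverse (x₁ ∷ s₁') ++ α ∷ tail
    counts : ∀ a → count a t' + δ w a ≡ count a t + δ α a
    counts a = begin
      δ w a + count a (reverse (x₁ ∷ s₁') ++ α ∷ tail) + δ w a
        ≡⟨ cong (λ n → δ w a + n + δ w a) (count-++ a (reverse (x₁ ∷ s₁')) (α ∷ tail)) ⟩
      δ w a + (count a (reverse (x₁ ∷ s₁')) + (δ α a + count a tail)) + δ w a
        ≡⟨ cong₂ (λ m n → δ w a + (m + (δ α a + n)) + δ w a)
             (trans (count-↭ a (↭-reverse (x₁ ∷ s₁'))) (c₁ a))
             (trans (count-++ a (x₂ ∷ s₂') _) (cong (_+ R) (c₂ a))) ⟩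
      δ w a + (count a (toList s₁) + (δ α a + (count a (toList s₂) + R))) + δ w a
        ≡⟨ lemma (δ w a) (δ α a) (count a (toList s₁)) (count a (toList s₂)) R ⟩
      (δ w a + (count a (toList s₁) + (δ w a + (count a (toList s₂) + R)))) + δ α a
        ≡⟨ cong (_+ δ α a) (sym expand) ⟩
      count a t + δ α a ∎
      where
      R = count a (concatMap (λ s → w ∷ toList s) rest)
      lemma : ∀ p q x y r → p + (x + (q + (y + r))) + p ≡ (p + (x + (p + (y + r)))) + q
      lemma = solve-∀
      expand : count a t ≡ δ w a + (count a (toList s₁) + (δ w a + (count a (toList s₂) + R)))
      expand = trans (Cut.count≡ C a) (trans (count-concatMap-↭ a _ perm)
        (cong (δ w a +_) (trans (count-++ a (toList s₁) _) (cong (λ n → count a (toList s₁) + (δ w a + n)) (count-++ a (toList s₂) _)))))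
    edges : ∀ u v → μ (cycleEdges t') u v + μ (star w (x₁ ∷ x₂ ∷ [])) u v ≡ μ (cycleEdges t) u v + μ (star α (x₁ ∷ x₂ ∷ [])) u v
    edges u v = begin
      μ (cycleEdges t') u v + (ε w x₁ u v + (ε w x₂ u v + 0))
        ≡⟨ cong (_+ (ε w x₁ u v + (ε w x₂ u v + 0))) new ⟩
      (ε α x₁ u v + P₁) + ((ε α x₂ u v + P₂) + R) + (ε w x₁ u v + (ε w x₂ u v + 0))
        ≡⟨ lemma (ε α x₁ u v) P₁ (ε α x₂ u v) P₂ R (ε w x₁ u v) (ε w x₂ u v) ⟩
      (ε w x₁ u v + P₁) + ((ε w x₂ u v + P₂) + R) + (ε α x₁ u v + (ε α x₂ u v + 0))
        ≡⟨ cong (_+ (ε α x₁ u v + (ε α x₂ u v + 0))) (sym old) ⟩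
      μ (cycleEdges t) u v + (ε α x₁ u v + (ε α x₂ u v + 0)) ∎
      where
      P₁ = μ (closeUp w x₁ s₁') u v
      P₂ = μ (closeUp w x₂ s₂') u v
      R = μ (loops w rest) u v
      lemma : ∀ a p b q r c d → (a + p) + ((b + q) + r) + (c + (d + 0)) ≡ (c + p) + ((d + q) + r) + (a + (b + 0))
      lemma = solve-∀
      new : μ (cycleEdges t') u v ≡ (ε α x₁ u v + P₁) + ((ε α x₂ u v + P₂) + R)
      new = begin
        μ (closeUp w w (reverse (x₁ ∷ s₁') ++ α ∷ tail)) u v
          ≡⟨ cong (λ l → μ l u v) (closeUp-++ w w (reverse (x₁ ∷ s₁')) α tail) ⟩
        μ (closeUp α w (reverse (x₁ ∷ s₁')) ++ closeUp w α tail) u v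
          ≡⟨ mult-++ (closeUp α w (reverse (x₁ ∷ s₁'))) _ u v ⟩
        μ (closeUp α w (reverse (x₁ ∷ s₁'))) u v + μ (closeUp w α tail) u v
          ≡⟨ cong₂ _+_ (closeUp-reverse α w (x₁ ∷ s₁') u v) (cong (λ l → μ l u v)
               (trans (cong (λ l → closeUp w α ((x₂ ∷ s₂') ++ l)) (sym (concatMap-map (w ∷_) toList rest)))
                 (trans (closeUp-concat w α (x₂ ∷ s₂') (map toList rest)) (cong (closeUp w α (x₂ ∷ s₂') ++_) (concatMap-map (closeUp w w) toList rest))))) ⟩
        (ε α x₁ u v + P₁) + μ (closeUp w α (x₂ ∷ s₂') ++ loops w rest) u v
          ≡⟨ cong ((ε α x₁ u v + P₁) +_) (mult-++ (closeUp w α (x₂ ∷ s₂')) _ u v) ⟩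
        (ε α x₁ u v + P₁) + ((ε α x₂ u v + P₂) + R) ∎
      old : μ (cycleEdges t) u v ≡ (ε w x₁ u v + P₁) + ((ε w x₂ u v + P₂) + R)
      old = begin
        μ (cycleEdges t) u v ≡⟨ Cut.edges≈ C u v ⟩
        μ (loops w (Cut.segments C)) u v ≡⟨ mult-concatMap-↭ _ perm u v ⟩
        μ (closeUp w w (toList s₁) ++ (closeUp w w (toList s₂) ++ loops w rest)) u v
          ≡⟨ mult-++ (closeUp w w (toList s₁)) _ u v ⟩
        μ (closeUp w w (toList s₁)) u v + μ (closeUp w w (toList s₂) ++ loops w rest) u v
          ≡⟨ cong (μ (closeUp w w (toList s₁)) u v +_) (mult-++ (closeUp w w (toList s₂)) _ u v) ⟩
        μ (closeUp w w (toList s₁)) u v + (μ (closeUp w w (toList s₂)) u v + R)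
          ≡⟨ cong₂ (λ m n → m + (n + R)) (sym (e₁ u v)) (sym (e₂ u v)) ⟩
        (ε w x₁ u v + P₁) + ((ε w x₂ u v + P₂) + R) ∎

-- Splitting one vertex inside each trail and each matching.

module Detachment {U V : Set} (_≟ᵁ_ : DecidableEquality U) (_≟_ : DecidableEquality V) (part : V → U) where
  open Multiplicity _≟_
  open Trails _≟_
  module U = Counting _≟ᵁ_

  private
    μ : Edges → V → V → ℕ
    μ = mult _≟_

  -- What is carried along from the base graph: a cycle of a 2-factor, or a single edge of the
  -- 1-factor.
  data Piece : Set where
    cyc : List U → Piece
    edg : U → U → Piece

  Simple : Piece → Set
  Simple (cyc c) = ∀ v → U.count v c ≤ 1
  Simple (edg u v) = u ≢ v

  -- g a is the number of final vertices still amalgamated into a.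
  Lifted : (V → ℕ) → Piece → Set
  Lifted g (cyc c) = Σ (List V) λ t → ∀ a → count a t ≡ U.count (part a) c * g a
  Lifted g (edg u v) = Σ Edges λ es → (∀ a → count a (map proj₁ es) ≡ U.δ u (part a) * g a)
                                    × (∀ a → count a (map proj₂ es) ≡ U.δ v (part a) * g a)

  edges : ∀ {g} b → Lifted g b → Edges
  edges (cyc c) (t , _) = cycleEdges t
  edges (edg u v) (es , _) = es

  allEdges : ∀ {g bs} → All (Lifted g) bs → Edges
  allEdges [] = []
  allEdges {bs = b ∷ _} (ℓ ∷ ℓs) = edges b ℓ ++ allEdges ℓs

  mult-swap : ∀ es u v → μ (map ×-swap es) u v ≡ μ es u v
  mult-swap [] u v = refl
  mult-swap ((a , b) ∷ es) u v = cong₂ _+_ (ε-swap b a u v) (mult-swap es u v)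

  partners : V → Edges → List V
  partners w [] = []
  partners w ((a , b) ∷ es) with a ≟ w
  ... | yes _ = b ∷ partners w es
  ... | no _ = partners w es

  partners-hit : ∀ w b es → partners w ((w , b) ∷ es) ≡ b ∷ partners w es
  partners-hit w b es with w ≟ w
  ... | yes _ = refl
  ... | no ne = ⊥-elim (ne refl)

  partners-miss : ∀ {w a} b es → a ≢ w → partners w ((a , b) ∷ es) ≡ partners w es
  partners-miss {w} {a} b es ne with a ≟ w
  ... | yes e = ⊥-elim (ne e)
  ... | no _ = refl

  length-partners : ∀ w es → length (partners w es) ≡ count w (map proj₁ es)
  length-partners w [] = refl
  length-partners w ((a , b) ∷ es) with a ≟ w
  ... | yes _ = cong suc (length-partners w es)
  ... | no _ = length-partners w es

  mult-partners : ∀ w es z → count w (map proj₂ es) ≡ 0 → μ es w z ≡ count z (partners w es)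
  mult-partners w [] z e = refl
  mult-partners w ((a , b) ∷ es) z e = go (a ≟ w)
    where
    rest : μ es w z ≡ count z (partners w es)
    rest = mult-partners w es z (m+n≡0⇒n≡0 (δ b w) e)
    go : Dec (a ≡ w) → μ ((a , b) ∷ es) w z ≡ count z (partners w ((a , b) ∷ es))
    go (yes refl) = trans (cong₂ _+_ (ε-at z (δ≡0⇒≢ (m+n≡0⇒m≡0 _ e))) rest) (cong (count z) (sym (partners-hit a b es)))
    go (no ne) = trans (cong₂ _+_ (ε-avoid z ne (δ≡0⇒≢ (m+n≡0⇒m≡0 _ e))) rest) (cong (count z) (sym (partners-miss b es ne)))

  mult-avoid : ∀ w es z → count w (map proj₁ es) ≡ 0 → count w (map proj₂ es) ≡ 0 → μ es w z ≡ 0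
  mult-avoid w [] z e₁ e₂ = refl
  mult-avoid w ((a , b) ∷ es) z e₁ e₂ = cong₂ _+_ (ε-avoid z (δ≡0⇒≢ (m+n≡0⇒m≡0 _ e₁)) (δ≡0⇒≢ (m+n≡0⇒m≡0 _ e₂)))
    (mult-avoid w es z (m+n≡0⇒n≡0 (δ a w) e₁) (m+n≡0⇒n≡0 (δ b w) e₂))

  SplitEdges : V → V → V → Edges → Set
  SplitEdges w α x es = ∃ λ es' → map proj₂ es' ≡ map proj₂ es
    × (∀ a → count a (map proj₁ es') + δ w a ≡ count a (map proj₁ es) + δ α a)
    × (∀ u v → μ es' u v + μ (star w (x ∷ [])) u v ≡ μ es u v + μ (star α (x ∷ [])) u v)

  splitEdges-∷ : ∀ {w α x es} e → SplitEdges w α x es → SplitEdges w α x (e ∷ es)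
  splitEdges-∷ (a , b) (es' , seconds , counts , mults) = (a , b) ∷ es' , cong (b ∷_) seconds
    , (λ z → add (δ a z) (counts z)) , λ u v → add (ε a b u v) (mults u v)
    where
    add : ∀ k {x y x' y'} → x + y ≡ x' + y' → k + x + y ≡ k + x' + y'
    add k {x} {y} {x'} {y'} e = trans (+-assoc k x y) (trans (cong (k +_) e) (sym (+-assoc k x' y')))

  splitEdges : ∀ w α es {x} → x ∈ partners w es → SplitEdges w α x es
  splitEdges w α ((a , b) ∷ es) x∈ with a ≟ w
  splitEdges w α ((a , b) ∷ es) (here refl) | yes refl = (α , b) ∷ es , refl
    , (λ z → exchange (δ α z) (count z (map proj₁ es)) (δ w z))
    , λ u v → exchange₀ (ε α b u v) (μ es u v) (ε w b u v)
    where
    exchange : ∀ x y z → x + y + z ≡ z + y + x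
    exchange = solve-∀
    exchange₀ : ∀ x y z → x + y + (z + 0) ≡ z + y + (x + 0)
    exchange₀ = solve-∀
  splitEdges w α ((a , b) ∷ es) (there x∈) | yes refl = splitEdges-∷ (a , b) (splitEdges w α es x∈)
  splitEdges w α ((a , b) ∷ es) x∈ | no _ = splitEdges-∷ (a , b) (splitEdges w α es x∈)

  -- One unit of weight moves from `w` to `α`. The additive form of `update` avoids truncated
  -- subtraction, and writing the weight of `w` as `2 + q` exposes both its lower bound and the
  -- number of dummies.
  module Step (g g' : V → ℕ) (w α : V) (q : ℕ) (same : part α ≡ part w)
    (gw : g w ≡ 2 + q) (update : ∀ a → g' a + δ w a ≡ g a + δ α a) where

    δ-part : ∀ {x a} → part x ≢ part a → δ x a ≡ 0
    δ-part ne = δ-≢ (λ e → ne (cong part e))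

    unchanged : ∀ {a} → part w ≢ part a → g' a ≡ g a
    unchanged {a} ne = begin
      g' a ≡⟨ +-identityʳ _ ⟨
      g' a + 0 ≡⟨ cong (g' a +_) (δ-part ne) ⟨
      g' a + δ w a ≡⟨ update a ⟩
      g a + δ α a ≡⟨ cong (g a +_) (δ-part (λ e → ne (trans (sym same) e))) ⟩
      g a + 0 ≡⟨ +-identityʳ _ ⟩
      g a ∎
      where open ≡-Reasoning

    -- Here `k` counts how often a piece meets each part. Weights change only in the part of `w`,
    -- where the factor `k` vanishes.
    untouched : ∀ (k : U → ℕ) → k (part w) ≡ 0 → ∀ a → k (part a) * g a ≡ k (part a) * g' a
    untouched k e a with part w ≟ᵁ part a
    ... | yes p = trans (cong (_* g a) k0) (sym (cong (_* g' a) k0))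
      where k0 = trans (cong k (sym p)) e
    ... | no ne = cong (k (part a) *_) (sym (unchanged ne))

    touched : ∀ (k : U → ℕ) → k (part w) ≡ 1 → ∀ (t t' : List V) → (∀ a → count a t ≡ k (part a) * g a) →
      (∀ a → count a t' + δ w a ≡ count a t + δ α a) → ∀ a → count a t' ≡ k (part a) * g' a
    touched k k1 t t' old change a with part w ≟ᵁ part a
    ... | yes p = +-cancelʳ-≡ (δ w a) _ _ (begin
      count a t' + δ w a ≡⟨ change a ⟩
      count a t + δ α a ≡⟨ cong (_+ δ α a) (trans (old a) (trans (cong (_* g a) k1') (*-identityˡ _))) ⟩
      g a + δ α a ≡⟨ update a ⟨
      g' a + δ w a ≡⟨ cong (_+ δ w a) (trans (cong (_* g' a) k1') (*-identityˡ _)) ⟨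
      k (part a) * g' a + δ w a ∎)
      where
      open ≡-Reasoning
      k1' = trans (cong k (sym p)) k1
    ... | no ne = begin
      count a t' ≡⟨ +-identityʳ _ ⟨
      count a t' + 0 ≡⟨ cong (count a t' +_) (δ-part ne) ⟨
      count a t' + δ w a ≡⟨ change a ⟩
      count a t + δ α a ≡⟨ cong₂ _+_ (old a) (δ-part (λ e → ne (trans (sym same) e))) ⟩
      k (part a) * g a + 0 ≡⟨ +-identityʳ _ ⟩
      k (part a) * g a ≡⟨ cong (k (part a) *_) (unchanged ne) ⟨
      k (part a) * g' a ∎
      where open ≡-Reasoning

    -- All that the global choice has to know about a piece: which ends at `w` it offers, and that
    -- any legal selection can be carried out inside it, whatever the other pieces do.
    record Gadget (b : Piece) (ℓ : Lifted g b) : Set where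
      field
        shape : Shape
        size  : OfSize (2 + q) shape
        ends  : ∀ z → μ (edges b ℓ) w z ≡ count z (endpoints shape)
        split : ∀ {Y} → Select shape Y → Σ (Lifted g' b) λ ℓ' → ∀ u v →
          μ (edges b ℓ') u v + μ (star w Y) u v ≡ μ (edges b ℓ) u v + μ (star α Y) u v

    gadget : ∀ b → Simple b → (ℓ : Lifted g b) → μ (edges b ℓ) w w ≡ 0 → Gadget b ℓ
    -- The cycle `c` meets the part of `w` at most once, so its trail visits `w` either never or
    -- exactly `g w` times.
    gadget (cyc c) simple (t , old) noloop with U.count (part w) c in eq | simple (part w)
    ... | zero | _ = record
      { shape = none ; size = tt
      ; ends = λ z → mult-cycle-avoid t z (trans (old w) (cong (_* g w) eq))
      ; split = λ { none → (t , λ a → trans (old a) (untouched (λ u → U.count u c) eq a)) , λ u v → refl } }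
    ... | suc (suc _) | s≤s ()
    ... | suc zero | _ = record
      { shape = pairs (Cut.segments C)
      ; size = Cut.number C
      ; ends = λ z → trans (Cut.edges≈ C w z) (mult-loops z (Cut.avoid C))
      ; split = λ sel → let t' , change , m = splitTrail {α = α} C sel in
          (t' , touched (λ u → U.count u c) eq t t' old change) , m }
      where
      C : Cut w t (2 + q)
      C = cut (suc q) (trans (old w) (trans (cong (_* g w) eq) (trans (*-identityˡ _) gw))) noloop
    gadget (edg u v) u≢v (es , old₁ , old₂) noloop with u ≟ᵁ part w | v ≟ᵁ part w
    ... | yes refl | yes refl = ⊥-elim (u≢v refl)
    ... | yes refl | no v≢ = record
      { shape = single (partners w es)
      ; size = trans (length-partners w es) (trans (old₁ w) (trans (cong (_* g w) (U.δ-refl u)) (trans (*-identityˡ _) gw)))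
      ; ends = λ z → mult-partners w es z (trans (old₂ w) (cong (_* g w) (U.δ-≢ v≢)))
      ; split = λ { (single x∈) → let es' , e , change , m = splitEdges w α es x∈ in
          (es' , touched (U.δ u) (U.δ-refl u) (map proj₁ es) (map proj₁ es') old₁ change
               , λ a → trans (cong (count a) e) (trans (old₂ a) (untouched (U.δ v) (U.δ-≢ v≢) a))) , m } }
    -- Now `w` lies on the second side of the matching. Swapping all edges reduces this to the
    -- previous case, and the result is swapped back.
    ... | no u≢ | yes refl = record
      { shape = single (partners w fs)
      ; size = trans (length-partners w fs) (trans (cong (count w) (firsts es)) (trans (old₂ w) (trans (cong (_* g w) (U.δ-refl v)) (trans (*-identityˡ _) gw))))
      ; ends = λ z → trans (sym (mult-swap es w z)) (mult-partners w fs z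
          (trans (cong (count w) (seconds es)) (trans (old₁ w) (cong (_* g w) (U.δ-≢ u≢)))))
      ; split = λ { (single x∈) → let fs' , e , change , m = splitEdges w α fs x∈ in
          (map ×-swap fs'
          , (λ a → trans (cong (count a) (trans (firsts fs') (trans e (seconds es)))) (trans (old₁ a) (untouched (U.δ u) (U.δ-≢ u≢) a)))
          , (λ a → trans (cong (count a) (seconds fs')) (touched (U.δ v) (U.δ-refl v) (map proj₁ fs) (map proj₁ fs')
               (λ a → trans (cong (count a) (firsts es)) (old₂ a)) change a)))
          , λ x y → trans (cong (_+ _) (mult-swap fs' x y)) (trans (m x y) (cong (_+ _) (mult-swap es x y))) } }
      where
      fs = map ×-swap es
      firsts : ∀ es → map proj₁ (map ×-swap es) ≡ map proj₂ es
      firsts [] = refl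
      firsts (e ∷ es) = cong (_ ∷_) (firsts es)
      seconds : ∀ es → map proj₂ (map ×-swap es) ≡ map proj₁ es
      seconds [] = refl
      seconds (e ∷ es) = cong (_ ∷_) (seconds es)
    ... | no u≢ | no v≢ = record
      { shape = none ; size = tt
      ; ends = λ z → mult-avoid w es z (trans (old₁ w) (cong (_* g w) (U.δ-≢ u≢))) (trans (old₂ w) (cong (_* g w) (U.δ-≢ v≢)))
      ; split = λ { none → (es , (λ a → trans (old₁ a) (untouched (U.δ u) (U.δ-≢ u≢) a))
                               , (λ a → trans (old₂ a) (untouched (U.δ v) (U.δ-≢ v≢) a))) , λ u v → refl } }

    record Gadgets {bs} (ℓs : All (Lifted g) bs) : Set where
      field
        shapes : List Shape
        sizes  : All (OfSize (2 + q)) shapes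
        ends   : ∀ z → μ (allEdges ℓs) w z ≡ count z (concatMap endpoints shapes)
        split  : ∀ {Ys} → Pointwise Select shapes Ys → Σ (All (Lifted g') bs) λ ℓs' → ∀ u v →
          μ (allEdges ℓs') u v + μ (star w (concat Ys)) u v ≡ μ (allEdges ℓs) u v + μ (star α (concat Ys)) u v

    gadgets : ∀ {bs} → All Simple bs → (ℓs : All (Lifted g) bs) → μ (allEdges ℓs) w w ≡ 0 → Gadgets ℓs
    gadgets [] [] noloop = record { shapes = [] ; sizes = [] ; ends = λ z → refl ; split = λ { [] → [] , λ u v → refl } }
    gadgets {b ∷ bs} (s ∷ ss) (ℓ ∷ ℓs) noloop = record
      { shapes = G.shape ∷ H.shapes
      ; sizes = G.size ∷ H.sizes
      ; ends = λ z → trans (mult-++ (edges b ℓ) _ w z) (trans (cong₂ _+_ (G.ends z) (H.ends z)) (sym (count-++ z (endpoints G.shape) _)))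
      ; split = λ { (_∷_ {y = Y} {ys = Ys} sel sels) →
          let ℓ' , m = G.split sel ; ℓs' , ms = H.split sels in ℓ' ∷ ℓs' , λ u v →
            trans (cong₂ _+_ (mult-++ (edges b ℓ') (allEdges ℓs') u v) (star-++ w Y (concat Ys) u v))
              (trans (interchange (μ (edges b ℓ') u v) _ (μ (star w Y) u v) _)
                (trans (cong₂ _+_ (m u v) (ms u v))
                  (trans (interchange (μ (edges b ℓ) u v) (μ (star α Y) u v) _ _)
                    (sym (cong₂ _+_ (mult-++ (edges b ℓ) (allEdges ℓs) u v) (star-++ α Y (concat Ys) u v)))))) }
      }
      where
      noloop' : μ (edges b ℓ) w w + μ (allEdges ℓs) w w ≡ 0
      noloop' = trans (sym (mult-++ (edges b ℓ) _ w w)) noloop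
      module G = Gadget (gadget b s ℓ (m+n≡0⇒m≡0 _ noloop'))
      module H = Gadgets (gadgets ss ℓs (m+n≡0⇒n≡0 (μ (edges b ℓ) w w) noloop'))
      star-++ : ∀ x Y Z u v → μ (star x (Y ++ Z)) u v ≡ μ (star x Y) u v + μ (star x Z) u v
      star-++ x [] Z u v = refl
      star-++ x (y ∷ Y) Z u v = trans (cong (ε x y u v +_) (star-++ x Y Z u v)) (sym (+-assoc (ε x y u v) _ _))
      interchange : ∀ a b c d → a + b + (c + d) ≡ (a + c) + (b + d)
      interchange = solve-∀

-- The edge multiplicities kept invariant under splitting.

infix 4 _≈₂_
_≈₂_ : {V : Set} → Multigraph V → Multigraph V → Set
G ≈₂ H = ∀ u v → G u v ≡ H u v

module Invariant {U V : Set} (_≟ᵁ_ : DecidableEquality U) (_≟_ : DecidableEquality V) (part : V → U)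
  (verts : List V) (once : ∀ v → Counting.count _≟_ v verts ≡ 1) (κ : ℕ) where
  open Multiplicity _≟_
  open Trails _≟_
  open Detachment _≟ᵁ_ _≟_ part

  -- The complete `κ`-fold multipartite graph after identifying vertices within parts so that each
  -- `a` stands for `g a` of them; weight zero means not yet present.
  amalgam : (V → ℕ) → Multigraph V
  amalgam g u v = if ⌊ part u ≟ᵁ part v ⌋ then 0 else κ * (g u * g v)

  amalgam-same : ∀ g {u v} → part u ≡ part v → amalgam g u v ≡ 0
  amalgam-same g {u} {v} e with part u ≟ᵁ part v
  ... | yes _ = refl
  ... | no ne = ⊥-elim (ne e)

  amalgam-diff : ∀ g {u v} → part u ≢ part v → amalgam g u v ≡ κ * (g u * g v)
  amalgam-diff g {u} {v} ne with part u ≟ᵁ part v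
  ... | yes e = ⊥-elim (ne e)
  ... | no _ = refl

  count-copies : ∀ (h : V → ℕ) z xs → count z (concatMap (λ y → replicate (h y) y) xs) ≡ h z * count z xs
  count-copies h z [] = sym (*-zeroʳ (h z))
  count-copies h z (x ∷ xs) = begin
    count z (replicate (h x) x ++ concatMap _ xs) ≡⟨ count-++ z (replicate (h x) x) _ ⟩
    count z (replicate (h x) x) + count z (concatMap _ xs) ≡⟨ cong₂ _+_ (head (h x)) (count-copies h z xs) ⟩
    h x * δ x z + h z * count z xs ≡⟨ cong (_+ h z * count z xs) (same (x ≟ z)) ⟩
    h z * δ x z + h z * count z xs ≡⟨ *-distribˡ-+ (h z) (δ x z) _ ⟨
    h z * (δ x z + count z xs) ∎
    where
    open ≡-Reasoning
    head : ∀ k → count z (replicate k x) ≡ k * δ x z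
    head zero = refl
    head (suc k) = cong (δ x z +_) (head k)
    same : Dec (x ≡ z) → h x * δ x z ≡ h z * δ x z
    same (yes refl) = refl
    same (no ne) rewrite δ-≢ ne = trans (*-zeroʳ (h x)) (sym (*-zeroʳ (h z)))

  module _ (g g' : V → ℕ) (w α : V) (q : ℕ) (same : part α ≡ part w)
    (gw : g w ≡ 2 + q) (update : ∀ a → g' a + δ w a ≡ g a + δ α a) where
    open Step g g' w α q same gw update

    -- The edges that a single final vertex of the part of `w` needs towards `z`: `κ` to each of the
    -- `g z` vertices merged in `z`.
    share : V → ℕ
    share z = if ⌊ part z ≟ᵁ part w ⌋ then 0 else κ * g z

    share-same : ∀ {z} → part z ≡ part w → share z ≡ 0
    share-same {z} e with part z ≟ᵁ part w
    ... | yes _ = refl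
    ... | no ne = ⊥-elim (ne e)

    share-diff : ∀ {z} → part z ≢ part w → share z ≡ κ * g z
    share-diff {z} ne with part z ≟ᵁ part w
    ... | yes e = ⊥-elim (ne e)
    ... | no _ = refl

    caps : List V
    caps = concatMap (λ y → replicate (share y) y) verts

    count-caps : ∀ z → count z caps ≡ share z
    count-caps z = trans (count-copies share z verts) (trans (cong (share z *_) (once z)) (*-identityʳ _))

    at-w : ∀ z → amalgam g w z ≡ (2 + q) * share z
    at-w z = go (part z ≟ᵁ part w)
      where
      go : Dec (part z ≡ part w) → amalgam g w z ≡ (2 + q) * share z
      go (yes e) = trans (amalgam-same g (sym e)) (sym (trans (cong ((2 + q) *_) (share-same e)) (*-zeroʳ (2 + q))))
      go (no ne) = trans (amalgam-diff g (λ e → ne (sym e))) (trans (cong (λ x → κ * (x * g z)) gw)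
        (trans (lemma κ (2 + q) (g z)) (cong ((2 + q) *_) (sym (share-diff ne)))))
        where lemma : ∀ a b c → a * (b * c) ≡ b * (a * c)
              lemma = solve-∀

    spokes : V → V → V → ℕ
    spokes x u v = δ x u * share v + δ x v * share u

    -- For different parts `amalgam` is bilinear in the two weights, and at most one of `u` and `v`
    -- lies in the part of `w`. So moving one unit of weight from `w` to `α` moves exactly `share z`
    -- edges at every `z`.
    exchange : ∀ u v → amalgam g' u v + spokes w u v ≡ amalgam g u v + spokes α u v
    exchange u v = go (part u ≟ᵁ part v) (part u ≟ᵁ part w) (part v ≟ᵁ part w)
      where
      far : ∀ {x a} n → part x ≡ part w → part a ≢ part w → δ x a * n ≡ 0
      far {x} {a} n e ne = cong (_* n) (δ-part (λ e' → ne (trans (sym e') e)))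
      near : ∀ k {a} → part a ≡ part w → k * share a ≡ 0
      near k e = trans (cong (k *_) (share-same e)) (*-zeroʳ k)
      go : Dec (part u ≡ part v) → Dec (part u ≡ part w) → Dec (part v ≡ part w) →
        amalgam g' u v + spokes w u v ≡ amalgam g u v + spokes α u v
      go (yes e) (yes p) _ = cong₂ _+_ (trans (amalgam-same g' e) (sym (amalgam-same g e)))
        (trans (cong₂ _+_ (near (δ w u) (trans (sym e) p)) (near (δ w v) p))
          (sym (cong₂ _+_ (near (δ α u) (trans (sym e) p)) (near (δ α v) p))))
      go (yes e) (no p) _ = cong₂ _+_ (trans (amalgam-same g' e) (sym (amalgam-same g e)))
        (trans (cong₂ _+_ (far _ refl p) (far _ refl (λ e' → p (trans e e'))))
          (sym (cong₂ _+_ (far _ same p) (far _ same (λ e' → p (trans e e'))))))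
      go (no ne) (yes p) (yes r) = ⊥-elim (ne (trans p (sym r)))
      go (no ne) (yes p) (no r) = begin
        amalgam g' u v + spokes w u v
          ≡⟨ cong₂ _+_ (trans (amalgam-diff g' ne) (cong (λ x → κ * (g' u * x)) (unchanged (r ∘ sym))))
               (cong₂ _+_ (cong (δ w u *_) (share-diff r)) (far _ refl r)) ⟩
        κ * (g' u * g v) + (δ w u * (κ * g v) + 0) ≡⟨ lemma κ (g' u) (g v) (δ w u) ⟩
        κ * ((g' u + δ w u) * g v) ≡⟨ cong (λ x → κ * (x * g v)) (update u) ⟩
        κ * ((g u + δ α u) * g v) ≡⟨ lemma κ (g u) (g v) (δ α u) ⟨
        κ * (g u * g v) + (δ α u * (κ * g v) + 0)
          ≡⟨ sym (cong₂ _+_ (amalgam-diff g ne) (cong₂ _+_ (cong (δ α u *_) (share-diff r)) (far _ same r))) ⟩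
        amalgam g u v + spokes α u v ∎
        where
        open ≡-Reasoning
        lemma : ∀ k a b d → k * (a * b) + (d * (k * b) + 0) ≡ k * ((a + d) * b)
        lemma = solve-∀
      go (no ne) (no p) (yes r) = begin
        amalgam g' u v + spokes w u v
          ≡⟨ cong₂ _+_ (trans (amalgam-diff g' ne) (cong (λ x → κ * (x * g' v)) (unchanged (p ∘ sym))))
               (cong₂ _+_ (far _ refl p) (cong (δ w v *_) (share-diff p))) ⟩
        κ * (g u * g' v) + (0 + δ w v * (κ * g u)) ≡⟨ lemma κ (g u) (g' v) (δ w v) ⟩
        κ * (g u * (g' v + δ w v)) ≡⟨ cong (λ x → κ * (g u * x)) (update v) ⟩
        κ * (g u * (g v + δ α v)) ≡⟨ lemma κ (g u) (g v) (δ α v) ⟨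
        κ * (g u * g v) + (0 + δ α v * (κ * g u))
          ≡⟨ sym (cong₂ _+_ (amalgam-diff g ne) (cong₂ _+_ (far _ same p) (cong (δ α v *_) (share-diff p)))) ⟩
        amalgam g u v + spokes α u v ∎
        where
        open ≡-Reasoning
        lemma : ∀ k a b d → k * (a * b) + (0 + d * (k * a)) ≡ k * (a * (b + d))
        lemma = solve-∀
      go (no ne) (no p) (no r) = cong₂ _+_
        (trans (amalgam-diff g' ne) (trans (cong₂ (λ x y → κ * (x * y)) (unchanged (p ∘ sym)) (unchanged (r ∘ sym))) (sym (amalgam-diff g ne))))
        (trans (cong₂ _+_ (far _ refl p) (far _ refl r)) (sym (cong₂ _+_ (far _ same p) (far _ same r))))

    -- The selected ends realise `share` exactly, so the edges moved from `w` to `α` are the spokes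
    -- by which the two amalgamated graphs differ.
    step : ∀ {bs} → All Simple bs → (ℓs : All (Lifted g) bs) → mult _≟_ (allEdges ℓs) ≈₂ amalgam g →
      Σ (All (Lifted g') bs) λ ℓs' → mult _≟_ (allEdges ℓs') ≈₂ amalgam g'
    step simple ℓs inv with gadgets simple ℓs (trans (inv w w) (amalgam-same g refl))
    ... | G with select q caps (Gadgets.sizes G) (λ z → trans (sym (Gadgets.ends G z))
                   (trans (inv w z) (trans (at-w z) (cong ((2 + q) *_) (sym (count-caps z))))))
    ... | Ys , sel , cYs with Gadgets.split G sel
    ... | ℓs' , m = ℓs' , λ u v → +-cancelʳ-≡ (spokes w u v) _ _ (begin
      mult _≟_ (allEdges ℓs') u v + spokes w u v ≡⟨ cong (mult _≟_ (allEdges ℓs') u v +_) (spokes≡ refl u v) ⟨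
      mult _≟_ (allEdges ℓs') u v + mult _≟_ (star w (concat Ys)) u v ≡⟨ m u v ⟩
      mult _≟_ (allEdges ℓs) u v + mult _≟_ (star α (concat Ys)) u v ≡⟨ cong₂ _+_ (inv u v) (spokes≡ same u v) ⟩
      amalgam g u v + spokes α u v ≡⟨ exchange u v ⟨
      amalgam g' u v + spokes w u v ∎)
      where
      open ≡-Reasoning
      count-Y : ∀ z → count z (concat Ys) ≡ share z
      count-Y z = trans (cYs z) (count-caps z)
      spokes≡ : ∀ {x} → part x ≡ part w → ∀ u v → mult _≟_ (star x (concat Ys)) u v ≡ spokes x u v
      spokes≡ {x} e u v = trans (mult-star x (concat Ys) u v (trans (count-Y x) (share-same e)))
        (cong₂ (λ p r → δ x u * p + δ x v * r) (count-Y v) (count-Y u))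

-- Transport along injections, and counts in products.

module _ {A B : Set} (_≟A_ : DecidableEquality A) (_≟B_ : DecidableEquality B)
  (f : A → B) (f-inj : ∀ {x y} → f x ≡ f y → x ≡ y) where
  private
    module A = Multiplicity _≟A_
    module B = Multiplicity _≟B_

  ⌊⌋-inj : ∀ x y → ⌊ f x ≟B f y ⌋ ≡ ⌊ x ≟A y ⌋
  ⌊⌋-inj x y with x ≟A y | f x ≟B f y
  ... | yes _ | yes _ = refl
  ... | no _ | no _ = refl
  ... | yes refl | no ne = ⊥-elim (ne refl)
  ... | no ne | yes e = ⊥-elim (ne (f-inj e))

  count-map : ∀ x xs → B.count (f x) (map f xs) ≡ A.count x xs
  count-map x [] = refl
  count-map x (y ∷ xs) = cong₂ _+_ (cong (λ b → if b then 1 else 0) (⌊⌋-inj y x)) (count-map x xs)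

  mult-map : ∀ es u v → mult _≟B_ (map (×-map f f) es) (f u) (f v) ≡ mult _≟A_ es u v
  mult-map [] u v = refl
  mult-map ((a , b) ∷ es) u v = cong₂ _+_
    (cong (λ b → if b then 1 else 0) (cong₂ _∨_ (cong₂ _∧_ (⌊⌋-inj a u) (⌊⌋-inj b v)) (cong₂ _∧_ (⌊⌋-inj a v) (⌊⌋-inj b u))))
    (mult-map es u v)

module _ {A B : Set} (f : A → B) where

  closeUp-map : ∀ x y s → closeUp (f x) (f y) (map f s) ≡ map (×-map f f) (closeUp x y s)
  closeUp-map x y [] = refl
  closeUp-map x y (z ∷ s) = cong (_ ∷_) (closeUp-map x z s)

  cycleEdges-map : ∀ c → cycleEdges (map f c) ≡ map (×-map f f) (cycleEdges c)
  cycleEdges-map [] = refl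
  cycleEdges-map (x ∷ s) = closeUp-map x x s

count-map-miss : ∀ {A B : Set} (_≟B_ : DecidableEquality B) (f : A → B) y → (∀ x → f x ≢ y) → ∀ xs →
  Counting.count _≟B_ y (map f xs) ≡ 0
count-map-miss _≟B_ f y miss [] = refl
count-map-miss _≟B_ f y miss (x ∷ xs) = cong₂ _+_ (Counting.δ-≢ _≟B_ (miss x)) (count-map-miss _≟B_ f y miss xs)

count-allFin : ∀ n (i : Fin n) → Counting.count _≟ᶠ_ i (allFin n) ≡ 1
count-allFin (suc n) zero = cong suc (trans (cong (Counting.count _≟ᶠ_ zero) (sym (map-tabulate {n = n} (λ i → i) suc)))
  (count-map-miss _≟ᶠ_ suc zero (λ _ ()) (allFin n)))
count-allFin (suc n) (suc i) = trans (cong (Counting.count _≟ᶠ_ (suc i)) (sym (map-tabulate {n = n} (λ i → i) suc)))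
  (trans (count-map _≟ᶠ_ _≟ᶠ_ suc (λ { refl → refl }) i (allFin n)) (count-allFin n i))

module _ {n m : ℕ} where
  private
    _≟_ = decNM n m
    count₁ = Counting.count (_≟ᶠ_ {n})
    count₂ = Counting.count (_≟ᶠ_ {m})
    open Counting _≟_

  count-product : ∀ u k xs (ys : List (Fin m)) → count (u , k) (cartesianProduct xs ys) ≡ count₁ u xs * count₂ k ys
  count-product u k [] ys = refl
  count-product u k (x ∷ xs) ys = trans (count-++ (u , k) (map (x ,_) ys) _)
    (trans (cong₂ _+_ (fibre (x ≟ᶠ u)) (count-product u k xs ys)) (sym (*-distribʳ-+ (count₂ k ys) (Counting.δ _≟ᶠ_ x u) (count₁ u xs))))
    where
    fibre : Dec (x ≡ u) → count (u , k) (map (x ,_) ys) ≡ Counting.δ _≟ᶠ_ x u * count₂ k ys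
    fibre (yes refl) = trans (count-map _≟ᶠ_ _≟_ (x ,_) ,-injectiveʳ k ys)
      (sym (trans (cong (_* count₂ k ys) (Counting.δ-refl _≟ᶠ_ x)) (*-identityˡ _)))
    fibre (no ne) = trans (count-map-miss _≟_ (x ,_) (u , k) (λ _ e → ne (,-injectiveˡ e)) ys)
      (sym (cong (_* count₂ k ys) (Counting.δ-≢ _≟ᶠ_ ne)))

  count-product-proj₁ : ∀ u xs (ys : List (Fin m)) → count₁ u (map proj₁ (cartesianProduct xs ys)) ≡ count₁ u xs * length ys
  count-product-proj₁ u [] ys = refl
  count-product-proj₁ u (x ∷ xs) ys = begin
    count₁ u (map proj₁ (map (x ,_) ys ++ cartesianProduct xs ys))
      ≡⟨ cong (count₁ u) (map-++ proj₁ (map (x ,_) ys) _) ⟩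
    count₁ u (map proj₁ (map (x ,_) ys) ++ map proj₁ (cartesianProduct xs ys))
      ≡⟨ Counting.count-++ _≟ᶠ_ u (map proj₁ (map (x ,_) ys)) _ ⟩
    count₁ u (map proj₁ (map (x ,_) ys)) + count₁ u (map proj₁ (cartesianProduct xs ys))
      ≡⟨ cong₂ _+_ (copies ys) (count-product-proj₁ u xs ys) ⟩
    Counting.δ _≟ᶠ_ x u * length ys + count₁ u xs * length ys
      ≡⟨ *-distribʳ-+ (length ys) (Counting.δ _≟ᶠ_ x u) _ ⟨
    (Counting.δ _≟ᶠ_ x u + count₁ u xs) * length ys ∎
    where
    open ≡-Reasoning
    copies : ∀ ys → count₁ u (map proj₁ (map (x ,_) ys)) ≡ Counting.δ _≟ᶠ_ x u * length ys
    copies [] = sym (*-zeroʳ (Counting.δ _≟ᶠ_ x u))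
    copies (y ∷ ys) = trans (cong (Counting.δ _≟ᶠ_ x u +_) (copies ys)) (sym (*-suc (Counting.δ _≟ᶠ_ x u) (length ys)))

  count-verticesNM : ∀ v → count v (verticesNM n m) ≡ 1
  count-verticesNM (u , k) = trans (count-product u k (allFin n) (allFin m)) (cong₂ _*_ (count-allFin n u) (count-allFin m k))

-- The amalgamated starting position and its complete detachment.

module Lifting (n m' κ : ℕ) where
  m : ℕ
  m = suc m'

  V : Set
  V = Fin n × Fin m

  _≟_ : DecidableEquality V
  _≟_ = decNM n m

  open Multiplicity _≟_
  open Invariant (_≟ᶠ_ {n}) _≟_ proj₁ (verticesNM n m) count-verticesNM κ public
  open Detachment (_≟ᶠ_ {n}) _≟_ proj₁ public

  private
    module P = Counting (decNM n m')
    μ : Edges → V → V → ℕ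
    μ = mult _≟_

  -- P lists the vertices not yet split off; (u , zero) still stands for those of them in part u.
  weight : List (Fin n × Fin m') → V → ℕ
  weight P (u , zero) = suc (U.count u (map proj₁ P))
  weight P (u , suc k) = 1 ∸ P.count (u , k) P

  -- The head `(u , k)` of the list is split off from `(u , zero)`, which stands for itself, for
  -- this vertex and for the remaining ones of part `u`. Its weight is therefore 2 plus the number
  -- remaining, as `step` requires.
  detachAll : ∀ P → (∀ x → P.count x P ≤ 1) → ∀ {bs} → All Simple bs →
    (ℓs : All (Lifted (weight P)) bs) → μ (allEdges ℓs) ≈₂ amalgam (weight P) →
    Σ (All (Lifted (weight [])) bs) λ ℓs' → μ (allEdges ℓs') ≈₂ amalgam (weight [])
  detachAll [] _ simple ℓs inv = ℓs , inv
  detachAll ((u , k) ∷ P) distinct simple ℓs inv =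
    let ℓs' , inv' = step (weight ((u , k) ∷ P)) (weight P) (u , zero) (u , suc k) (U.count u (map proj₁ P)) refl
                       (cong (λ d → suc (d + U.count u (map proj₁ P))) (U.δ-refl u)) update simple ℓs inv
    in detachAll P (λ x → ≤-trans (m≤n+m _ _) (distinct x)) simple ℓs' inv'
    where
    -- Because the list has no repetitions, the weight of the new vertex rises from 0 to 1 when the
    -- head is dropped.
    fresh : P.count (u , k) P ≡ 0
    fresh = n≤0⇒n≡0 (≤-pred (subst (λ d → d + P.count (u , k) P ≤ 1) (P.δ-refl (u , k)) (distinct (u , k))))
    update : ∀ a → weight P a + δ (u , zero) a ≡ weight ((u , k) ∷ P) a + δ (u , suc k) a
    update (v , zero) = trans (cong (suc (U.count v (map proj₁ P)) +_) δ-part₁)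
      (trans (cong suc (+-comm (U.count v (map proj₁ P)) _))
        (sym (trans (cong (suc (U.δ u v + U.count v (map proj₁ P)) +_) (δ-≢ {u , suc k} {v , zero} (λ ()))) (+-identityʳ _))))
      where
      δ-part₁ : δ (u , zero) (v , zero) ≡ U.δ u v
      δ-part₁ = cong (λ b → if b then 1 else 0) (⌊⌋-inj _≟ᶠ_ _≟_ (_, zero) ,-injectiveˡ u v)
    update (v , suc j) = trans (cong ((1 ∸ P.count (v , j) P) +_) (δ-≢ {u , zero} {v , suc j} (λ ())))
      (trans (+-identityʳ _) (sym (trans (cong ((1 ∸ P.count (v , j) ((u , k) ∷ P)) +_) δ-suc) (hit (decNM n m' (u , k) (v , j))))))
      where
      δ-suc : δ (u , suc k) (v , suc j) ≡ P.δ (u , k) (v , j)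
      δ-suc = cong (λ b → if b then 1 else 0) (⌊⌋-inj (decNM n m') _≟_ (×-map (λ x → x) suc) (λ { refl → refl }) (u , k) (v , j))
      hit : Dec ((u , k) ≡ (v , j)) → (1 ∸ (P.δ (u , k) (v , j) + P.count (v , j) P)) + P.δ (u , k) (v , j) ≡ 1 ∸ P.count (v , j) P
      hit (yes refl) rewrite P.δ-refl (u , k) | fresh = refl
      hit (no ne) rewrite P.δ-≢ ne = +-identityʳ _

  unsplit : List (Fin n × Fin m')
  unsplit = verticesNM n m'

  ι : Fin n → V
  ι u = u , zero

  count-ι : ∀ u xs → count (ι u) (map ι xs) ≡ U.count u xs
  count-ι = count-map _≟ᶠ_ _≟_ ι ,-injectiveˡ

  count-ι-miss : ∀ u k xs → count (u , suc k) (map ι xs) ≡ 0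
  count-ι-miss u k = count-map-miss _≟_ ι (u , suc k) (λ _ ())

  weight-all-zero : ∀ u → weight unsplit (ι u) ≡ m
  weight-all-zero u = cong suc (trans (count-product-proj₁ u (allFin n) (allFin m'))
    (trans (cong (_* length (allFin m')) (count-allFin n u)) (trans (*-identityˡ _) (length-tabulate {n = m'} (λ i → i)))))

  weight-all-suc : ∀ u k → weight unsplit (u , suc k) ≡ 0
  weight-all-suc u k = cong (1 ∸_) (count-verticesNM (u , k))

  copies-ι : ∀ xs a → count a (concat (replicate m (map ι xs))) ≡ U.count (proj₁ a) xs * weight unsplit a
  copies-ι xs (u , zero) = trans (count-concat-replicate m (ι u) (map ι xs))
    (trans (cong (m *_) (count-ι u xs)) (trans (*-comm m _) (cong (U.count u xs *_) (sym (weight-all-zero u)))))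
  copies-ι xs (u , suc k) = trans (count-concat-replicate m (u , suc k) (map ι xs))
    (trans (cong (m *_) (count-ι-miss u k xs)) (trans (*-zeroʳ m)
      (sym (trans (cong (U.count u xs *_) (weight-all-suc u k)) (*-zeroʳ (U.count u xs))))))

  pieceEdges : Piece → List (Fin n × Fin n)
  pieceEdges (cyc c) = cycleEdges c
  pieceEdges (edg u v) = (u , v) ∷ []

  initial : ∀ b → Lifted (weight unsplit) b
  initial (cyc c) = concat (replicate m (map ι c)) , copies-ι c
  initial (edg u v) = replicate m (ι u , ι v) , firsts , seconds
    where
    map-replicate-concat : ∀ {A B : Set} (f : A → B) k x → map f (replicate k x) ≡ concat (replicate k (f x ∷ []))
    map-replicate-concat f zero x = refl
    map-replicate-concat f (suc k) x = cong (f x ∷_) (map-replicate-concat f k x)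
    firsts : ∀ a → count a (map proj₁ (replicate m (ι u , ι v))) ≡ U.δ u (proj₁ a) * weight unsplit a
    firsts a = trans (cong (count a) (map-replicate-concat proj₁ m (ι u , ι v)))
      (trans (copies-ι (u ∷ []) a) (cong (_* weight unsplit a) (+-identityʳ (U.δ u (proj₁ a)))))
    seconds : ∀ a → count a (map proj₂ (replicate m (ι u , ι v))) ≡ U.δ v (proj₁ a) * weight unsplit a
    seconds a = trans (cong (count a) (map-replicate-concat proj₂ m (ι u , ι v)))
      (trans (copies-ι (v ∷ []) a) (cong (_* weight unsplit a) (+-identityʳ (U.δ v (proj₁ a)))))

  closeUp-repeat : ∀ (x p : V) s t k →
    closeUp x p (s ++ concat (replicate k (x ∷ t))) ≡ closeUp x p s ++ concat (replicate k (closeUp x x t))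
  closeUp-repeat x p s t zero = trans (cong (closeUp x p) (++-identityʳ s)) (sym (++-identityʳ _))
  closeUp-repeat x p s t (suc k) = trans (closeUp-++ x p s x (t ++ concat (replicate k (x ∷ t))))
    (cong (closeUp x p s ++_) (closeUp-repeat x x t t k))

  -- After each round the walk returns to its first vertex along the closing edge of `c`, so every
  -- round uses all edges of `c`. The first round opens the walk, which leaves `m'` repetitions.
  cycleEdges-repeat : ∀ (c : List V) → cycleEdges (concat (replicate m c)) ≡ concat (replicate m (cycleEdges c))
  cycleEdges-repeat [] = trans (cong cycleEdges (empty m)) (sym (empty m))
    where
    empty : ∀ {A : Set} k → concat (replicate k ([] {A = A})) ≡ []
    empty zero = refl
    empty (suc k) = empty k
  cycleEdges-repeat (x ∷ s) = closeUp-repeat x x s s m'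

  edges-initial : ∀ b → edges b (initial b) ≡ concat (replicate m (map (×-map ι ι) (pieceEdges b)))
  edges-initial (cyc c) = trans (cycleEdges-repeat (map ι c)) (cong (λ l → concat (replicate m l)) (cycleEdges-map ι c))
  edges-initial (edg u v) = singles m
    where
    e : V × V
    e = ι u , ι v
    singles : ∀ k → replicate k e ≡ concat (replicate k (e ∷ []))
    singles zero = refl
    singles (suc k) = cong (e ∷_) (singles k)

  initials : ∀ bs → All (Lifted (weight unsplit)) bs
  initials [] = []
  initials (b ∷ bs) = initial b ∷ initials bs

  mult-initials : ∀ bs a b → μ (allEdges (initials bs)) a b ≡ m * μ (map (×-map ι ι) (concatMap pieceEdges bs)) a b
  mult-initials [] a b = sym (*-zeroʳ m)
  mult-initials (p ∷ bs) a b = begin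
    μ (edges p (initial p) ++ allEdges (initials bs)) a b ≡⟨ mult-++ (edges p (initial p)) _ a b ⟩
    μ (edges p (initial p)) a b + μ (allEdges (initials bs)) a b
      ≡⟨ cong₂ _+_ (trans (cong (λ l → μ l a b) (edges-initial p)) (mult-concat-replicate m (map (×-map ι ι) (pieceEdges p)) a b))
           (mult-initials bs a b) ⟩
    m * μ (map (×-map ι ι) (pieceEdges p)) a b + m * μ (map (×-map ι ι) (concatMap pieceEdges bs)) a b
      ≡⟨ *-distribˡ-+ m (μ (map (×-map ι ι) (pieceEdges p)) a b) _ ⟨
    m * (μ (map (×-map ι ι) (pieceEdges p)) a b + μ (map (×-map ι ι) (concatMap pieceEdges bs)) a b)
      ≡⟨ cong (m *_) (trans (cong (λ l → μ l a b) (map-++ (×-map ι ι) (pieceEdges p) _)) (mult-++ (map (×-map ι ι) (pieceEdges p)) _ a b)) ⟨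
    m * μ (map (×-map ι ι) (concatMap pieceEdges (p ∷ bs))) a b ∎
    where open ≡-Reasoning

  mult-ι-miss : ∀ es u k b → μ (map (×-map ι ι) es) (u , suc k) b ≡ 0
  mult-ι-miss es u k b = mult-avoid (u , suc k) (map (×-map ι ι) es) b
    (trans (cong (count (u , suc k)) (trans (sym (map-∘ es)) (map-∘ es))) (count-ι-miss u k (map proj₁ es)))
    (trans (cong (count (u , suc k)) (trans (sym (map-∘ es)) (map-∘ es))) (count-ι-miss u k (map proj₂ es)))

  -- Two representatives have weight `m` each, and `m` rounds through `κ * m` base edges give
  -- `κ * (m * m)`. All other vertices have weight zero and carry no edge.
  invariant-initials : ∀ bs → mult _≟ᶠ_ (concatMap pieceEdges bs) ≈₂ completeMulti n (κ * m) →
    μ (allEdges (initials bs)) ≈₂ amalgam (weight unsplit)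
  invariant-initials bs decomp a b = trans (mult-initials bs a b) (go a b)
    where
    E = concatMap pieceEdges bs
    vanish : ∀ a b → μ (map (×-map ι ι) E) a b ≡ 0 → κ * (weight unsplit a * weight unsplit b) ≡ 0 →
      m * μ (map (×-map ι ι) E) a b ≡ amalgam (weight unsplit) a b
    vanish a b e g with proj₁ a ≟ᶠ proj₁ b
    ... | yes _ = trans (cong (m *_) e) (*-zeroʳ m)
    ... | no _ = trans (trans (cong (m *_) e) (*-zeroʳ m)) (sym g)
    go : ∀ a b → m * μ (map (×-map ι ι) E) a b ≡ amalgam (weight unsplit) a b
    go (u , zero) (v , zero) = trans (cong (m *_) (trans (mult-map _≟ᶠ_ _≟_ ι ,-injectiveˡ E u v) (decomp u v))) main
      where
      main : m * completeMulti n (κ * m) u v ≡ amalgam (weight unsplit) (ι u) (ι v)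
      main with u ≟ᶠ v
      ... | yes _ = *-zeroʳ m
      ... | no _ = trans (lemma m κ) (sym (cong₂ (λ x y → κ * (x * y)) (weight-all-zero u) (weight-all-zero v)))
        where lemma : ∀ m κ → m * (κ * m) ≡ κ * (m * m)
              lemma = solve-∀
    go (u , suc k) b = vanish (u , suc k) b (mult-ι-miss E u k b)
      (trans (cong (λ x → κ * (x * weight unsplit b)) (weight-all-suc u k)) (*-zeroʳ κ))
    go (u , zero) (v , suc k) = vanish (ι u) (v , suc k)
      (trans (mult-sym (map (×-map ι ι) E) (ι u) (v , suc k)) (mult-ι-miss E v k (ι u)))
      (trans (cong (λ x → κ * (weight unsplit (ι u) * x)) (weight-all-suc v k))
        (trans (cong (κ *_) (*-zeroʳ (weight unsplit (ι u)))) (*-zeroʳ κ)))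

-- Blow-up of a 2-factorization of the base multigraph.

module Blowup (n m : ℕ) where

  Vertex : Set
  Vertex = Fin n × Fin m

  _≟_ : DecidableEquality Vertex
  _≟_ = decNM n m

  open Multiplicity _≟_ public
  module Base = Multiplicity (_≟ᶠ_ {n})

  factorsMult : List (TwoFactorData Vertex) → Vertex → Vertex → ℕ
  factorsMult Fs u v = sum (map (λ F → mult _≟_ (factorEdges F) u v) Fs)

  -- A perfect matching between parts `u` and `v`, with every edge directed from `u` to `v`. The
  -- direction is what later allows a second matching between the same parts to be formed by
  -- shifting the first ends.
  Matched : Fin n × Fin n → Edges → Set
  Matched (u , v) es = (∀ a → count a (map proj₁ es) ≡ Base.δ u (proj₁ a))
                     × (∀ a → count a (map proj₂ es) ≡ Base.δ v (proj₁ a))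

  -- The lifted 1-factor is kept in groups, one per base edge, so that it can either remain a
  -- 1-factor or be closed up between each pair of parts.
  record Lift (κ : ℕ) (types : List (List ℕ)) (M : List (Fin n × Fin n)) : Set where
    field
      factors    : List (TwoFactorData Vertex)
      twoFactors : All (IsTwoFactor (verticesNM n m)) factors
      types≡     : map factorType factors ≡ map (map (m *_)) types
      groups     : List Edges
      matched    : Pointwise Matched M groups
      decomposes : ∀ u v → completeMultipartite n m κ u v ≡ factorsMult factors u v + mult _≟_ (concat groups) u v

module _ (n m' κ : ℕ) where
  open Lifting n m' κ hiding (V; _≟_)
  open Blowup n m

  private
    g₁ = weight []
    Over : List (Fin n) → List Vertex → Set
    Over c t = ∀ a → count a t ≡ Base.count (proj₁ a) c

  weight-one : ∀ a → g₁ a ≡ 1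
  weight-one (u , zero) = refl
  weight-one (u , suc k) = refl

  amalgam-one : amalgam g₁ ≈₂ completeMultipartite n m κ
  amalgam-one u v with proj₁ u ≟ᶠ proj₁ v
  ... | yes _ = refl
  ... | no _ = trans (cong₂ (λ x y → κ * (x * y)) (weight-one u) (weight-one v)) (*-identityʳ κ)

  pieces : List (TwoFactorData (Fin n)) → List (Fin n × Fin n) → List Piece
  pieces [] M = map (uncurry edg) M
  pieces (F ∷ Fs) M = map cyc F ++ pieces Fs M

  pieces-mult : ∀ Fs M u v → mult _≟ᶠ_ (concatMap pieceEdges (pieces Fs M)) u v
    ≡ sum (map (λ F → mult _≟ᶠ_ (factorEdges F) u v) Fs) + mult _≟ᶠ_ M u v
  pieces-mult [] M u v = cong (λ l → mult _≟ᶠ_ l u v) (singles M)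
    where
    singles : ∀ M → concatMap pieceEdges (map (uncurry edg) M) ≡ M
    singles [] = refl
    singles (e ∷ M) = cong (e ∷_) (singles M)
  pieces-mult (F ∷ Fs) M u v = begin
    mult _≟ᶠ_ (concatMap pieceEdges (map cyc F ++ pieces Fs M)) u v
      ≡⟨ cong (λ l → mult _≟ᶠ_ l u v) (concatMap-++ pieceEdges (map cyc F) _) ⟩
    mult _≟ᶠ_ (concatMap pieceEdges (map cyc F) ++ concatMap pieceEdges (pieces Fs M)) u v
      ≡⟨ Base.mult-++ (concatMap pieceEdges (map cyc F)) _ u v ⟩
    mult _≟ᶠ_ (concatMap pieceEdges (map cyc F)) u v + mult _≟ᶠ_ (concatMap pieceEdges (pieces Fs M)) u v
      ≡⟨ cong₂ _+_ (cong (λ l → mult _≟ᶠ_ l u v) (cycles F)) (pieces-mult Fs M u v) ⟩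
    mult _≟ᶠ_ (factorEdges F) u v + (sum (map (λ F → mult _≟ᶠ_ (factorEdges F) u v) Fs) + mult _≟ᶠ_ M u v)
      ≡⟨ +-assoc (mult _≟ᶠ_ (factorEdges F) u v) _ _ ⟨
    mult _≟ᶠ_ (factorEdges F) u v + sum (map (λ F → mult _≟ᶠ_ (factorEdges F) u v) Fs) + mult _≟ᶠ_ M u v ∎
    where
    open ≡-Reasoning
    cycles : ∀ F → concatMap pieceEdges (map cyc F) ≡ factorEdges F
    cycles [] = refl
    cycles (c ∷ F) = cong (cycleEdges c ++_) (cycles F)

  pieces-simple : ∀ {Fs M} → All (IsTwoFactor (verticesK n)) Fs → All (λ e → proj₁ e ≢ proj₂ e) M → All Simple (pieces Fs M)
  pieces-simple [] ne = All.map⁺ ne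
  pieces-simple {F ∷ Fs} ((_ , perm) ∷ ok) ne = All.++⁺
    (All.map⁺ (simple F (λ v → ≤-reflexive (trans (Base.count-↭ v perm) (count-allFin n v))))) (pieces-simple ok ne)
    where
    simple : ∀ F → (∀ v → Base.count v (concat F) ≤ 1) → All (λ c → Simple (cyc c)) F
    simple [] h = []
    simple (c ∷ F) h = (λ v → ≤-trans (m≤m+n _ _) (≤-trans (≤-reflexive (sym (Base.count-++ v c (concat F)))) (h v)))
      ∷ simple F (λ v → ≤-trans (m≤n+m _ (Base.count v c)) (≤-trans (≤-reflexive (sym (Base.count-++ v c (concat F)))) (h v)))

  unpackFactor : ∀ F {bs} (ℓs : All (Lifted g₁) (map cyc F ++ bs)) →
    ∃ λ ts → Pointwise Over F ts × Σ (All (Lifted g₁) bs) λ ℓs' →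
      ∀ u v → mult _≟_ (allEdges ℓs) u v ≡ mult _≟_ (factorEdges ts) u v + mult _≟_ (allEdges ℓs') u v
  unpackFactor [] ℓs = [] , [] , ℓs , λ u v → refl
  unpackFactor (c ∷ F) ((t , ct) ∷ ℓs) =
    let ts , over , ℓs' , m = unpackFactor F ℓs in
    t ∷ ts , (λ a → trans (ct a) (trans (cong (U.count (proj₁ a) c *_) (weight-one a)) (*-identityʳ _))) ∷ over , ℓs'
    , λ u v → trans (mult-++ (cycleEdges t) _ u v) (trans (cong (mult _≟_ (cycleEdges t) u v +_) (m u v))
        (trans (sym (+-assoc (mult _≟_ (cycleEdges t) u v) _ _)) (cong (_+ mult _≟_ (allEdges ℓs') u v) (sym (mult-++ (cycleEdges t) _ u v)))))

  unpackMatching : ∀ M (ℓs : All (Lifted g₁) (map (uncurry edg) M)) →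
    ∃ λ groups → Pointwise Matched M groups × (∀ u v → mult _≟_ (allEdges ℓs) u v ≡ mult _≟_ (concat groups) u v)
  unpackMatching [] [] = [] , [] , λ u v → refl
  unpackMatching ((x , y) ∷ M) ((es , c₁ , c₂) ∷ ℓs) =
    let groups , ok , m = unpackMatching M ℓs in
    es ∷ groups , (one x (map proj₁ es) c₁ , one y (map proj₂ es) c₂) ∷ ok
    , λ u v → trans (mult-++ es _ u v) (trans (cong (mult _≟_ es u v +_) (m u v)) (sym (mult-++ es _ u v)))
    where
    one : ∀ x xs → (∀ a → count a xs ≡ U.δ x (proj₁ a) * g₁ a) → ∀ a → count a xs ≡ Base.δ x (proj₁ a)
    one x xs h a = trans (h a) (trans (cong (U.δ x (proj₁ a) *_) (weight-one a)) (*-identityʳ _))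

  -- A trail over `c` has the same counts as `cartesianProduct c (allFin m)`, which gives its
  -- length. Over the whole 2-factor every vertex is counted once, so the trails are disjoint
  -- spanning cycles.
  over-factor : ∀ F {ts} → Pointwise Over F ts → IsTwoFactor (verticesK n) F →
    IsTwoFactor (verticesNM n m) ts × factorType ts ≡ map (m *_) (factorType F)
  over-factor F over (long , perm) = (longs over long , count≡⇒↭ _ _ (λ a → trans (total over a)
      (trans (Base.count-↭ (proj₁ a) perm) (trans (count-allFin n (proj₁ a)) (sym (count-verticesNM a)))))) , lengths over
    where
    length-product : ∀ {A B : Set} (xs : List A) (ys : List B) → length (cartesianProduct xs ys) ≡ length xs * length ys
    length-product [] ys = refl
    length-product (x ∷ xs) ys = trans (length-++ (map (x ,_) ys)) (cong₂ _+_ (length-map (x ,_) ys) (length-product xs ys))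
    length-over : ∀ c t → Over c t → length t ≡ m * length c
    length-over c t o = trans (↭-length (count≡⇒↭ t (cartesianProduct c (allFin m))
      (λ a → trans (o a) (sym (trans (count-product (proj₁ a) (proj₂ a) c (allFin m))
        (trans (cong (Base.count (proj₁ a) c *_) (count-allFin m (proj₂ a))) (*-identityʳ _)))))))
      (trans (length-product c (allFin m)) (trans (*-comm (length c) _) (cong (_* length c) (length-tabulate {n = m} (λ i → i)))))
    lengths : ∀ {F ts} → Pointwise Over F ts → factorType ts ≡ map (m *_) (factorType F)
    lengths [] = refl
    lengths (_∷_ {x = c} {y = t} o os) = cong₂ _∷_ (length-over c t o) (lengths os)
    longs : ∀ {F ts} → Pointwise Over F ts → All (λ c → 2 ≤ length c) F → All (λ c → 2 ≤ length c) ts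
    longs [] [] = []
    longs (_∷_ {x = c} {y = t} o os) (l ∷ ls) = ≤-trans l (≤-trans (m≤m+n (length c) _) (≤-reflexive (sym (length-over c t o)))) ∷ longs os ls
    total : ∀ {F ts} → Pointwise Over F ts → ∀ a → count a (concat ts) ≡ Base.count (proj₁ a) (concat F)
    total [] a = refl
    total (_∷_ {x = c} {y = t} o os) a = trans (count-++ a t _) (trans (cong₂ _+_ (o a) (total os a)) (sym (Base.count-++ (proj₁ a) c _)))

  unpack : ∀ Fs M → All (IsTwoFactor (verticesK n)) Fs → (ℓs : All (Lifted g₁) (pieces Fs M)) →
    mult _≟_ (allEdges ℓs) ≈₂ completeMultipartite n m κ → Lift κ (map factorType Fs) M
  unpack Fs M ok ℓs inv =
    let factors , two , types≡ , groups , matched , m≡ = go Fs ok ℓs in record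
    { factors = factors ; twoFactors = two ; types≡ = types≡ ; groups = groups ; matched = matched
    ; decomposes = λ u v → trans (sym (inv u v)) (m≡ u v) }
    where
    go : ∀ Fs → All (IsTwoFactor (verticesK n)) Fs → (ℓs : All (Lifted g₁) (pieces Fs M)) →
      ∃ λ factors → All (IsTwoFactor (verticesNM n m)) factors
        × map factorType factors ≡ map (map (m *_)) (map factorType Fs)
        × ∃ λ groups → Pointwise Matched M groups
        × (∀ u v → mult _≟_ (allEdges ℓs) u v ≡ factorsMult factors u v + mult _≟_ (concat groups) u v)
    go [] [] ℓs = let groups , matched , e = unpackMatching M ℓs in [] , [] , refl , groups , matched , e
    go (F ∷ Fs) (okF ∷ ok) ℓs =
      let ts , over , ℓs' , e = unpackFactor F ℓs
          two , types = over-factor F over okF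
          factors , twos , types' , groups , matched , e' = go Fs ok ℓs'
      in ts ∷ factors , two ∷ twos , cong₂ _∷_ types types' , groups , matched
         , λ u v → trans (e u v) (trans (cong (mult _≟_ (factorEdges ts) u v +_) (e' u v))
             (sym (+-assoc (mult _≟_ (factorEdges ts) u v) _ _)))

  lift : ∀ Fs M → All (IsTwoFactor (verticesK n)) Fs → All (λ e → proj₁ e ≢ proj₂ e) M →
    (∀ u v → completeMulti n (κ * m) u v ≡ sum (map (λ F → mult _≟ᶠ_ (factorEdges F) u v) Fs) + mult _≟ᶠ_ M u v) →
    Lift κ (map factorType Fs) M
  lift Fs M ok ne decomp =
    let ℓs , inv = detachAll unsplit (λ x → ≤-reflexive (count-verticesNM x)) (pieces-simple ok ne) (initials (pieces Fs M))
                     (invariant-initials (pieces Fs M) (λ u v → trans (pieces-mult Fs M u v) (sym (decomp u v))))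
    in unpack Fs M ok ℓs (λ u v → trans (inv u v) (amalgam-one u v))

-- Permutations that carry one enumeration to another.

ends : {A : Set} → List (A × A) → List A
ends = concatMap (λ e → proj₁ e ∷ proj₂ e ∷ [])

ends-map : ∀ {A B : Set} (f : A → B) E → ends (map (×-map f f) E) ≡ map f (ends E)
ends-map f [] = refl
ends-map f ((a , b) ∷ E) = cong (λ l → f a ∷ f b ∷ l) (ends-map f E)

-- Lets an equality of flattened vertex lists, which is what `align` provides, be read as an
-- equality of edge lists.
ends-injective : ∀ {A : Set} (E E' : List (A × A)) → ends E ≡ ends E' → E ≡ E'
ends-injective [] [] e = refl
ends-injective ((a , b) ∷ E) ((c , d) ∷ E') e =
  cong₂ _∷_ (cong₂ _,_ (∷-injectiveˡ e) (∷-injectiveˡ (∷-injectiveʳ e))) (ends-injective E E' (∷-injectiveʳ (∷-injectiveʳ e)))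

length-ends : ∀ {A : Set} (E : List (A × A)) → length (ends E) ≡ 2 * length E
length-ends [] = refl
length-ends (e ∷ E) = trans (cong (2 +_) (length-ends E)) (sym (*-suc 2 (length E)))

map≡⇒≡ : ∀ {A B : Set} {f g : A → B} xs → map f xs ≡ map g xs → ∀ {a} → a ∈ xs → f a ≡ g a
map≡⇒≡ (x ∷ xs) e (here refl) = ∷-injectiveˡ e
map≡⇒≡ (x ∷ xs) e (there p) = map≡⇒≡ xs (∷-injectiveʳ e) p

module Matching {A : Set} (_≟_ : DecidableEquality A) where
  open Counting _≟_

  count-ends : ∀ a E → count a (ends E) ≡ count a (map proj₁ E) + count a (map proj₂ E)
  count-ends a [] = refl
  count-ends a ((x , y) ∷ E) rewrite count-ends a E = lemma (δ x a) (δ y a) (count a (map proj₁ E)) (count a (map proj₂ E))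
    where lemma : ∀ p q r s → p + (q + (r + s)) ≡ p + r + (q + s)
          lemma = solve-∀

  Everything : List A → Set
  Everything xs = ∀ a → count a xs ≡ 1

  -- Sends the entry at each position of the first list to the entry at the same position of the
  -- second. The last clause is a default; it is not reached when both lists enumerate all of `A`.
  align : List A → List A → A → A
  align (x ∷ xs) (y ∷ ys) a = if ⌊ x ≟ a ⌋ then y else align xs ys a
  align _ _ a = a

  align-map : ∀ xs ys → length xs ≡ length ys → (∀ a → count a xs ≤ 1) → map (align xs ys) xs ≡ ys
  align-map [] [] e h = refl
  align-map (x ∷ xs) (y ∷ ys) e h = cong₂ _∷_ head (trans (tail xs fresh) (align-map xs ys (suc-injective e) (λ a → ≤-trans (m≤n+m _ _) (h a))))
    where
    head : align (x ∷ xs) (y ∷ ys) x ≡ y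
    head with x ≟ x
    ... | yes _ = refl
    ... | no ne = ⊥-elim (ne refl)
    fresh : count x xs ≡ 0
    fresh = n≤0⇒n≡0 (≤-pred (subst (λ d → d + count x xs ≤ 1) (δ-refl x) (h x)))
    miss : ∀ z → x ≢ z → align (x ∷ xs) (y ∷ ys) z ≡ align xs ys z
    miss z ne with x ≟ z
    ... | yes e = ⊥-elim (ne e)
    ... | no _ = refl
    tail : ∀ zs → count x zs ≡ 0 → map (align (x ∷ xs) (y ∷ ys)) zs ≡ map (align xs ys) zs
    tail [] _ = refl
    tail (z ∷ zs) f = cong₂ _∷_ (miss z (λ { refl → 1+n≢0 (trans (sym (δ-refl x)) (m+n≡0⇒m≡0 (δ x x) f)) })) (tail zs (m+n≡0⇒n≡0 (δ z x) f))

  module _ (xs ys : List A) (exs : Everything xs) (eys : Everything ys) where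

    align-≡ : map (align xs ys) xs ≡ ys
    align-≡ = align-map xs ys (↭-length (count≡⇒↭ xs ys (λ a → trans (exs a) (sym (eys a))))) (λ a → ≤-reflexive (exs a))

  module _ (xs ys : List A) (exs : Everything xs) (eys : Everything ys) where

    align-inverse : ∀ a → align ys xs (align xs ys a) ≡ a
    align-inverse a = map≡⇒≡ xs
      (trans (map-∘ xs) (trans (cong (map (align ys xs)) (align-≡ xs ys exs eys)) (trans (align-≡ ys xs eys exs) (sym (map-id xs)))))
      (1≤count⇒∈ {a} xs (≤-reflexive (sym (exs a))))

    align-injective : ∀ {a b} → align xs ys a ≡ align xs ys b → a ≡ b
    align-injective e = trans (sym (align-inverse _)) (trans (cong (align ys xs) e) (align-inverse _))

-- Pairing two 1-factors into a 2-factor of prescribed type.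

module Gluing (n m : ℕ) where
  open Blowup n m
  open Matching _≟_
  module BaseM = Matching (_≟ᶠ_ {n})

  base : Vertex × Vertex → Fin n × Fin n
  base = ×-map proj₁ proj₁

  matched-base : ∀ {e es} → Matched e es → map base es ≡ replicate m e
  matched-base {u , v} {es} (c₁ , c₂) = trans (constant es (λ p → part (map proj₁ es) c₁ (∈-map⁺ proj₁ p)) (λ p → part (map proj₂ es) c₂ (∈-map⁺ proj₂ p)))
    (cong (λ k → replicate k (u , v)) length≡m)
    where
    part : ∀ {x} xs → (∀ a → count a xs ≡ Base.δ x (proj₁ a)) → ∀ {a} → a ∈ xs → proj₁ a ≡ x
    part {x} xs c {a} a∈ with x ≟ᶠ proj₁ a | c a
    ... | yes e | _ = sym e
    ... | no _ | e = ⊥-elim (count≡0⇒∉ e a∈)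
    constant : ∀ es → (∀ {e} → e ∈ es → proj₁ (proj₁ e) ≡ u) → (∀ {e} → e ∈ es → proj₁ (proj₂ e) ≡ v) →
      map base es ≡ replicate (length es) (u , v)
    constant [] h₁ h₂ = refl
    constant (e ∷ es) h₁ h₂ = cong₂ _∷_ (cong₂ _,_ (h₁ (here refl)) (h₂ (here refl))) (constant es (h₁ ∘ there) (h₂ ∘ there))
    fibre : List Vertex
    fibre = map (u ,_) (allFin m)
    length≡m : length es ≡ m
    length≡m = trans (sym (length-map proj₁ es)) (trans
      (↭-length (count≡⇒↭ (map proj₁ es) (cartesianProduct (u ∷ []) (allFin m))
        (λ a → trans (c₁ a) (sym (trans (count-product (proj₁ a) (proj₂ a) (u ∷ []) (allFin m))
          (trans (cong₂ _*_ (+-identityʳ (Base.δ u (proj₁ a))) (count-allFin m (proj₂ a))) (*-identityʳ _)))))))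
      (trans (cong length (++-identityʳ fibre)) (trans (length-map (u ,_) (allFin m)) (length-tabulate {n = m} (λ i → i)))))

  matched-length : ∀ {e es} → Matched e es → length es ≡ m
  matched-length {e} {es} mt = trans (sym (length-map base es)) (trans (cong length (matched-base {e} {es} mt)) (length-replicate m))

  matched-bases : ∀ {M groups} → Pointwise Matched M groups → map base (concat groups) ≡ concatMap (replicate m) M
  matched-bases [] = refl
  matched-bases (_∷_ {y = es} mt mts) = trans (map-++ base es _) (cong₂ _++_ (matched-base mt) (matched-bases mts))

  count-matched : ∀ {M groups} → Pointwise Matched M groups → ∀ a → count a (ends (concat groups)) ≡ Base.count (proj₁ a) (ends M)
  count-matched [] a = refl
  count-matched (_∷_ {x = u , v} {y = es} (c₁ , c₂) mts) a =
    trans (cong (count a) (concatMap-++ _ es _)) (trans (count-++ a (ends es) _)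
      (trans (cong₂ _+_ (trans (count-ends a es) (cong₂ _+_ (c₁ a) (c₂ a))) (count-matched mts a)) (+-assoc (Base.δ u (proj₁ a)) _ _)))

  OneFactor : List (Fin n × Fin n) → Set
  OneFactor M = IsOneFactor (verticesK n) M

  oneFactor-everything : ∀ {M} → OneFactor M → BaseM.Everything (ends M)
  oneFactor-everything p a = trans (Base.count-↭ a p) (count-allFin n a)

  matched-everything : ∀ {M groups} → OneFactor M → Pointwise Matched M groups → Everything (ends (concat groups))
  matched-everything {M} p mts a = trans (count-matched mts a) (oneFactor-everything {M} p (proj₁ a))

  -- Matching positions in the two vertex lists defines `π`, which carries the first 1-factor edge
  -- by edge to the second, and likewise `ρ` on the base graph. Since `π` lies over `ρ`, it is an
  -- automorphism of the multipartite graph.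
  module Relabel {M₁ M₂ groups₁ groups₂} (one₁ : OneFactor M₁) (one₂ : OneFactor M₂)
    (matched₁ : Pointwise Matched M₁ groups₁) (matched₂ : Pointwise Matched M₂ groups₂) where

    private
      E₁ = concat groups₁
      E₂ = concat groups₂
      all₁ = matched-everything {M₁} one₁ matched₁
      all₂ = matched-everything {M₂} one₂ matched₂
      base₁ = oneFactor-everything {M₁} one₁
      base₂ = oneFactor-everything {M₂} one₂

    π π⁻¹ : Vertex → Vertex
    π = align (ends E₁) (ends E₂)
    π⁻¹ = align (ends E₂) (ends E₁)

    ρ : Fin n → Fin n
    ρ = BaseM.align (ends M₁) (ends M₂)

    ππ⁻¹ : ∀ a → π (π⁻¹ a) ≡ a
    ππ⁻¹ = align-inverse (ends E₂) (ends E₁) all₂ all₁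

    π-injective : ∀ {a b} → π a ≡ π b → a ≡ b
    π-injective = align-injective (ends E₁) (ends E₂) all₁ all₂

    ρ-injective : ∀ {a b} → ρ a ≡ ρ b → a ≡ b
    ρ-injective = BaseM.align-injective (ends M₁) (ends M₂) base₁ base₂

    π-edges : map (×-map π π) E₁ ≡ E₂
    π-edges = ends-injective _ E₂ (trans (ends-map π E₁) (align-≡ (ends E₁) (ends E₂) all₁ all₂))

    ρ-edges : map (×-map ρ ρ) M₁ ≡ M₂
    ρ-edges = ends-injective _ M₂ (trans (ends-map ρ M₁) (BaseM.align-≡ (ends M₁) (ends M₂) base₁ base₂))

    -- Each base edge is represented by exactly `m` consecutive edges in both lists, so equal
    -- positions in the 1-factors lie over equal positions in `M₁` and `M₂`.
    π-part : ∀ a → proj₁ (π a) ≡ ρ (proj₁ a)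
    π-part a = map≡⇒≡ (ends E₁) (begin
      map (proj₁ ∘ π) (ends E₁) ≡⟨ map-∘ (ends E₁) ⟩
      map proj₁ (map π (ends E₁)) ≡⟨ cong (map proj₁) (align-≡ (ends E₁) (ends E₂) all₁ all₂) ⟩
      map proj₁ (ends E₂) ≡⟨ ends-map proj₁ E₂ ⟨
      ends (map base E₂) ≡⟨ cong ends (matched-bases matched₂) ⟩
      ends (concatMap (replicate m) M₂) ≡⟨ cong (λ M → ends (concatMap (replicate m) M)) ρ-edges ⟨
      ends (concatMap (replicate m) (map (×-map ρ ρ) M₁)) ≡⟨ cong ends (copies M₁) ⟩
      ends (map (×-map ρ ρ) (concatMap (replicate m) M₁)) ≡⟨ ends-map ρ (concatMap (replicate m) M₁) ⟩
      map ρ (ends (concatMap (replicate m) M₁)) ≡⟨ cong (map ρ ∘ ends) (matched-bases matched₁) ⟨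
      map ρ (ends (map base E₁)) ≡⟨ cong (map ρ) (ends-map proj₁ E₁) ⟩
      map ρ (map proj₁ (ends E₁)) ≡⟨ map-∘ (ends E₁) ⟨
      map (ρ ∘ proj₁) (ends E₁) ∎)
      (1≤count⇒∈ (ends E₁) (≤-reflexive (sym (all₁ a))))
      where
      open ≡-Reasoning
      copies : ∀ M → concatMap (replicate m) (map (×-map ρ ρ) M) ≡ map (×-map ρ ρ) (concatMap (replicate m) M)
      copies [] = refl
      copies (e ∷ M) = trans (cong₂ _++_ (sym (map-replicate (×-map ρ ρ) m e)) (copies M))
        (sym (map-++ (×-map ρ ρ) (replicate m e) _))

    π-graph : ∀ κ a b → completeMultipartite n m κ (π a) (π b) ≡ completeMultipartite n m κ a b
    π-graph κ a b = cong (λ t → if t then 0 else κ)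
      (trans (cong₂ (λ x y → ⌊ x ≟ᶠ y ⌋) (π-part a) (π-part b)) (⌊⌋-inj _≟ᶠ_ _≟ᶠ_ ρ ρ-injective (proj₁ a) (proj₁ b)))

    relabel : TwoFactorData Vertex → TwoFactorData Vertex
    relabel = map (map π)

    relabel-type : ∀ F → factorType (relabel F) ≡ factorType F
    relabel-type F = trans (sym (map-∘ F)) (map-cong (length-map π) F)

    count-π : ∀ xs a → count a (map π xs) ≡ count (π⁻¹ a) xs
    count-π xs a = trans (cong (λ x → count x (map π xs)) (sym (ππ⁻¹ a))) (count-map _≟_ _≟_ π π-injective (π⁻¹ a) xs)

    relabel-twoFactor : ∀ {F} → IsTwoFactor (verticesNM n m) F → IsTwoFactor (verticesNM n m) (relabel F)
    relabel-twoFactor {F} (long , perm) =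
      All.map⁺ (All.map (λ {c} l → ≤-trans l (≤-reflexive (sym (length-map π c)))) long)
      , count≡⇒↭ _ _ (λ a → trans (cong (count a) (concat-map F)) (trans (count-π (concat F) a)
          (trans (count-↭ (π⁻¹ a) perm) (trans (count-verticesNM (π⁻¹ a)) (sym (count-verticesNM a))))))

    factorEdges-relabel : ∀ F → factorEdges (relabel F) ≡ map (×-map π π) (factorEdges F)
    factorEdges-relabel [] = refl
    factorEdges-relabel (c ∷ F) = trans (cong₂ _++_ (cycleEdges-map π c) (factorEdges-relabel F)) (sym (map-++ (×-map π π) (cycleEdges c) _))

    mult-π : ∀ es a b → mult _≟_ (map (×-map π π) es) a b ≡ mult _≟_ es (π⁻¹ a) (π⁻¹ b)
    mult-π es a b = trans (cong₂ (mult _≟_ (map (×-map π π) es)) (sym (ππ⁻¹ a)) (sym (ππ⁻¹ b)))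
      (mult-map _≟_ _≟_ π π-injective es (π⁻¹ a) (π⁻¹ b))

    -- The decomposition is read at `π⁻¹ u` and `π⁻¹ v`; the graph does not notice, and the
    -- left-over 1-factor becomes the prescribed one.
    relabel-decomposes : ∀ κ Fs →
      (∀ u v → completeMultipartite n m κ u v ≡ factorsMult Fs u v + mult _≟_ E₁ u v) →
      ∀ u v → completeMultipartite n m κ u v ≡ factorsMult (map relabel Fs) u v + mult _≟_ E₂ u v
    relabel-decomposes κ Fs decomp u v = begin
      completeMultipartite n m κ u v ≡⟨ cong₂ (completeMultipartite n m κ) (ππ⁻¹ u) (ππ⁻¹ v) ⟨
      completeMultipartite n m κ (π (π⁻¹ u)) (π (π⁻¹ v)) ≡⟨ π-graph κ (π⁻¹ u) (π⁻¹ v) ⟩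
      completeMultipartite n m κ (π⁻¹ u) (π⁻¹ v) ≡⟨ decomp (π⁻¹ u) (π⁻¹ v) ⟩
      factorsMult Fs (π⁻¹ u) (π⁻¹ v) + mult _≟_ E₁ (π⁻¹ u) (π⁻¹ v)
        ≡⟨ cong₂ _+_ (cong sum (trans (map-cong (λ F → trans (sym (mult-π (factorEdges F) u v))
             (cong (λ l → mult _≟_ l u v) (sym (factorEdges-relabel F)))) Fs) (map-∘ Fs)))
             (trans (sym (mult-π E₁ u v)) (cong (λ l → mult _≟_ l u v) π-edges)) ⟩
      factorsMult (map relabel Fs) u v + mult _≟_ E₂ u v ∎
      where open ≡-Reasoning

  -- Walking a₁ b₁ a₂ b₂ … a_h b_h uses the edges a_k b_k and closes up with the edges a_{k+1} b_k.
  weave : Vertex → Vertex → Edges → Edges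
  weave f b [] = (f , b) ∷ []
  weave f b ((a' , b') ∷ es) = (a' , b) ∷ weave f b' es

  weave-edges : ∀ f b es u v → mult _≟_ (closeUp f b (ends es)) u v ≡ mult _≟_ es u v + mult _≟_ (weave f b es) u v
  weave-edges f b [] u v = cong (_+ 0) (ε-swap b f u v)
  weave-edges f b ((a' , b') ∷ es) u v = trans
    (cong₂ (λ x y → x + (ε a' b' u v + y)) (ε-swap b a' u v) (weave-edges f b' es u v))
    (lemma (ε a' b u v) (ε a' b' u v) (mult _≟_ es u v) (mult _≟_ (weave f b' es) u v))
    where lemma : ∀ p q r s → p + (q + (r + s)) ≡ q + r + (p + s)
          lemma = solve-∀

  weave-firsts : ∀ f b es a → count a (map proj₁ (weave f b es)) ≡ δ f a + count a (map proj₁ es)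
  weave-firsts f b [] a = refl
  weave-firsts f b ((a' , b') ∷ es) a = trans (cong (δ a' a +_) (weave-firsts f b' es a)) (lemma (δ a' a) (δ f a) _)
    where lemma : ∀ p q r → p + (q + r) ≡ q + (p + r)
          lemma = solve-∀

  weave-seconds : ∀ f b es → map proj₂ (weave f b es) ≡ b ∷ map proj₂ es
  weave-seconds f b [] = refl
  weave-seconds f b ((a' , b') ∷ es) = cong (b ∷_) (weave-seconds f b' es)

  -- Even and positive: a cycle of this length uses one edge of the matching to open and `h` further
  -- ones.
  data EvenEntry : ℕ → Set where
    even : ∀ h → EvenEntry (2 * suc h)

  -- The equations for first and second ends make `partner` a perfect matching between the same two
  -- parts whenever `es` is one.
  record Weaving (block : List ℕ) (es : Edges) : Set where
    field
      cycles  : List (List Vertex)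
      partner : Edges
      lengths : map length cycles ≡ block
      verts   : concat cycles ≡ ends es
      firsts  : ∀ a → count a (map proj₁ partner) ≡ count a (map proj₁ es)
      seconds : ∀ a → count a (map proj₂ partner) ≡ count a (map proj₂ es)
      edges≡  : ∀ u v → mult _≟_ (factorEdges cycles) u v ≡ mult _≟_ es u v + mult _≟_ partner u v

  -- The matching is cut into consecutive stretches, one for each entry, with half as many edges as
  -- the entry says; the sum condition makes the stretches exhaust it.
  weaveBlock : ∀ block es → All EvenEntry block → sum block ≡ 2 * length es → Weaving block es
  weaveBlock [] [] [] s = record
    { cycles = [] ; partner = [] ; lengths = refl ; verts = refl
    ; firsts = λ a → refl ; seconds = λ a → refl ; edges≡ = λ u v → refl }
  weaveBlock [] (_ ∷ _) [] ()
  weaveBlock (_ ∷ block) [] (even h ∷ evens) ()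
  -- For `h` equal to zero the partner repeats the edge `(x , y)` and the cycle is a 2-cycle.
  weaveBlock (_ ∷ block) ((x , y) ∷ es) (even h ∷ evens) s = record
    { cycles = (x ∷ y ∷ ends es₁) ∷ W.cycles
    ; partner = weave x y es₁ ++ W.partner
    ; lengths = cong₂ _∷_ (trans (cong (2 +_) (trans (length-ends es₁) (cong (2 *_) length-es₁))) (sym (*-suc 2 h))) W.lengths
    ; verts = cong (λ l → x ∷ y ∷ l) (trans (cong (ends es₁ ++_) W.verts) (trans (sym (concatMap-++ _ es₁ es₂)) (cong ends split)))
    ; firsts = λ a → trans (cong (count a) (map-++ proj₁ (weave x y es₁) _)) (trans (count-++ a (map proj₁ (weave x y es₁)) _)
        (trans (cong₂ _+_ (weave-firsts x y es₁ a) (W.firsts a)) (trans (+-assoc (δ x a) _ _) (cong (δ x a +_) (glue proj₁ a)))))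
    ; seconds = λ a → trans (cong (count a) (map-++ proj₂ (weave x y es₁) _)) (trans (count-++ a (map proj₂ (weave x y es₁)) _)
        (trans (cong₂ _+_ (cong (count a) (weave-seconds x y es₁)) (W.seconds a)) (trans (+-assoc (δ y a) _ _) (cong (δ y a +_) (glue proj₂ a)))))
    ; edges≡ = λ u v → trans (mult-++ (cycleEdges (x ∷ y ∷ ends es₁)) _ u v)
        (trans (cong₂ _+_ (cong (ε x y u v +_) (weave-edges x y es₁ u v)) (W.edges≡ u v))
          (trans (lemma (ε x y u v) (mult _≟_ es₁ u v) (mult _≟_ (weave x y es₁) u v) (mult _≟_ es₂ u v) (mult _≟_ W.partner u v))
            (cong₂ _+_ (cong (ε x y u v +_) (trans (sym (mult-++ es₁ es₂ u v)) (cong (λ l → mult _≟_ l u v) split)))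
              (sym (mult-++ (weave x y es₁) W.partner u v)))))
    }
    where
    es₁ es₂ : Edges
    es₁ = take h es
    es₂ = drop h es
    split : es₁ ++ es₂ ≡ es
    split = take++drop≡id h es
    h≤ : h ≤ length es
    h≤ = ≤-pred (*-cancelˡ-≤ 2 (≤-trans (m≤m+n _ _) (≤-reflexive s)))
    length-es₁ : length es₁ ≡ h
    length-es₁ = trans (length-take h es) (m≤n⇒m⊓n≡m h≤)
    sum-block : sum block ≡ 2 * length es₂
    sum-block = +-cancelˡ-≡ (2 * suc h) _ _ (trans s (trans
      (cong (λ k → 2 * suc k) (trans (cong length (sym split)) (trans (length-++ es₁) (cong (_+ length es₂) length-es₁))))
      (*-distribˡ-+ 2 (suc h) (length es₂))))
    glue : ∀ (f : Vertex × Vertex → Vertex) a → count a (map f es₁) + count a (map f es₂) ≡ count a (map f es)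
    glue f a = trans (sym (count-++ a (map f es₁) _)) (trans (cong (count a) (sym (map-++ f es₁ es₂))) (cong (count a ∘ map f) split))
    lemma : ∀ p a b c d → p + (a + b) + (c + d) ≡ p + (a + c) + (b + d)
    lemma = solve-∀
    module W = Weaving (weaveBlock block es₂ evens sum-block)

  record Woven (M : List (Fin n × Fin n)) (groups : List Edges) (type : List ℕ) : Set where
    field
      factor   : TwoFactorData Vertex
      partners : List Edges
      type≡    : factorType factor ≡ type
      verts    : concat factor ≡ ends (concat groups)
      matched  : Pointwise Matched M partners
      edges≡   : ∀ u v → mult _≟_ (factorEdges factor) u v ≡ mult _≟_ (concat groups) u v + mult _≟_ (concat partners) u v

  -- A group has `m` edges and hence `2 * m` ends, exactly the sum prescribed for its block, so each
  -- pair of matched parts is woven separately.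
  weaveAll : ∀ {M groups} → Pointwise Matched M groups → ∀ blocks → All (All EvenEntry) blocks →
    map sum blocks ≡ replicate (length M) (2 * m) → Woven M groups (concat blocks)
  weaveAll [] [] [] e = record
    { factor = [] ; partners = [] ; type≡ = refl ; verts = refl ; matched = [] ; edges≡ = λ u v → refl }
  weaveAll (_∷_ {y = es} mt@(c₁ , c₂) mts) (block ∷ blocks) (ev ∷ evs) e = record
    { factor = W.cycles ++ R.factor
    ; partners = W.partner ∷ R.partners
    ; type≡ = trans (map-++ length W.cycles _) (cong₂ _++_ W.lengths R.type≡)
    ; verts = trans (sym (concat-++ W.cycles R.factor)) (trans (cong₂ _++_ W.verts R.verts) (sym (concatMap-++ _ es _)))
    ; matched = ((λ a → trans (W.firsts a) (c₁ a)) , λ a → trans (W.seconds a) (c₂ a)) ∷ R.matched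
    ; edges≡ = λ u v → trans (cong (λ l → mult _≟_ l u v) (concatMap-++ cycleEdges W.cycles R.factor))
        (trans (mult-++ (factorEdges W.cycles) _ u v) (trans (cong₂ _+_ (W.edges≡ u v) (R.edges≡ u v))
          (trans (lemma (mult _≟_ es u v) (mult _≟_ W.partner u v) _ _)
            (sym (cong₂ _+_ (mult-++ es _ u v) (mult-++ W.partner _ u v))))))
    }
    where
    lemma : ∀ a b c d → a + b + (c + d) ≡ a + c + (b + d)
    lemma = solve-∀
    module W = Weaving (weaveBlock block es ev (trans (∷-injectiveˡ e) (cong (2 *_) (sym (matched-length {es = es} mt)))))
    module R = Woven (weaveAll mts blocks evs (∷-injectiveʳ e))

-- Assembling the copies and pairing their 1-factors.

module Assembling (n m : ℕ) where
  open Blowup n m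
  open Gluing n m

  -- One block of cycle lengths for each of the `n / 2` edges of a base 1-factor, in the form
  -- consumed by `weaveAll`.
  Good : List ℕ → Set
  Good T = ∃ λ blocks → concat blocks ↭ T × All (All EvenEntry) blocks × map sum blocks ≡ replicate (n / 2) (2 * m)

  Parity : ℕ → List (Fin n × Fin n) → Set
  Parity ε M = (ε ≡ 0 × M ≡ []) ⊎ (ε ≡ 1 × OneFactor M)

  -- A decomposition of the `κ`-fold graph with at most one 1-factor pending, still in groups so
  -- that it can be paired later. The field `degree` records the vertex degree additively and
  -- postpones all divisions. Types of `extra` are known only up to order, since weaving lists the
  -- cycles block by block.
  record Assembly (κ ε : ℕ) (types Ts : List (List ℕ)) : Set where
    field
      lifted extra : List (TwoFactorData Vertex)
      types≡     : map factorType lifted ≡ types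
      extra↭     : Pointwise _↭_ (map factorType extra) Ts
      two-lifted : All (IsTwoFactor (verticesNM n m)) lifted
      two-extra  : All (IsTwoFactor (verticesNM n m)) extra
      {M}        : List (Fin n × Fin n)
      groups     : List Edges
      matched    : Pointwise Matched M groups
      parity     : Parity ε M
      degree     : 2 * (length lifted + length extra) + ε ≡ κ * (m * (n ∸ 1))
      decomposes : ∀ u v → completeMultipartite n m κ u v
                 ≡ factorsMult lifted u v + factorsMult extra u v + mult _≟_ (concat groups) u v

  record Copy (κ ε : ℕ) (types : List (List ℕ)) : Set where
    field
      {M}     : List (Fin n × Fin n)
      theLift : Lift κ types M
      parity  : Parity ε M
      degree  : 2 * length types + ε ≡ κ * (m * (n ∸ 1))
    open Lift theLift public

    length-factors : length factors ≡ length types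
    length-factors = trans (sym (length-map factorType factors)) (trans (cong length types≡) (length-map _ types))

  factorsMult-++ : ∀ Fs Gs u v → factorsMult (Fs ++ Gs) u v ≡ factorsMult Fs u v + factorsMult Gs u v
  factorsMult-++ Fs Gs u v = trans (cong sum (map-++ (λ F → mult _≟_ (factorEdges F) u v) Fs Gs)) (sum-++ (map _ Fs) _)

  multipartite-+ : ∀ κ κ' u v → completeMultipartite n m (κ + κ') u v
    ≡ completeMultipartite n m κ u v + completeMultipartite n m κ' u v
  multipartite-+ κ κ' u v with ⌊ proj₁ u ≟ᶠ proj₁ v ⌋
  ... | true = refl
  ... | false = refl

  scaled : List (List ℕ) → List (List ℕ)
  scaled = map (map (m *_))

  -- The union without pairing: `groups` is the 1-factor of whichever summand has one.
  addFactors : ∀ {κ κ' ε ε' e types types' Ts} (C : Copy κ ε types) (A : Assembly κ' ε' types' Ts) → ε + ε' ≡ e →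
    ∀ {M groups} → Pointwise Matched M groups → Parity e M →
    (∀ u v → mult _≟_ (concat groups) u v ≡ mult _≟_ (concat (Copy.groups C)) u v + mult _≟_ (concat (Assembly.groups A)) u v) →
    Assembly (κ + κ') e (scaled types ++ types') Ts
  addFactors {κ} {κ'} {ε} {ε'} C A refl {M} {groups} matched parity split = record
    { lifted = C.factors ++ A.lifted ; extra = A.extra
    ; types≡ = trans (map-++ factorType C.factors _) (cong₂ _++_ C.types≡ A.types≡)
    ; extra↭ = A.extra↭
    ; two-lifted = All.++⁺ C.twoFactors A.two-lifted ; two-extra = A.two-extra
    ; groups = groups ; matched = matched ; parity = parity
    ; degree = trans (cong (λ k → 2 * (k + length A.extra) + (ε + ε')) (length-++ C.factors))
        (trans (degrees (length C.factors) (length A.lifted) (length A.extra) ε ε')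
          (trans (cong₂ _+_ (trans (cong (λ k → 2 * k + ε) C.length-factors) C.degree) A.degree)
            (sym (*-distribʳ-+ (m * (n ∸ 1)) κ κ'))))
    ; decomposes = λ u v → trans (multipartite-+ κ κ' u v) (trans (cong₂ _+_ (C.decomposes u v) (A.decomposes u v))
        (trans (sums (factorsMult C.factors u v) _ (factorsMult A.lifted u v) (factorsMult A.extra u v) _)
          (sym (cong₂ (λ x y → x + factorsMult A.extra u v + y) (factorsMult-++ C.factors A.lifted u v) (split u v)))))
    }
    where
    module C = Copy C
    module A = Assembly A
    degrees : ∀ a b c p q → 2 * (a + b + c) + (p + q) ≡ 2 * a + p + (2 * (b + c) + q)
    degrees = solve-∀
    sums : ∀ a p b c q → a + p + (b + c + q) ≡ (a + b) + c + (p + q)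
    sums = solve-∀

  unmatched : ∀ {groups} → Pointwise Matched [] groups → groups ≡ []
  unmatched [] = refl

  oneFactor-length : ∀ {M} → OneFactor M → length M ≡ n / 2
  oneFactor-length {M} p = trans (sym (m*n/n≡m (length M) 2))
    (cong (_/ 2) (trans (*-comm (length M) 2) (trans (sym (length-ends M)) (trans (↭-length p) (length-tabulate {n = n} (λ i → i))))))

  -- The pending 1-factor of the assembly is woven into `T` first, which dictates the partner
  -- matching. The new copy is then relabelled so that its own 1-factor becomes this partner.
  -- Nothing already assembled is disturbed.
  addPair : ∀ {κ κ' types types' T Ts} → Copy κ 1 types → Assembly κ' 1 types' Ts → Good T →
    Assembly (κ + κ') 0 (scaled types ++ types') (T ∷ Ts)
  addPair {κ} {κ'} {types} {types'} {T} {Ts} C A (blocks , blocks↭T , evens , sums≡) = go (Copy.parity C) (Assembly.parity A)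
    where
    module C = Copy C
    module A = Assembly A
    go : Parity 1 C.M → Parity 1 A.M → Assembly (κ + κ') 0 (scaled types ++ types') (T ∷ Ts)
    go (inj₁ (() , _)) _
    go (inj₂ _) (inj₁ (() , _))
    go (inj₂ (_ , oneC)) (inj₂ (_ , oneA)) = record
      { lifted = map R.relabel C.factors ++ A.lifted ; extra = W.factor ∷ A.extra
      ; types≡ = trans (map-++ factorType (map R.relabel C.factors) _) (cong₂ _++_
          (trans (sym (map-∘ C.factors)) (trans (map-cong R.relabel-type C.factors) C.types≡)) A.types≡)
      ; extra↭ = ↭-trans (↭-reflexive W.type≡) blocks↭T ∷ A.extra↭
      ; two-lifted = All.++⁺ (All.map⁺ (All.map R.relabel-twoFactor C.twoFactors)) A.two-lifted
      ; two-extra = woven-twoFactor ∷ A.two-extra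
      ; groups = [] ; matched = [] ; parity = inj₁ (refl , refl)
      ; degree = trans (cong (λ k → 2 * (k + suc (length A.extra)) + 0)
            (trans (length-++ (map R.relabel C.factors)) (cong (_+ length A.lifted) (trans (length-map R.relabel C.factors) C.length-factors))))
          (trans (degrees (length types) (length A.lifted) (length A.extra))
            (trans (cong₂ _+_ C.degree A.degree) (sym (*-distribʳ-+ (m * (n ∸ 1)) κ κ'))))
      ; decomposes = λ u v → trans (multipartite-+ κ κ' u v)
          (trans (cong₂ _+_ (R.relabel-decomposes κ C.factors C.decomposes u v) (A.decomposes u v))
            (trans (sums (factorsMult (map R.relabel C.factors) u v) (mult _≟_ (concat W.partners) u v) (factorsMult A.lifted u v) (factorsMult A.extra u v) (mult _≟_ (concat A.groups) u v))
              (sym (cong₂ (λ x y → x + (y + factorsMult A.extra u v) + 0) (factorsMult-++ (map R.relabel C.factors) A.lifted u v) (W.edges≡ u v)))))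
      }
      where
      module W = Woven (weaveAll A.matched blocks evens (trans sums≡ (cong (λ k → replicate k (2 * m)) (sym (oneFactor-length {A.M} oneA)))))
      -- The target is `W.partners`, not the pending 1-factor itself; both lie over the same base
      -- 1-factor.
      module R = Relabel {C.M} {A.M} oneC oneA C.matched W.matched
      degrees : ∀ a b c → 2 * (a + b + suc c) + 0 ≡ 2 * a + 1 + (2 * (b + c) + 1)
      degrees = solve-∀
      sums : ∀ a p b c q → a + p + (b + c + q) ≡ (a + b) + ((q + p) + c) + 0
      sums = solve-∀
      woven-twoFactor : IsTwoFactor (verticesNM n m) W.factor
      woven-twoFactor = long W.type≡ evens
        , count≡⇒↭ _ _ (λ a → trans (cong (count a) W.verts) (trans (matched-everything {A.M} oneA A.matched a) (sym (count-verticesNM a))))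
        where
        long-all : ∀ {F : TwoFactorData Vertex} {T} → factorType F ≡ T → All EvenEntry T → All (λ c → 2 ≤ length c) F
        long-all {[]} e ev = []
        long-all {c ∷ F} refl (ev ∷ evs) = two≤ ev ∷ long-all refl evs
          where
          two≤ : ∀ {k} → EvenEntry k → 2 ≤ k
          two≤ (even h) = *-monoʳ-≤ 2 (s≤s z≤n)
        long : ∀ {F : TwoFactorData Vertex} {blocks} → factorType F ≡ concat blocks → All (All EvenEntry) blocks → All (λ c → 2 ≤ length c) F
        long e evs = long-all e (All.concat⁺ evs)

  addCopy : ∀ {κ κ' ε ε' types types' Ts} (C : Copy κ ε types) (A : Assembly κ' ε' types' Ts) → ε + ε' ≤ 1 →
    Assembly (κ + κ') (ε + ε') (scaled types ++ types') Ts
  addCopy {ε = ε} {ε'} C A small with Copy.parity C in eC | Assembly.parity A in eA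
  ... | inj₁ (refl , refl) | p = addFactors C A refl (Assembly.matched A) p
        (λ u v → cong (λ g → mult _≟_ (concat g) u v + mult _≟_ (concat (Assembly.groups A)) u v) (sym (unmatched (Copy.matched C))))
  ... | inj₂ (refl , one) | inj₁ (refl , none) = addFactors C A refl (Copy.matched C) (inj₂ (refl , one))
        (λ u v → trans (sym (+-identityʳ _)) (cong (λ g → mult _≟_ (concat (Copy.groups C)) u v + mult _≟_ (concat g) u v)
          (sym (unmatched (subst (λ M → Pointwise Matched M (Assembly.groups A)) none (Assembly.matched A))))))
  ... | inj₂ (refl , _) | inj₂ (refl , _) = ⊥-elim (1+n≰n small)

  empty : Assembly 0 0 [] []
  empty = record
    { lifted = [] ; extra = [] ; types≡ = refl ; extra↭ = [] ; two-lifted = [] ; two-extra = []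
    ; groups = [] ; matched = [] ; parity = inj₁ (refl , refl) ; degree = refl
    ; decomposes = λ u v → zeroes ⌊ proj₁ u ≟ᶠ proj₁ v ⌋ }
    where
    zeroes : ∀ b → (if b then 0 else 0) ≡ 0
    zeroes true = refl
    zeroes false = refl

  module _ {J : Set} (κ ε : J → ℕ) (types : J → List (List ℕ)) (copy : ∀ j → Copy (κ j) (ε j) (types j)) where

    -- The number of odd copies is `2 * length Ts + e`, where `e` tells whether a 1-factor is left.
    -- An even copy changes nothing. An odd one leaves its 1-factor pending if `e` is 1; otherwise
    -- it is paired with the one pending from the remaining copies, at the cost of one prescribed
    -- type.
    assemble : ∀ js Ts e → e ≤ 1 → 2 * length Ts + e ≡ sum (map ε js) → All Good Ts →
      Assembly (sum (map κ js)) e (concatMap (scaled ∘ types) js) Ts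
    assemble [] [] e small refl [] = empty
    assemble (j ∷ js) Ts e small total good = go (ε j) refl e Ts small total good
      where
      bit : ε j ≤ 1
      bit with Copy.parity (copy j)
      ... | inj₁ (e , _) = ≤-trans (≤-reflexive e) z≤n
      ... | inj₂ (e , _) = ≤-reflexive e
      goal : ℕ → List (List ℕ) → Set
      goal e Ts = Assembly (κ j + sum (map κ js)) e (scaled (types j) ++ concatMap (scaled ∘ types) js) Ts
      go : ∀ d → ε j ≡ d → ∀ e Ts → e ≤ 1 → 2 * length Ts + e ≡ ε j + sum (map ε js) → All Good Ts → goal e Ts
      go zero d e Ts small total good = subst (λ k → goal k Ts) (cong (_+ e) d)
        (addCopy (copy j) (assemble js Ts e small (trans total (cong (_+ sum (map ε js)) d)) good)
          (≤-trans (≤-reflexive (cong (_+ e) d)) small))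
      go (suc zero) d (suc zero) Ts small total good = subst (λ k → goal k Ts) (cong (_+ 0) d)
        (addCopy (copy j) (assemble js Ts 0 z≤n (suc-injective (trans (sym (+-suc _ 0)) (trans total (cong (_+ sum (map ε js)) d)))) good)
          (≤-reflexive (cong (_+ 0) d)))
      go (suc zero) d (suc (suc _)) Ts (s≤s ()) total good
      -- With no type left and nothing pending the number of odd copies would be zero, but this copy
      -- is odd.
      go (suc zero) d zero [] small total good = ⊥-elim (1+n≢0 (trans (cong (_+ sum (map ε js)) (sym d)) (sym total)))
      go (suc zero) d zero (T ∷ Ts) small total (g ∷ good) =
        addPair (subst (λ k → Copy (κ j) k (types j)) d (copy j))
          (assemble js Ts 1 ≤-refl (suc-injective (trans (lemma (length Ts)) (trans total (cong (_+ sum (map ε js)) d)))) good) g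
        where lemma : ∀ k → suc (2 * k + 1) ≡ 2 * suc k + 0
              lemma = solve-∀
      go (suc (suc _)) d e Ts small total good = ⊥-elim (1+n≰n (≤-trans (s≤s (s≤s z≤n)) (≤-trans (≤-reflexive (sym d)) bit)))

-- Types as multisets, and parity arithmetic.

typeEq-++ : ∀ {xs ys xs' ys'} → TypeMultisetEq xs ys → TypeMultisetEq xs' ys' → TypeMultisetEq (xs ++ xs') (ys ++ ys')
typeEq-++ (zs , p , q) (zs' , p' , q') = zs ++ zs' , Pointwise.++⁺ p p' , ++⁺ q q'

typeEq-↭ : ∀ {xs ys zs} → TypeMultisetEq xs ys → ys ↭ zs → TypeMultisetEq xs zs
typeEq-↭ (ws , p , q) r = ws , p , ↭-trans q r

typeEq-scale : ∀ m {xs ys} → TypeMultisetEq xs ys → TypeMultisetEq (map (map (m *_)) xs) (map (map (m *_)) ys)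
typeEq-scale m (zs , p , q) = map (map (m *_)) zs , Pointwise.map⁺ _ _ (Pointwise.map (map⁺ (m *_)) p) , map⁺ (map (m *_)) q

module _ {A B : Set} (f : A → B) where

  -- The construction lists types copy by copy, the theorem repeats each type in place; as multisets
  -- these agree.
  repeat-↭ : ∀ k xs → concat (replicate k (map f xs)) ↭ concatMap (λ y → replicate k (f y)) xs
  repeat-↭ zero [] = ↭-refl
  repeat-↭ zero (x ∷ xs) = repeat-↭ zero xs
  repeat-↭ (suc k) xs = ↭-trans (++⁺ˡ (map f xs) (repeat-↭ k xs)) (spread xs)
    where
    spread : ∀ xs → map f xs ++ concatMap (λ y → replicate k (f y)) xs ↭ concatMap (λ y → replicate (suc k) (f y)) xs
    spread [] = ↭-refl
    spread (x ∷ xs) = prep (f x) (↭-trans (shifts (map f xs) (replicate k (f x))) (++⁺ˡ (replicate k (f x)) (spread xs)))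

copies : {J : Set} → (J → ℕ) → List J → List J
copies x = concatMap (λ i → replicate (x i) i)

sum-copies : ∀ {J : Set} (x h : J → ℕ) is → sum (map h (copies x is)) ≡ sum (map (λ i → x i * h i) is)
sum-copies x h [] = refl
sum-copies x h (i ∷ is) = trans (cong sum (map-++ h (replicate (x i) i) _))
  (trans (sum-++ (map h (replicate (x i) i)) _) (cong₂ _+_ (const (x i)) (sum-copies x h is)))
  where
  const : ∀ k → sum (map h (replicate k i)) ≡ k * h i
  const zero = refl
  const (suc k) = cong (h i +_) (const k)

typeEq-copies : ∀ {J : Set} m (x : J → ℕ) (τ 𝒯 : J → List (List ℕ)) → (∀ i → TypeMultisetEq (τ i) (𝒯 i)) → ∀ is →
  TypeMultisetEq (concatMap (λ j → map (map (m *_)) (τ j)) (copies x is))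
    (concat (map (λ i → concatMap (λ T → replicate (x i) (map (m *_) T)) (𝒯 i)) is))
typeEq-copies m x τ 𝒯 eq [] = [] , [] , ↭-refl
typeEq-copies m x τ 𝒯 eq (i ∷ is) = subst (λ l → TypeMultisetEq l _)
  (sym (concatMap-++ (λ j → map (map (m *_)) (τ j)) (replicate (x i) i) (copies x is)))
  (typeEq-++ (typeEq-↭ (repeated (x i)) (repeat-↭ (map (m *_)) (x i) (𝒯 i))) (typeEq-copies m x τ 𝒯 eq is))
  where
  repeated : ∀ k → TypeMultisetEq (concatMap (λ j → map (map (m *_)) (τ j)) (replicate k i)) (concat (replicate k (map (map (m *_)) (𝒯 i))))
  repeated zero = [] , [] , ↭-refl
  repeated (suc k) = typeEq-++ (typeEq-scale m (eq i)) (repeated k)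

bit-/2 : ∀ k e → e ≤ 1 → (2 * k + e) / 2 ≡ k
bit-/2 k e e≤1 = trans (cong (_/ 2) (trans (+-comm (2 * k) e) (cong (e +_) (*-comm 2 k))))
  (trans (+-distrib-/-∣ʳ e (divides k refl)) (cong₂ _+_ (small e e≤1) (m*n/n≡m k 2)))
  where
  small : ∀ e → e ≤ 1 → e / 2 ≡ 0
  small zero _ = refl
  small (suc zero) _ = refl
  small (suc (suc _)) (s≤s ())

bit-%2 : ∀ k e → e ≤ 1 → (2 * k + e) % 2 ≡ e
bit-%2 k e e≤1 = trans (cong (_% 2) (trans (+-comm (2 * k) e) (cong (e +_) (*-comm 2 k)))) (trans ([m+kn]%n≡m%n e k 2) (small e e≤1))
  where
  small : ∀ e → e ≤ 1 → e % 2 ≡ e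
  small zero _ = refl
  small (suc zero) _ = refl
  small (suc (suc _)) (s≤s ())

divide-2 : ∀ r → 2 * (r / 2) + r % 2 ≡ r
divide-2 r = trans (+-comm (2 * (r / 2)) _) (trans (cong (r % 2 +_) (*-comm 2 (r / 2))) (sym (m≡m%n+[m/n]*n r 2)))

%2≤1 : ∀ r → r % 2 ≤ 1
%2≤1 r = ≤-pred (m%n<n r 2)

isOdd-copies : ∀ x r → (if isOdd r then x else 0) ≡ x * (r % 2)
isOdd-copies x r with r % 2 | %2≤1 r
... | zero | _ = sym (*-zeroʳ x)
... | suc zero | _ = sym (*-identityʳ x)
... | suc (suc _) | s≤s ()

-- From the hypotheses to the 2-factorization.

module _ (n m' : ℕ) where
  private
    m = suc m'
  open Blowup n m
  open Gluing n m
  open Assembling n m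

  -- A loop would list its vertex twice among the ends.
  loopless : ∀ M → (∀ v → Base.count v (ends M) ≤ 1) → All (λ e → proj₁ e ≢ proj₂ e) M
  loopless [] h = []
  loopless ((u , v) ∷ M) h = (λ { refl → 1+n≰n (≤-trans (≤-reflexive (sym (cong₂ _+_ (Base.δ-refl u) (Base.δ-refl u))))
      (≤-trans (≤-trans (m≤m+n _ _) (≤-reflexive (+-assoc (Base.δ u u) _ _))) (h u))) })
    ∷ loopless M (λ w → ≤-trans (m≤n+m _ (Base.δ v w)) (≤-trans (m≤n+m _ (Base.δ u w)) (h w)))

  copyOf : ∀ κ (D : TwoFactorization (decK n) (verticesK n) (completeMulti n (κ * m)) (κ * m * (n ∸ 1))) →
    Copy κ ((κ * m * (n ∸ 1)) % 2) (TwoFactorization.fType D)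
  copyOf κ D = record
    { theLift = lift n m' κ D.factors D.oneFactor D.allTwoFactors (no-loops parity) D.decomposes
    ; parity = parity
    ; degree = trans (cong (λ k → 2 * k + r % 2) (trans (length-map factorType D.factors) D.numFactors))
        (trans (divide-2 r) (*-assoc κ m (n ∸ 1)))
    }
    where
    module D = TwoFactorization D
    r = κ * m * (n ∸ 1)
    parity : Parity (r % 2) D.oneFactor
    parity = go (r % 2) refl (%2≤1 r)
      where
      go : ∀ ε → r % 2 ≡ ε → ε ≤ 1 → Parity (r % 2) D.oneFactor
      go zero e _ = inj₁ (e , D.evenCase e)
      go (suc zero) e _ = inj₂ (e , D.oddCase e)
      go (suc (suc _)) e (s≤s ())
    no-loops : Parity (r % 2) D.oneFactor → All (λ e → proj₁ e ≢ proj₂ e) D.oneFactor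
    no-loops (inj₁ (_ , none)) = subst (All (λ e → proj₁ e ≢ proj₂ e)) (sym none) []
    no-loops (inj₂ (_ , one)) = loopless D.oneFactor (λ v → ≤-reflexive (oneFactor-everything {D.oneFactor} one v))

  -- Evenness leaves the entry 0 possible. The 2-factor behind admissibility has only cycles of
  -- length at least 2, which makes every entry positive.
  good : ∀ {T} → Bipartite T × Admissible (decNM n m) (verticesNM n m) (completeMultipartite n m 2) T
    × Refinement T (replicate (n / 2) (2 * m)) → Good T
  good {T} (bip , (F , (long , _) , _ , perm) , blocks , blocks↭T , sums) =
    blocks , blocks↭T , All.concat⁻ (All-resp-↭ (↭-sym blocks↭T) (entries bip (All-resp-↭ perm (All.map⁺ long)))) , sums
    where
    entry : ∀ c → c % 2 ≡ 0 → 2 ≤ c → EvenEntry c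
    entry c e 2≤c with m%n≡0⇒n∣m c 2 e
    entry c e 2≤c | divides (suc h) refl = subst EvenEntry (*-comm 2 (suc h)) (even h)
    entry c e () | divides zero refl
    entries : ∀ {T} → Bipartite T → All (2 ≤_) T → All EvenEntry T
    entries [] [] = []
    entries {c ∷ _} (e ∷ es) (l ∷ ls) = entry c e l ∷ entries es ls

  -- The degree equation now yields both the number of 2-factors, by halving, and the parity that
  -- decides whether the pending groups are the 1-factor.
  finish : ∀ {κ e types Ts} → e ≤ 1 → Assembly κ e types Ts →
    Σ (TwoFactorization (decNM n m) (verticesNM n m) (completeMultipartite n m κ) (κ * m * (n ∸ 1))) λ D →
      ∃ λ extra → TwoFactorization.fType D ≡ types ++ extra × Pointwise _↭_ extra Ts
  finish {κ} {e} e≤1 A = record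
    { factors = A.lifted ++ A.extra
    ; oneFactor = concat A.groups
    ; allTwoFactors = All.++⁺ A.two-lifted A.two-extra
    ; numFactors = trans (length-++ A.lifted) (trans (sym (bit-/2 _ e e≤1)) (cong (_/ 2) degree))
    ; oddCase = λ odd → onefactor A.parity (trans (sym odd) r%2≡e)
    ; evenCase = λ ev → none A.parity (trans (sym ev) r%2≡e)
    ; decomposes = λ u v → trans (A.decomposes u v) (cong (_+ mult _≟_ (concat A.groups) u v) (sym (factorsMult-++ A.lifted A.extra u v)))
    } , map factorType A.extra , trans (map-++ factorType A.lifted A.extra) (cong (_++ map factorType A.extra) A.types≡) , A.extra↭
    where
    module A = Assembly A
    degree : 2 * (length A.lifted + length A.extra) + e ≡ κ * m * (n ∸ 1)
    degree = trans A.degree (sym (*-assoc κ m (n ∸ 1)))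
    r%2≡e : (κ * m * (n ∸ 1)) % 2 ≡ e
    r%2≡e = trans (cong (_% 2) (sym degree)) (bit-%2 (length A.lifted + length A.extra) e e≤1)
    onefactor : Parity e A.M → 1 ≡ e → IsOneFactor (verticesNM n m) (concat A.groups)
    onefactor (inj₁ (refl , _)) ()
    onefactor (inj₂ (_ , one)) _ = count≡⇒↭ _ _ (λ a → trans (matched-everything {A.M} one A.matched a) (sym (count-verticesNM a)))
    none : Parity e A.M → 0 ≡ e → concat A.groups ≡ []
    none (inj₂ (refl , _)) ()
    none (inj₁ (_ , M≡)) _ = cong concat (unmatched (subst (λ M → Pointwise Matched M A.groups) M≡ A.matched))

theorem5p5 : (n m ℓ : ℕ) → n % 2 ≡ 0 → 1 ≤ m → 1 ≤ ℓ →
    (μ : Fin ℓ → ℕ) → (∀ i → 1 ≤ μ i) →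
    (𝒯 : Fin ℓ → List (List ℕ)) →
    (∀ i → HasTwoFactorizationOfType (decK n) (verticesK n) (completeMulti n (μ i * m)) (μ i * m * (n ∸ 1)) (𝒯 i)) →
    (λ' : ℕ) → 1 ≤ λ' →
    (x : Fin ℓ → ℕ) → sumFin ℓ (λ i → x i * μ i) ≡ λ' →
    (Ts : List (List ℕ)) →
    length Ts ≡ sumFin ℓ (λ i → if isOdd (μ i * m * (n ∸ 1)) then x i else 0) / 2 →
    All (λ T → Bipartite T × Admissible (decNM n m) (verticesNM n m) (completeMultipartite n m 2) T × Refinement T (replicate (n / 2) (2 * m))) Ts →
    HasTwoFactorizationOfType (decNM n m) (verticesNM n m) (completeMultipartite n m λ')
    (λ' * m * (n ∸ 1))
    (concat (map (λ i → concatMap (λ T → replicate (x i) (map (m *_) T)) (𝒯 i)) (allFin ℓ)) ++ Ts)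
theorem5p5 n (suc m') ℓ _ _ _ μ _ 𝒯 hyp λ' _ x refl Ts len goods =
  let D , extra , types≡ , extra↭ = finish n m' (%2≤1 β) (subst (λ κ → Assembly κ (β % 2) _ Ts) (sum-copies x μ (allFin ℓ))
        (assemble μ ε (λ i → TwoFactorization.fType (proj₁ (hyp i))) (λ i → copyOf n m' (μ i) (proj₁ (hyp i)))
          (copies x (allFin ℓ)) Ts (β % 2) (%2≤1 β) total (All.map (good n m') goods)))
  in D , subst (λ l → TypeMultisetEq l _) (sym types≡)
           (typeEq-++ (typeEq-copies m x _ 𝒯 (λ i → proj₂ (hyp i)) (allFin ℓ)) (Ts , extra↭ , ↭-refl))
  where
  open Assembling n (suc m')
  m = suc m'
  ε : Fin ℓ → ℕ
  ε i = (μ i * m * (n ∸ 1)) % 2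
  β : ℕ
  β = sumFin ℓ (λ i → if isOdd (μ i * m * (n ∸ 1)) then x i else 0)
  -- Both sides are `β`: on the left split into quotient and remainder by 2, on the right as the
  -- number of copies whose degree is odd.
  total : 2 * length Ts + β % 2 ≡ sum (map ε (copies x (allFin ℓ)))
  total = trans (cong (λ k → 2 * k + β % 2) len) (trans (divide-2 β)
    (trans (cong sum (map-cong (λ i → isOdd-copies (x i) (μ i * m * (n ∸ 1))) (allFin ℓ))) (sym (sum-copies x ε (allFin ℓ)))))
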